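{- For every integer $k>0$ there exists a constant $A>0$ such that if $m\geq A\ln\ln n$, then when playing the $(m:1)$ random-Maker game on $E(K_n)$, w.h.p.\ Maker's graph is $k$-vertex-connected (against any strategy of Breaker).
   Context: The $(m:1)$ random-Maker game on the board $E(K_n)$: Maker and Breaker alternately claim previously unclaimed edges of $K_n$, Breaker moving first. In each round Breaker claims one unclaimed edge of his choice, and Maker claims $m$ edges chosen uniformly at random among all unclaimed edges; the game continues until all edges are claimed. "W.h.p." means with probability tending to $1$ as $n\to\infty$. -}

module Defs where

open import Data.Nat using (ℕ; zero; suc; _⊓_) renaming (_<_ to _<ℕ_)
open import Data.Fin using (Fin; toℕ)
open import Data.Fin.Properties using (_<?_)
open import Data.Product using (_×_; _,_; proj₁; proj₂; Σ)
open import Data.Sum using (_⊎_)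
open import Data.List using (List; []; _∷_; [_]; _++_; map; concatMap; length;
  lookup; removeAt; filter; cartesianProduct; allFin)
open import Data.List.Membership.Propositional using (_∈_; _∉_)
open import Data.Integer using (+_)
open import Data.Rational using (ℚ; _/_; _*_; 1ℚ; 0ℚ; _+_)
open import Relation.Nullary using (¬_)

-- Edges of K_n: unordered pairs {i,j}, represented as (i , j) with i < j.
Edge : ℕ → Set
Edge n = Fin n × Fin n

edges : (n : ℕ) → List (Edge n)
edges n = filter (λ p → proj₁ p <? proj₂ p) (cartesianProduct (allFin n) (allFin n))

-- History of the play: list of rounds, each round = (Breaker's edge, Maker's edges).
History : ℕ → Set
History n = List (Edge n × List (Edge n))

-- A (deterministic, history-dependent) Breaker strategy: given the history and the
-- current nonempty list of unclaimed edges u ∷ us, pick the index of an unclaimed edge.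
Strategy : ℕ → Set
Strategy n = History n → (u : Edge n) → (us : List (Edge n)) → Fin (suc (length us))

-- All ways of choosing k elements (as a sub-list, by position) from xs:
-- pairs (chosen , rest).  Each k-subset of a duplicate-free list occurs exactly once.
choices : {A : Set} → ℕ → List A → List (List A × List A)
choices zero xs = [ ([] , xs) ]
choices (suc k) [] = []
choices (suc k) (x ∷ xs) =
  map (λ p → (x ∷ proj₁ p , proj₂ p)) (choices k xs)
  ++ map (λ p → (proj₁ p , x ∷ proj₂ p)) (choices (suc k) xs)

-- uniform weight 1/|xs| of a list (0 for the empty list, never used)
unif : {B : Set} → List B → ℚ
unif [] = 0ℚ
unif (_ ∷ xs) = (+ 1) / suc (length xs)

-- The probability distribution of the final Maker graph in the (m:1) random-Maker
-- game with Breaker strategy S: a list of (probability weight , Maker's edge list)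
-- outcomes.  In each round Breaker claims one unclaimed edge (chosen by S), then Maker
-- claims a uniformly random set of min(m, #unclaimed) of the unclaimed edges.
-- The fuel argument bounds the number of rounds (each round claims ≥ 1 edge).
outcomes : (n m : ℕ) → Strategy n → ℕ → History n → List (Edge n) → List (Edge n)
         → List (ℚ × List (Edge n))
outcomes n m S fuel h M [] = [ (1ℚ , M) ]
outcomes n m S zero h M (u ∷ us) = [ (1ℚ , M) ]
outcomes n m S (suc f) h M (u ∷ us) =
  concatMap (λ c → map (λ o → (proj₁ o * unif C , proj₂ o))
                       (outcomes n m S f (h ++ [ (e , proj₁ c) ]) (M ++ proj₁ c) (proj₂ c)))
            C
  where
  i = S h u us
  e = lookup (u ∷ us) i
  U' = removeAt (u ∷ us) i
  C = choices (m ⊓ length U') U'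

game : (n m : ℕ) → Strategy n → List (ℚ × List (Edge n))
game n m S = outcomes n m S (length (edges n)) [] [] (edges n)

Adj : {n : ℕ} → List (Edge n) → Fin n → Fin n → Set
Adj M u v = ((u , v) ∈ M) ⊎ ((v , u) ∈ M)

-- walks in G - X from u to v (u assumed outside X; all further vertices outside X)
data Reach {n : ℕ} (M : List (Edge n)) (X : List (Fin n)) : Fin n → Fin n → Set where
  here : ∀ {u} → Reach M X u u
  step : ∀ {u w v} → Adj M u w → w ∉ X → Reach M X w v → Reach M X u v

KConnected : (k n : ℕ) → List (Edge n) → Set
KConnected k n M =
  k <ℕ n ×
  ((X : List (Fin n)) → length X <ℕ k →
     (u v : Fin n) → u ∉ X → v ∉ X → Reach M X u v)

sumW : {B : Set} → List (ℚ × B) → ℚ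
sumW [] = 0ℚ
sumW (o ∷ os) = proj₁ o + sumW os

{-# OPTIONS --safe #-}
module Submission where

-- Only the first T = O(n log n) rounds matter, and the failure probability is bounded by the
-- initial value of a potential Φ₁/Z₁ + Φ₂/Z₂ that does not increase on average in a round.
--
-- Φ₁ is a union bound over cuts.  If Maker has no edge between S and V ∖ (S ∪ X), with
-- |X| ≤ k and |S| = s, while at least sn/8 edges of that cut are free, then a single random
-- edge misses the cut with probability at most (1 - 1/(8n))^s; the product over T rounds beats
-- the number n^(s + k) of cuts.
--
-- Such a cut can only be short of free edges if Breaker has degree at least 2θ = n/32 at half
-- of the vertices of S.  Breaker can bring only O(log n) vertices to degree θ.  From then on,
-- in every round in which Breaker plays at such a vertex v, Maker's random edges may give v a
-- new private neighbour (a "head", so that heads of different vertices are distinct).  Before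
-- Breaker reaches degree 2θ, v collects D = 2(k + 1) heads (or has Maker degree n/16) with
-- probability 1 - 2^(-Ω(m)), and m ≥ A log log n suffices for O(log n) vertices: this is Φ₂.
-- Both endpoints of Breaker's edge look for a head in the same round; they never compete as one
-- searches among the first half of the vertices and the other among the second half.
--
-- If S consisted mostly of vertices with D private neighbours, these would not fit into S ∪ X.

-- Against cuts one random edge per round is enough: `T` rounds give a factor `K ^ (- |S|)` with `K`
-- at least `(n + 1) ^ (k + 3)`. Against a single vertex Maker's whole move counts: between Breaker
-- degrees θ and 2θ each attack on an unhappy vertex fails to yield a head with probability at most
-- `4g / (4g + 1)`, where `n ≤ m * g`. The factor `2 ^ (D - c)` is an exponential moment of the
-- number `c` of heads. Its start value `2 ^ D`, like all else that depends on `k`, is absorbed by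
-- log n, so one constant 9216 serves every `k` and only the threshold for `n` grows.
--
-- Maker degree n/16 counts as success because a vertex with many Maker neighbours may run out of
-- free edges to fresh vertices. This does no harm: Maker neighbours of S lie in S ∪ X, so such a
-- vertex occurs only in an S of linear size, of which the O(log n) attacked vertices are a small
-- part.
--
-- Stopping times are replaced by a case distinction: where the potential has reached its limit, the
-- claimed bound is void, so every round may assume that nothing has gone wrong yet.

-- Finite sums, binomial coefficients and uniformly random subsets.

module FiniteSums where

  open import Data.Nat using (ℕ; zero; suc; _+_; _*_; _∸_; _^_; _≤_; _<_; z≤n; s≤s; >-nonZero)
  open import Data.Nat.Properties
  open import Data.Nat.ListAction using (sum)
  open import Data.Nat.ListAction.Properties using (sum-++)
  open import Data.Nat.Tactic.RingSolver using (solve-∀; solve)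
  open import Data.Bool using (Bool; true; false; not)
  open import Data.Fin using (Fin; zero; suc)
  import Data.Fin as Fin
  import Data.Fin.Properties as Fin
  open import Data.List using (List; []; _∷_; _++_; map; length; filter; cartesianProduct; allFin; lookup; removeAt)
  open import Data.List.Properties using (map-++; map-∘; map-tabulate; length-++; length-map; length-tabulate)
  open import Data.List.Membership.Propositional using (_∈_)
  open import Data.List.Membership.Propositional.Properties using (∈-++⁻; ∈-map⁻)
  open import Data.List.Relation.Unary.Any using (here; there)
  open import Data.Product using (_×_; _,_; proj₁; proj₂)
  open import Data.Sum using (_⊎_; inj₁; inj₂)
  open import Function using (_∘_)
  open import Relation.Nullary using (yes; no; does; contradiction)
  open import Relation.Unary using (Decidable)
  open import Relation.Binary.PropositionalEquality using (_≡_; _≢_; refl; sym; trans; cong; cong₂; subst; module ≡-Reasoning)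
  open import Defs using (choices)

  private
    variable
      A B : Set

  -- Inequalities by certificate: `l ≤ r` is a combination of known inequalities, `z` is what they
  -- leave over, and the remaining identity is left to the ring solver.
  ≤-by-slack : ∀ {a b l r} z → l ≤ r → a + r + z ≡ b + l → a ≤ b
  ≤-by-slack {a} {b} {l} {r} z l≤r eq = +-cancelʳ-≤ r a b (begin
    a + r     ≤⟨ m≤m+n (a + r) z ⟩
    a + r + z ≡⟨ eq ⟩
    b + l     ≤⟨ +-monoʳ-≤ b l≤r ⟩
    b + r     ∎)
    where open ≤-Reasoning

  1≤m*n⇒1≤n : ∀ m n → 1 ≤ m * n → 1 ≤ n
  1≤m*n⇒1≤n m zero    1≤ = contradiction (subst (1 ≤_) (*-zeroʳ m) 1≤) λ ()
  1≤m*n⇒1≤n m (suc n) _  = s≤s z≤n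

  ∑ : List A → (A → ℕ) → ℕ
  ∑ xs f = sum (map f xs)

  ∑-mono-∈ : (xs : List A) {f g : A → ℕ} → (∀ {x} → x ∈ xs → f x ≤ g x) → ∑ xs f ≤ ∑ xs g
  ∑-mono-∈ []       f≤g = z≤n
  ∑-mono-∈ (x ∷ xs) f≤g = +-mono-≤ (f≤g (here refl)) (∑-mono-∈ xs (f≤g ∘ there))

  ∑-mono : (xs : List A) {f g : A → ℕ} → (∀ x → f x ≤ g x) → ∑ xs f ≤ ∑ xs g
  ∑-mono xs f≤g = ∑-mono-∈ xs (λ {x} _ → f≤g x)

  ∑-cong : (xs : List A) {f g : A → ℕ} → (∀ x → f x ≡ g x) → ∑ xs f ≡ ∑ xs g
  ∑-cong []       f≡g = refl
  ∑-cong (x ∷ xs) f≡g = cong₂ _+_ (f≡g x) (∑-cong xs f≡g)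

  ∑-+ : (xs : List A) (f g : A → ℕ) → ∑ xs (λ x → f x + g x) ≡ ∑ xs f + ∑ xs g
  ∑-+ []       f g = refl
  ∑-+ (x ∷ xs) f g = trans (cong (f x + g x +_) (∑-+ xs f g)) (interchange (f x) (g x) (∑ xs f) (∑ xs g))
    where
    interchange : ∀ a b c d → a + b + (c + d) ≡ a + c + (b + d)
    interchange = solve-∀

  ∑-*ˡ : (xs : List A) (c : ℕ) (f : A → ℕ) → ∑ xs (λ x → c * f x) ≡ c * ∑ xs f
  ∑-*ˡ []       c f = sym (*-zeroʳ c)
  ∑-*ˡ (x ∷ xs) c f = trans (cong (c * f x +_) (∑-*ˡ xs c f)) (sym (*-distribˡ-+ c (f x) (∑ xs f)))

  ∑-*ʳ : (xs : List A) (f : A → ℕ) (c : ℕ) → ∑ xs (λ x → f x * c) ≡ ∑ xs f * c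
  ∑-*ʳ xs f c = trans (∑-cong xs (λ x → *-comm (f x) c)) (trans (∑-*ˡ xs c f) (*-comm c (∑ xs f)))

  ∑-const : (xs : List A) (c : ℕ) → ∑ xs (λ _ → c) ≡ length xs * c
  ∑-const []       c = refl
  ∑-const (x ∷ xs) c = cong (c +_) (∑-const xs c)

  ∑-zero : (xs : List A) → ∑ xs (λ _ → 0) ≡ 0
  ∑-zero xs = trans (∑-const xs 0) (*-zeroʳ (length xs))

  ∑-one : (xs : List A) → ∑ xs (λ _ → 1) ≡ length xs
  ∑-one xs = trans (∑-const xs 1) (*-identityʳ (length xs))

  ∑-++ : (xs ys : List A) (f : A → ℕ) → ∑ (xs ++ ys) f ≡ ∑ xs f + ∑ ys f
  ∑-++ xs ys f = trans (cong sum (map-++ f xs ys)) (sum-++ (map f xs) (map f ys))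

  ∑-map : (h : A → B) (xs : List A) (f : B → ℕ) → ∑ (map h xs) f ≡ ∑ xs (f ∘ h)
  ∑-map h xs f = cong sum (sym (map-∘ xs))

  ∑-swap : (xs : List A) (ys : List B) (f : A → B → ℕ) →
    ∑ xs (λ x → ∑ ys (f x)) ≡ ∑ ys (λ y → ∑ xs (λ x → f x y))
  ∑-swap []       ys f = sym (∑-zero ys)
  ∑-swap (x ∷ xs) ys f = trans (cong (∑ ys (f x) +_) (∑-swap xs ys f))
                               (sym (∑-+ ys (f x) (λ y → ∑ xs (λ z → f z y))))

  ∈⇒≤∑ : {xs : List A} {x : A} (f : A → ℕ) → x ∈ xs → f x ≤ ∑ xs f
  ∈⇒≤∑ f (here refl) = m≤m+n _ _
  ∈⇒≤∑ {xs = y ∷ _} f (there x∈xs) = ≤-trans (∈⇒≤∑ f x∈xs) (m≤n+m _ (f y))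

  ∑-cartesianProduct : (xs : List A) (ys : List B) (f : A × B → ℕ) →
    ∑ (cartesianProduct xs ys) f ≡ ∑ xs (λ x → ∑ ys (λ y → f (x , y)))
  ∑-cartesianProduct []       ys f = refl
  ∑-cartesianProduct (x ∷ xs) ys f =
    trans (∑-++ (map (x ,_) ys) _ f) (cong₂ _+_ (∑-map (x ,_) ys f) (∑-cartesianProduct xs ys f))

  ind : Bool → ℕ
  ind true  = 1
  ind false = 0

  ind≤1 : ∀ b → ind b ≤ 1
  ind≤1 true  = ≤-refl
  ind≤1 false = z≤n

  ∑-filter : {P : A → Set} (P? : Decidable P) (xs : List A) (f : A → ℕ) →
    ∑ (filter P? xs) f ≡ ∑ xs (λ x → ind (does (P? x)) * f x)
  ∑-filter P? []       f = refl
  ∑-filter P? (x ∷ xs) f with does (P? x)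
  ... | true  = cong₂ _+_ (sym (+-identityʳ (f x))) (∑-filter P? xs f)
  ... | false = ∑-filter P? xs f

  ∑-removeAt : (xs : List A) (i : Fin (length xs)) (f : A → ℕ) →
    f (lookup xs i) + ∑ (removeAt xs i) f ≡ ∑ xs f
  ∑-removeAt (x ∷ xs) zero    f = refl
  ∑-removeAt (x ∷ xs) (suc i) f = begin
    f (lookup xs i) + (f x + ∑ (removeAt xs i) f) ≡⟨ solve-swap (f (lookup xs i)) (f x) (∑ (removeAt xs i) f) ⟩
    f x + (f (lookup xs i) + ∑ (removeAt xs i) f) ≡⟨ cong (f x +_) (∑-removeAt xs i f) ⟩
    f x + ∑ xs f                                  ∎
    where
    open ≡-Reasoning
    solve-swap : ∀ a b c → a + (b + c) ≡ b + (a + c)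
    solve-swap = solve-∀

  -- Sums over the vertices

  ∑ᶠ : ∀ n → (Fin n → ℕ) → ℕ
  ∑ᶠ n f = ∑ (allFin n) f

  ∑ᶠ-suc : ∀ n (f : Fin (suc n) → ℕ) → ∑ᶠ (suc n) f ≡ f zero + ∑ᶠ n (f ∘ suc)
  ∑ᶠ-suc n f = cong (f zero +_) (cong sum
    (trans (map-tabulate suc f) (sym (map-tabulate (λ i → i) (f ∘ suc)))))

  ∑ᶠ-one : ∀ n → ∑ᶠ n (λ _ → 1) ≡ n
  ∑ᶠ-one n = trans (∑-one (allFin n)) (length-tabulate (λ i → i))

  δ : ∀ {n} → Fin n → Fin n → ℕ
  δ v w = ind (does (v Fin.≟ w))

  δ-refl : ∀ {n} (v : Fin n) → δ v v ≡ 1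
  δ-refl v with v Fin.≟ v
  ... | yes _  = refl
  ... | no v≢v = contradiction refl v≢v

  δ-≢ : ∀ {n} {v w : Fin n} → v ≢ w → δ v w ≡ 0
  δ-≢ {v = v} {w} v≢w with v Fin.≟ w
  ... | yes v≡w = contradiction v≡w v≢w
  ... | no _    = refl

  δ-suc : ∀ {n} (v w : Fin n) → δ (Fin.suc v) (suc w) ≡ δ v w
  δ-suc v w with v Fin.≟ w
  ... | yes _ = refl
  ... | no  _ = refl

  ∑-δ : ∀ {n} (w : Fin n) (f : Fin n → ℕ) → ∑ᶠ n (λ v → δ v w * f v) ≡ f w
  ∑-δ {suc n} zero f = begin
    ∑ᶠ (suc n) (λ v → δ v zero * f v) ≡⟨ ∑ᶠ-suc n _ ⟩
    f zero + 0 + ∑ᶠ n (λ v → 0)       ≡⟨ cong₂ _+_ (+-identityʳ (f zero)) (∑-zero (allFin n)) ⟩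
    f zero + 0                        ≡⟨ +-identityʳ (f zero) ⟩
    f zero                            ∎
    where open ≡-Reasoning
  ∑-δ {suc n} (suc w) f = begin
    ∑ᶠ (suc n) (λ v → δ v (suc w) * f v)       ≡⟨ ∑ᶠ-suc n (λ v → δ v (suc w) * f v) ⟩
    ∑ᶠ n (λ v → δ (suc v) (suc w) * f (suc v)) ≡⟨ ∑-cong (allFin n) (λ v → cong (_* f (suc v)) (δ-suc v w)) ⟩
    ∑ᶠ n (λ v → δ v w * f (suc v))             ≡⟨ ∑-δ w (f ∘ suc) ⟩
    f (suc w)                                  ∎
    where open ≡-Reasoning

  ∑-δ₁ : ∀ {n} (w : Fin n) → ∑ᶠ n (λ v → δ v w) ≡ 1
  ∑-δ₁ w = trans (∑-cong (allFin _) (λ v → sym (*-identityʳ (δ v w)))) (∑-δ w (λ _ → 1))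

  below : ∀ {n} → ℕ → Fin n → Bool
  below zero    _       = false
  below (suc h) zero    = true
  below (suc h) (suc v) = below h v

  ∑-below : ∀ n h → h ≤ n → ∑ᶠ n (ind ∘ below h) ≡ h
  ∑-below n zero _ = ∑-zero (allFin n)
  ∑-below (suc n) (suc h) (s≤s h≤n) = trans (∑ᶠ-suc n (ind ∘ below (suc h))) (cong suc (∑-below n h h≤n))

  ind-not : ∀ b → ind b + ind (not b) ≡ 1
  ind-not true  = refl
  ind-not false = refl

  ∑-not-below : ∀ n h → h ≤ n → ∑ᶠ n (λ v → ind (not (below h v))) ≡ n ∸ h
  ∑-not-below n h h≤n = sym (trans (cong (_∸ h) n≡) (m+n∸m≡n h _))
    where
    open ≡-Reasoning
    g : Fin n → ℕ
    g v = ind (not (below h v))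
    n≡ : n ≡ h + ∑ᶠ n g
    n≡ = begin
      n                                 ≡⟨ ∑ᶠ-one n ⟨
      ∑ᶠ n (λ _ → 1)                    ≡⟨ ∑-cong (allFin n) (λ v → ind-not (below h v)) ⟨
      ∑ᶠ n (λ v → ind (below h v) + g v) ≡⟨ ∑-+ (allFin n) _ g ⟩
      ∑ᶠ n (ind ∘ below h) + ∑ᶠ n g     ≡⟨ cong (_+ ∑ᶠ n g) (∑-below n h h≤n) ⟩
      h + ∑ᶠ n g                        ∎

  -- Random subsets

  bin : ℕ → ℕ → ℕ
  bin zero    _       = 1
  bin (suc k) zero    = 0
  bin (suc k) (suc n) = bin k n + bin (suc k) n

  bin-pos : ∀ {k n} → k ≤ n → 1 ≤ bin k n
  bin-pos {zero} _ = ≤-refl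
  bin-pos {suc k} {suc n} (s≤s k≤n) = ≤-trans (bin-pos k≤n) (m≤m+n _ _)

  -- The absorption law `(k + 1) C(n, k + 1) = (n - k) C(n, k)` with the subtracted term moved to
  -- the left.
  bin-absorb : ∀ k n → bin (suc k) n * suc k + bin k n * k ≡ bin k n * n
  bin-absorb zero    zero    = refl
  bin-absorb (suc k) zero    = refl
  bin-absorb zero (suc n) = begin
    (1 + bin 1 n) * 1 + 0 ≡⟨ r (bin 1 n) ⟩
    suc (bin 1 n * 1 + 0) ≡⟨ cong suc (bin-absorb zero n) ⟩
    suc (1 * n)           ≡⟨ solve (n ∷ []) ⟩
    1 * suc n             ∎
    where
    open ≡-Reasoning
    r : ∀ b → (1 + b) * 1 + 0 ≡ suc (b * 1 + 0)
    r = solve-∀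
  bin-absorb (suc k) (suc n) = begin
    (b + c) * suc (suc k) + (a + b) * suc k                   ≡⟨ regroup a b c k ⟩
    (c * suc (suc k) + b * suc k) + (b * suc k + a * k) + a + b ≡⟨ cong₂ (λ p q → p + q + a + b) (bin-absorb (suc k) n) (bin-absorb k n) ⟩
    b * n + a * n + a + b                                     ≡⟨ collect a b n ⟩
    (a + b) * suc n                                           ∎
    where
    open ≡-Reasoning
    a = bin k n
    b = bin (suc k) n
    c = bin (suc (suc k)) n
    regroup : ∀ a b c k → (b + c) * suc (suc k) + (a + b) * suc k ≡
                          (c * suc (suc k) + b * suc k) + (b * suc k + a * k) + a + b
    regroup = solve-∀
    collect : ∀ a b n → b * n + a * n + a + b ≡ (a + b) * suc n
    collect = solve-∀

  -- After division by `bin k v` and `bin k u` this is `(v - k) u ≤ (u - k) v`, that is,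
  -- `k v ≤ k u`.
  bin-ratio-step : ∀ k {v u} → v ≤ u → bin (suc k) v * (u * bin k u) ≤ bin (suc k) u * (v * bin k v)
  bin-ratio-step k {v} {u} v≤u = *-cancelʳ-≤ _ _ (suc k)
    (≤-by-slack 0 (*-monoʳ-≤ (bin k v * (bin k u * k)) v≤u) identity)
    where
    open ≡-Reasoning
    BV = bin (suc k) v
    BU = bin (suc k) u
    bv = bin k v
    bu = bin k u
    r₁ : ∀ BV bv bu k u → BV * (u * bu) * suc k + bv * (bu * k) * u + 0 ≡ (BV * suc k + bv * k) * (u * bu)
    r₁ = solve-∀
    r₂ : ∀ BU bv bu k v → BU * (v * bv) * suc k + bv * (bu * k) * v ≡ (BU * suc k + bu * k) * (v * bv)
    r₂ = solve-∀
    r₃ : ∀ bv bu u v → bv * v * (u * bu) ≡ bu * u * (v * bv)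
    r₃ = solve-∀
    identity : BV * (u * bu) * suc k + bv * (bu * k) * u + 0 ≡ BU * (v * bv) * suc k + bv * (bu * k) * v
    identity = begin
      BV * (u * bu) * suc k + bv * (bu * k) * u + 0 ≡⟨ r₁ BV bv bu k u ⟩
      (BV * suc k + bv * k) * (u * bu)              ≡⟨ cong (_* (u * bu)) (bin-absorb k v) ⟩
      bv * v * (u * bu)                             ≡⟨ r₃ bv bu u v ⟩
      bu * u * (v * bv)                             ≡⟨ cong (_* (v * bv)) (bin-absorb k u) ⟨
      (BU * suc k + bu * k) * (v * bv)              ≡⟨ r₂ BU bv bu k v ⟨
      BU * (v * bv) * suc k + bv * (bu * k) * v     ∎

  bin-zero : ∀ {k n} → n < k → bin k n ≡ 0
  bin-zero {suc k} {zero}  _         = refl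
  bin-zero {suc k} {suc n} (s≤s n<k) = cong₂ _+_ (bin-zero n<k) (bin-zero (m<n⇒m<1+n n<k))

  -- Drawing without replacement misses a set at most as often as drawing with replacement: each
  -- factor `(v - i) / (u - i)` is at most `v / u`.
  bin-ratio : ∀ k {v u} → v ≤ u → bin k v * u ^ k ≤ bin k u * v ^ k
  bin-ratio zero    v≤u = ≤-refl
  bin-ratio (suc k) {v} {u} v≤u with k ≤? u
  -- For `k > u` the binomial `bin k u` to be cancelled vanishes, but so does the left side.
  ... | no k≰u = ≤-trans (≤-reflexive (cong (_* u ^ suc k) (bin-zero (≤-<-trans v≤u (m<n⇒m<1+n (≰⇒> k≰u)))))) z≤n
  ... | yes k≤u = *-cancelʳ-≤ _ _ (bin k u) {{>-nonZero (bin-pos k≤u)}} (begin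
    bin (suc k) v * (u * u ^ k) * bin k u  ≡⟨ r₁ (bin (suc k) v) u (u ^ k) (bin k u) ⟩
    bin (suc k) v * (u * bin k u) * u ^ k  ≤⟨ *-monoˡ-≤ (u ^ k) (bin-ratio-step k v≤u) ⟩
    bin (suc k) u * (v * bin k v) * u ^ k  ≡⟨ r₂ (bin (suc k) u) v (bin k v) (u ^ k) ⟩
    bin (suc k) u * v * (bin k v * u ^ k)  ≤⟨ *-monoʳ-≤ (bin (suc k) u * v) (bin-ratio k v≤u) ⟩
    bin (suc k) u * v * (bin k u * v ^ k)  ≡⟨ r₃ (bin (suc k) u) v (bin k u) (v ^ k) ⟩
    bin (suc k) u * (v * v ^ k) * bin k u  ∎)
    where
    open ≤-Reasoning
    r₁ : ∀ a b c d → a * (b * c) * d ≡ a * (b * d) * c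
    r₁ = solve-∀
    r₂ : ∀ a b c d → a * (b * c) * d ≡ a * b * (c * d)
    r₂ = solve-∀
    r₃ : ∀ a b c d → a * b * (c * d) ≡ a * (b * d) * c
    r₃ = solve-∀

  length-choices : ∀ k (xs : List A) → length (choices k xs) ≡ bin k (length xs)
  length-choices zero    xs       = refl
  length-choices (suc k) []       = refl
  length-choices (suc k) (x ∷ xs) = trans (length-++ (map _ (choices k xs)))
    (cong₂ _+_ (trans (length-map _ (choices k xs)) (length-choices k xs))
               (trans (length-map _ (choices (suc k) xs)) (length-choices (suc k) xs)))

  ∑-choices : ∀ k (xs : List A) {c} → c ∈ choices k xs → (f : A → ℕ) → ∑ (proj₁ c) f + ∑ (proj₂ c) f ≡ ∑ xs f
  ∑-choices zero    xs (here refl) f = refl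
  ∑-choices (suc k) (x ∷ xs) c∈ f with ∈-++⁻ (map _ (choices k xs)) c∈
  ... | inj₁ c∈₁ with c′ , c′∈ , refl ← ∈-map⁻ _ c∈₁ =
    trans (+-assoc (f x) _ _) (cong (f x +_) (∑-choices k xs c′∈ f))
  ... | inj₂ c∈₂ with c′ , c′∈ , refl ← ∈-map⁻ _ c∈₂ =
    trans (swap (∑ (proj₁ c′) f) (f x) (∑ (proj₂ c′) f)) (cong (f x +_) (∑-choices (suc k) xs c′∈ f))
    where
    swap : ∀ a b c → a + (b + c) ≡ b + (a + c)
    swap = solve-∀

  ∑-unchosen≤ : ∀ k (xs : List A) {c} → c ∈ choices k xs → (f : A → ℕ) → ∑ (proj₂ c) f ≤ ∑ xs f
  ∑-unchosen≤ k xs {c} c∈ f = subst (∑ (proj₂ c) f ≤_) (∑-choices k xs c∈ f) (m≤n+m (∑ (proj₂ c) f) (∑ (proj₁ c) f))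

  cnt : (A → Bool) → List A → ℕ
  cnt P xs = ∑ xs (ind ∘ P)

  -- A number rather than a truth value, so that its sum over `choices` is the number of moves that
  -- miss `P`.
  avoid : (A → Bool) → List A → ℕ
  avoid P []       = 1
  avoid P (x ∷ xs) = ind (not (P x)) * avoid P xs

  avoid-dichotomy : (P : A → Bool) (xs : List A) →
    (avoid P xs ≡ 1 × cnt P xs ≡ 0) ⊎ (avoid P xs ≡ 0 × 1 ≤ cnt P xs)
  avoid-dichotomy P [] = inj₁ (refl , refl)
  avoid-dichotomy P (x ∷ xs) with P x
  ... | true  = inj₂ (refl , s≤s z≤n)
  ... | false with avoid-dichotomy P xs
  ...   | inj₁ (a , c) = inj₁ (trans (+-identityʳ _) a , c)
  ...   | inj₂ (a , c) = inj₂ (trans (+-identityʳ _) a , c)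

  ∑-avoid : (P : A → Bool) → ∀ k (xs : List A) →
    ∑ (choices k xs) (avoid P ∘ proj₁) ≡ bin k (cnt (not ∘ P) xs)
  ∑-avoid P zero xs = refl
  ∑-avoid P (suc k) [] = refl
  ∑-avoid P (suc k) (x ∷ xs) = trans (trans (∑-++ (map _ (choices k xs)) _ _)
    (cong₂ _+_ (trans (∑-map _ (choices k xs) _) (∑-*ˡ (choices k xs) (ind (not (P x))) _))
               (∑-map _ (choices (suc k) xs) _)))
    (trans (cong₂ _+_ (cong (ind (not (P x)) *_) (∑-avoid P k xs)) (∑-avoid P (suc k) xs)) split)
    where
    split : ind (not (P x)) * bin k (cnt (not ∘ P) xs) + bin (suc k) (cnt (not ∘ P) xs)
          ≡ bin (suc k) (ind (not (P x)) + cnt (not ∘ P) xs)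
    split with P x
    ... | true  = refl
    ... | false = cong (_+ bin (suc k) (cnt (not ∘ P) xs)) (+-identityʳ (bin k (cnt (not ∘ P) xs)))

  cnt-not : (P : A → Bool) (xs : List A) → cnt (not ∘ P) xs + cnt P xs ≡ length xs
  cnt-not P xs = trans (sym (∑-+ xs _ _))
    (trans (∑-cong xs (λ x → trans (+-comm (ind (not (P x))) _) (ind-not (P x)))) (∑-one xs))

  module _ (P : A → Bool) (r : ℕ) (xs : List A) where

    private
      u v f miss total : ℕ
      u = length xs
      v = cnt (not ∘ P) xs
      f = cnt P xs
      miss = ∑ (choices r xs) (avoid P ∘ proj₁)
      total = length (choices r xs)
      v+f≡u : v + f ≡ u
      v+f≡u = cnt-not P xs
      v≤u : v ≤ u
      v≤u = subst (v ≤_) v+f≡u (m≤m+n v f)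

      miss-ratio : miss * u ^ r ≤ total * v ^ r
      miss-ratio = subst (λ z → z * u ^ r ≤ total * v ^ r) (sym (∑-avoid P r xs))
        (subst (λ z → bin r v * u ^ r ≤ z * v ^ r) (sym (length-choices r xs)) (bin-ratio r v≤u))

    -- Of the `r` factors `v / u` in the probability of a miss a single one is kept; the others are
    -- bounded by 1.
    miss-linear : 1 ≤ r → 1 ≤ length xs → miss * length xs + total * cnt P xs ≤ total * length xs
    miss-linear (s≤s {n = r′} _) 1≤u = begin
      miss * u + total * f ≤⟨ +-monoˡ-≤ (total * f) miss*u≤ ⟩
      total * v + total * f ≡⟨ *-distribˡ-+ total v f ⟨
      total * (v + f)       ≡⟨ cong (total *_) v+f≡u ⟩
      total * u             ∎
      where
      open ≤-Reasoning
      instance _ = >-nonZero 1≤u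
      miss*u≤ : miss * u ≤ total * v
      miss*u≤ = *-cancelʳ-≤ _ _ (u ^ r′) {{m^n≢0 u r′}} (begin
        miss * u * u ^ r′    ≡⟨ *-assoc miss u (u ^ r′) ⟩
        miss * u ^ suc r′    ≤⟨ miss-ratio ⟩
        total * v ^ suc r′   ≤⟨ *-monoʳ-≤ total (*-monoʳ-≤ v (^-monoˡ-≤ r′ v≤u)) ⟩
        total * (v * u ^ r′) ≡⟨ *-assoc total v (u ^ r′) ⟨
        total * v * u ^ r′   ∎)

    -- (1 - f/u)^r ≤ 1/(1 + rf/u), cleared of denominators.
    miss-harmonic : 1 ≤ length xs → miss * (length xs + r * cnt P xs) ≤ total * length xs
    miss-harmonic 1≤u = *-cancelʳ-≤ _ _ (u ^ r) {{m^n≢0 u r}} (begin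
      miss * (u + r * f) * u ^ r    ≡⟨ r₁ miss (u + r * f) (u ^ r) ⟩
      miss * u ^ r * (u + r * f)    ≤⟨ *-monoˡ-≤ (u + r * f) miss-ratio ⟩
      total * v ^ r * (u + r * f)   ≡⟨ *-assoc total (v ^ r) (u + r * f) ⟩
      total * (v ^ r * (u + r * f)) ≤⟨ *-monoʳ-≤ total (power r) ⟩
      total * (u ^ r * u)           ≡⟨ r₂ total (u ^ r) u ⟩
      total * u * u ^ r             ∎)
      where
      open ≤-Reasoning
      instance _ = >-nonZero 1≤u
      r₁ : ∀ a b c → a * b * c ≡ a * c * b
      r₁ = solve-∀
      r₂ : ∀ a b c → a * (b * c) ≡ a * c * b
      r₂ = solve-∀
      r₃ : ∀ u f → 1 * (u + 0 * f) ≡ 1 * u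
      r₃ = solve-∀
      r₄ : ∀ v f i → v * (v + f + suc i * f) + suc i * f * f ≡ (v + f) * (v + f + i * f)
      r₄ = solve-∀
      r₅ : ∀ v p x → v * p * x ≡ p * (v * x)
      r₅ = solve-∀
      r₆ : ∀ p u x → p * (u * x) ≡ u * (p * x)
      r₆ = solve-∀
      -- With `p = f / u` the induction step is `(1 - p) (1 + (i + 1) p) ≤ 1 + i p`; the two sides
      -- differ by `(i + 1) p ^ 2`.
      power : ∀ i → v ^ i * (u + i * f) ≤ u ^ i * u
      power zero    = ≤-reflexive (r₃ u f)
      power (suc i) = begin
        v * v ^ i * (u + suc i * f)       ≡⟨ r₅ v (v ^ i) (u + suc i * f) ⟩
        v ^ i * (v * (u + suc i * f))     ≤⟨ *-monoʳ-≤ (v ^ i) (m+n≤o⇒m≤o _ (≤-reflexive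
            (subst (λ u → v * (u + suc i * f) + suc i * f * f ≡ u * (u + i * f)) v+f≡u (r₄ v f i)))) ⟩
        v ^ i * (u * (u + i * f))         ≡⟨ r₆ (v ^ i) u (u + i * f) ⟩
        u * (v ^ i * (u + i * f))         ≤⟨ *-monoʳ-≤ u (power i) ⟩
        u * (u ^ i * u)                   ≡⟨ *-assoc u (u ^ i) u ⟨
        u * u ^ i * u                     ∎

-- Weighted outcome lists and the averaging principle for potentials.

module Probability where

  open FiniteSums
  open import Data.Nat as ℕ using (ℕ; suc; z≤n)
  import Data.Nat.Properties as ℕ
  import Data.Integer as ℤ
  import Data.Integer.Properties as ℤ
  open import Data.Integer using (+_)
  open import Data.Rational as ℚ using (ℚ; 0ℚ; 1ℚ; _+_; _*_; _-_; -_; _/_; _≤_; toℚᵘ; NonNegative; Positive)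
  open import Data.Rational.Properties as ℚ
  import Data.Rational.Unnormalised as ℚᵘ
  import Data.Rational.Unnormalised.Properties as ℚᵘ
  open import Data.Rational.Solver using (module +-*-Solver)
  open import Data.List using (List; []; _∷_; [_]; _++_; map; concatMap; length)
  open import Data.List.Membership.Propositional using (_∈_)
  open import Data.List.Relation.Unary.Any using (here; there)
  open import Data.List.Relation.Unary.All using (All; []; _∷_)
  open import Data.List.Relation.Unary.All.Properties using (++⁺; map⁺)
  open import Data.List.Relation.Binary.Sublist.Propositional using (_⊆_; []; ⊆-refl; minimum)
  import Data.List.Relation.Binary.Sublist.Propositional.Properties as Sub
  open import Data.Product using (Σ; _×_; _,_; proj₁; proj₂)
  open import Function using (_∘_)
  open import Relation.Binary.PropositionalEquality using (_≡_; refl; sym; trans; cong; cong₂; module ≡-Reasoning)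
  open import Defs using (unif; sumW)

  private
    variable
      A B : Set

  abstract
    -- Opaque, so that fractions are never normalised during type checking; only the laws proved
    -- here are available outside.
    ι : ℕ → ℚ
    ι n = + n / 1

    ιᵘ : ∀ n → toℚᵘ (ι n) ℚᵘ.≃ ℚᵘ.mkℚᵘ (+ n) 0
    ιᵘ n = toℚᵘ-fromℚᵘ (ℚᵘ.mkℚᵘ (+ n) 0)

    ι-+ : ∀ m n → ι (m ℕ.+ n) ≡ ι m + ι n
    ι-+ m n = toℚᵘ-injective (begin
      toℚᵘ (ι (m ℕ.+ n))                                  ≈⟨ ιᵘ (m ℕ.+ n) ⟩
      ℚᵘ.mkℚᵘ (+ (m ℕ.+ n)) 0                             ≈⟨ ℚᵘ.*≡* (cong (ℤ._* + 1) (sym (cong₂ ℤ._+_ (ℤ.*-identityʳ (+ m)) (ℤ.*-identityʳ (+ n))))) ⟩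
      ℚᵘ.mkℚᵘ (+ m) 0 ℚᵘ.+ ℚᵘ.mkℚᵘ (+ n) 0                ≈⟨ ℚᵘ.+-cong (ιᵘ m) (ιᵘ n) ⟨
      toℚᵘ (ι m) ℚᵘ.+ toℚᵘ (ι n)                          ≈⟨ toℚᵘ-homo-+ (ι m) (ι n) ⟨
      toℚᵘ (ι m + ι n)                                    ∎)
      where open ℚᵘ.≃-Reasoning

    ι-* : ∀ m n → ι (m ℕ.* n) ≡ ι m * ι n
    ι-* m n = toℚᵘ-injective (begin
      toℚᵘ (ι (m ℕ.* n))                   ≈⟨ ιᵘ (m ℕ.* n) ⟩
      ℚᵘ.mkℚᵘ (+ (m ℕ.* n)) 0              ≈⟨ ℚᵘ.*≡* (cong (ℤ._* + 1) (ℤ.pos-* m n)) ⟩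
      ℚᵘ.mkℚᵘ (+ m) 0 ℚᵘ.* ℚᵘ.mkℚᵘ (+ n) 0 ≈⟨ ℚᵘ.*-cong (ιᵘ m) (ιᵘ n) ⟨
      toℚᵘ (ι m) ℚᵘ.* toℚᵘ (ι n)           ≈⟨ toℚᵘ-homo-* (ι m) (ι n) ⟨
      toℚᵘ (ι m * ι n)                     ∎)
      where open ℚᵘ.≃-Reasoning

    ι-mono : ∀ {m n} → m ℕ.≤ n → ι m ≤ ι n
    ι-mono {m} {n} m≤n = toℚᵘ-cancel-≤ (begin
      toℚᵘ (ι m)      ≃⟨ ιᵘ m ⟩
      ℚᵘ.mkℚᵘ (+ m) 0 ≤⟨ ℚᵘ.*≤* (ℤ.*-monoʳ-≤-nonNeg (+ 1) (ℤ.+≤+ m≤n)) ⟩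
      ℚᵘ.mkℚᵘ (+ n) 0 ≃⟨ ιᵘ n ⟨
      toℚᵘ (ι n)      ∎)
      where open ℚᵘ.≤-Reasoning

    ι-pos : ∀ {n} → 1 ℕ.≤ n → Positive (ι n)
    ι-pos {suc n} _ = normalize-pos (suc n) 1

    ι-inverse : ∀ n → ι (suc n) * (+ 1 / suc n) ≡ 1ℚ
    ι-inverse n = toℚᵘ-injective (begin
      toℚᵘ (ι (suc n) * (+ 1 / suc n))           ≈⟨ toℚᵘ-homo-* (ι (suc n)) (+ 1 / suc n) ⟩
      toℚᵘ (ι (suc n)) ℚᵘ.* toℚᵘ (+ 1 / suc n)   ≈⟨ ℚᵘ.*-cong (ιᵘ (suc n)) (toℚᵘ-fromℚᵘ (ℚᵘ.mkℚᵘ (+ 1) n)) ⟩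
      ℚᵘ.mkℚᵘ (+ suc n) 0 ℚᵘ.* ℚᵘ.mkℚᵘ (+ 1) n   ≈⟨ ℚᵘ.*≡* (trans (ℤ.*-identityʳ _) (trans (ℤ.*-identityʳ _)
                                                     (sym (trans (ℤ.*-identityˡ _) (cong +_ (ℕ.+-identityʳ (suc n))))))) ⟩
      toℚᵘ 1ℚ                                    ∎)
      where open ℚᵘ.≃-Reasoning

    ι-0 : ι 0 ≡ 0ℚ
    ι-0 = refl

    ι-1 : ι 1 ≡ 1ℚ
    ι-1 = refl

  abstract
    unif-nonNeg : (C : List A) → NonNegative (unif C)
    unif-nonNeg []       = _
    unif-nonNeg (x ∷ xs) = normalize-nonNeg 1 (suc (length xs))

    unif-inverse : (C : List A) → 1 ℕ.≤ length C → ι (length C) * unif C ≡ 1ℚ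
    unif-inverse (x ∷ xs) _ = ι-inverse (length xs)

  sumW-++ : (xs ys : List (ℚ × B)) → sumW (xs ++ ys) ≡ sumW xs + sumW ys
  sumW-++ []       ys = sym (+-identityˡ _)
  sumW-++ (x ∷ xs) ys = trans (cong (λ z → proj₁ x + z) (sumW-++ xs ys)) (sym (+-assoc (proj₁ x) _ _))

  scale : ℚ → ℚ × B → ℚ × B
  scale q o = proj₁ o * q , proj₂ o

  sumW-scale : (q : ℚ) (xs : List (ℚ × B)) → sumW (map (scale q) xs) ≡ sumW xs * q
  sumW-scale q []       = sym (*-zeroˡ q)
  sumW-scale q (x ∷ xs) = trans (cong (λ z → proj₁ x * q + z) (sumW-scale q xs)) (sym (*-distribʳ-+ q (proj₁ x) (sumW xs)))

  -- Φ / W bounds the probability that Q fails; the inequality is kept free of divisions.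
  record Likely (Q : B → Set) (W : ℕ) (outs : List (ℚ × B)) (Φ : ℕ) : Set where
    constructor likely
    field
      good   : List (ℚ × B)
      good⊆  : good ⊆ outs
      allQ   : All (Q ∘ proj₂) good
      weight : ι W ≤ ι Φ + ι W * sumW good

  module _ {Q : B → Set} {W : ℕ} where

    -- A failure bound of at least 1 says nothing, so the empty list of good outcomes will do. This
    -- disposes of every state whose potential has reached its limit.
    Likely-trivial : (outs : List (ℚ × B)) {Φ : ℕ} → W ℕ.≤ Φ → Likely Q W outs Φ
    Likely-trivial outs {Φ} W≤Φ = likely [] (minimum outs) [] (begin
      ι W            ≤⟨ ι-mono W≤Φ ⟩
      ι Φ            ≡⟨ +-identityʳ (ι Φ) ⟨
      ι Φ + 0ℚ       ≡⟨ cong (λ z → ι Φ + z) (*-zeroʳ (ι W)) ⟨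
      ι Φ + ι W * 0ℚ ∎)
      where open ≤-Reasoning

    Likely-sure : {b : B} {Φ : ℕ} → Q b → Likely Q W [ (1ℚ , b) ] Φ
    Likely-sure {b} {Φ} Qb = likely [ (1ℚ , b) ] ⊆-refl (Qb ∷ []) (begin
      ι W                     ≡⟨ +-identityˡ (ι W) ⟨
      0ℚ + ι W                ≡⟨ cong (_+ ι W) ι-0 ⟨
      ι 0 + ι W               ≤⟨ +-monoˡ-≤ (ι W) (ι-mono {n = Φ} z≤n) ⟩
      ι Φ + ι W               ≡⟨ cong (λ z → ι Φ + z) (*-identityʳ (ι W)) ⟨
      ι Φ + ι W * (1ℚ + 0ℚ)   ∎)
      where open ≤-Reasoning

    Likely-mono : {outs : List (ℚ × B)} {Φ Φ′ : ℕ} → Φ ℕ.≤ Φ′ → Likely Q W outs Φ → Likely Q W outs Φ′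
    Likely-mono Φ≤Φ′ (likely g g⊆ q w) = likely g g⊆ q (≤-trans w (+-monoˡ-≤ _ (ι-mono Φ≤Φ′)))

    private
      -- The induction runs over the tails of Maker's list of choices, whereas the weight of a
      -- branch is the reciprocal of the full length; hence `q` stays a parameter.
      mix : (q : ℚ) .{{_ : NonNegative q}} (outs : A → List (ℚ × B)) (Φ : A → ℕ) (cs : List A) →
        (∀ {c} → c ∈ cs → Likely Q W (outs c) (Φ c)) →
        Σ (List (ℚ × B)) λ good → good ⊆ concatMap (λ c → map (scale q) (outs c)) cs ×
          All (Q ∘ proj₂) good × ι (length cs) * q * ι W ≤ ι (∑ cs Φ) * q + ι W * sumW good
      mix q outs Φ [] _ = [] , [] , [] , ≤-reflexive (begin
        ι 0 * q * ι W       ≡⟨ cong (λ z → z * q * ι W) ι-0 ⟩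
        0ℚ * q * ι W        ≡⟨ cong (_* ι W) (*-zeroˡ q) ⟩
        0ℚ * ι W            ≡⟨ *-comm 0ℚ (ι W) ⟩
        ι W * 0ℚ            ≡⟨ +-identityˡ (ι W * 0ℚ) ⟨
        0ℚ + ι W * 0ℚ       ≡⟨ cong (_+ ι W * 0ℚ) (trans (cong (_* q) ι-0) (*-zeroˡ q)) ⟨
        ι 0 * q + ι W * 0ℚ  ∎)
        where open ≡-Reasoning
      mix q outs Φ (c ∷ cs) L with L (here refl) | mix q outs Φ cs (L ∘ there)
      ... | likely g g⊆ gQ gw | gs , gs⊆ , gsQ , gsw =
        map (scale q) g ++ gs , Sub.++⁺ (Sub.map⁺ (scale q) g⊆) gs⊆ , ++⁺ (map⁺ gQ) gsQ , (begin
          ι (suc (length cs)) * q * ι W                   ≡⟨ cong (λ z → z * q * ι W) (trans (ι-+ 1 (length cs)) (cong (_+ ι (length cs)) ι-1)) ⟩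
          (1ℚ + ι (length cs)) * q * ι W                  ≡⟨ r₁ (ι (length cs)) q (ι W) ⟩
          ι W * q + ι (length cs) * q * ι W               ≤⟨ +-mono-≤ (*-monoʳ-≤-nonNeg q gw) gsw ⟩
          (ι (Φ c) + ι W * sumW g) * q + (ι (∑ cs Φ) * q + ι W * sumW gs)
                                                          ≡⟨ r₂ (ι (Φ c)) (ι W) (sumW g) q (ι (∑ cs Φ)) (sumW gs) ⟩
          (ι (Φ c) + ι (∑ cs Φ)) * q + ι W * (sumW g * q + sumW gs)
                                                          ≡⟨ cong₂ (λ y z → y * q + ι W * z) (ι-+ (Φ c) (∑ cs Φ))
                                                               (trans (sumW-++ (map (scale q) g) gs) (cong (_+ sumW gs) (sumW-scale q g))) ⟨
          ι (∑ (c ∷ cs) Φ) * q + ι W * sumW (map (scale q) g ++ gs) ∎)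
        where
        open ≤-Reasoning
        r₁ : ∀ l q w → (1ℚ + l) * q * w ≡ w * q + l * q * w
        r₁ = solve 3 (λ l q w → (con 1ℚ :+ l) :* q :* w := w :* q :+ l :* q :* w) refl
          where open +-*-Solver
        r₂ : ∀ a w s q b t → (a + w * s) * q + (b * q + w * t) ≡ (a + b) * q + w * (s * q + t)
        r₂ = solve 6 (λ a w s q b t → (a :+ w :* s) :* q :+ (b :* q :+ w :* t) := (a :+ b) :* q :+ w :* (s :* q :+ t)) refl
          where open +-*-Solver

    private
      mix-average : (q : ℚ) .{{_ : NonNegative q}} (C : List A) → ι (length C) * q ≡ 1ℚ →
        (outs : A → List (ℚ × B)) (Φ : A → ℕ) (Φ₀ : ℕ) → ∑ C Φ ℕ.≤ length C ℕ.* Φ₀ →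
        (∀ {c} → c ∈ C → Likely Q W (outs c) (Φ c)) →
        Likely Q W (concatMap (λ c → map (scale q) (outs c)) C) Φ₀
      mix-average q C q-inverse outs Φ Φ₀ ∑≤ L with mix q outs Φ C L
      ... | g , g⊆ , gQ , gw = likely g g⊆ gQ (begin
          ι W                                    ≡⟨ *-identityˡ (ι W) ⟨
          1ℚ * ι W                               ≡⟨ cong (_* ι W) q-inverse ⟨
          ι (length C) * q * ι W                 ≤⟨ gw ⟩
          ι (∑ C Φ) * q + ι W * sumW g           ≤⟨ +-monoˡ-≤ _ (*-monoʳ-≤-nonNeg q (ι-mono ∑≤)) ⟩
          ι (length C ℕ.* Φ₀) * q + ι W * sumW g ≡⟨ cong (_+ ι W * sumW g) cancel ⟩
          ι Φ₀ + ι W * sumW g                    ∎)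
        where
        open ≤-Reasoning
        cancel : ι (length C ℕ.* Φ₀) * q ≡ ι Φ₀
        cancel = trans (cong (_* q) (trans (ι-* (length C) Φ₀) (*-comm (ι (length C)) (ι Φ₀))))
          (trans (*-assoc (ι Φ₀) (ι (length C)) q) (trans (cong (ι Φ₀ *_) q-inverse) (*-identityʳ (ι Φ₀))))

    -- The supermartingale step: the premise on `∑ C Φ` says that the potential does not grow on
    -- average under Maker's uniform move.
    Likely-uniform : (C : List A) (outs : A → List (ℚ × B)) (Φ : A → ℕ) (Φ₀ : ℕ) →
      1 ℕ.≤ length C → ∑ C Φ ℕ.≤ length C ℕ.* Φ₀ →
      (∀ {c} → c ∈ C → Likely Q W (outs c) (Φ c)) →
      Likely Q W (concatMap (λ c → map (scale (unif C)) (outs c)) C) Φ₀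
    Likely-uniform C outs Φ Φ₀ 1≤C = mix-average (unif C) {{unif-nonNeg C}} C (unif-inverse C 1≤C) outs Φ Φ₀

    private
      complement : (q s : ℚ) .{{_ : NonNegative q}} (Φ j : ℕ) → ι (suc j) * q ≡ 1ℚ → 1 ℕ.≤ W →
        Φ ℕ.* suc j ℕ.≤ W → ι W ≤ ι Φ + ι W * s → 1ℚ - q ≤ s
      complement q s Φ j q-inverse 1≤W Φj≤W w = begin
        1ℚ - q         ≤⟨ +-monoˡ-≤ (- q) 1≤s+q ⟩
        s + q - q      ≡⟨ +-assoc s q (- q) ⟩
        s + (q - q)    ≡⟨ cong (λ z → s + z) (+-inverseʳ q) ⟩
        s + 0ℚ         ≡⟨ +-identityʳ s ⟩
        s              ∎
        where
        open ≤-Reasoning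
        ιΦ≤ : ι Φ ≤ ι W * q
        ιΦ≤ = begin
          ι Φ                   ≡⟨ *-identityʳ (ι Φ) ⟨
          ι Φ * 1ℚ              ≡⟨ cong (ι Φ *_) q-inverse ⟨
          ι Φ * (ι (suc j) * q) ≡⟨ *-assoc (ι Φ) (ι (suc j)) q ⟨
          ι Φ * ι (suc j) * q   ≡⟨ cong (_* q) (ι-* Φ (suc j)) ⟨
          ι (Φ ℕ.* suc j) * q   ≤⟨ *-monoʳ-≤-nonNeg q (ι-mono Φj≤W) ⟩
          ι W * q               ∎
        1≤s+q : 1ℚ ≤ s + q
        1≤s+q = *-cancelˡ-≤-pos (ι W) {{ι-pos 1≤W}} (begin
          ι W * 1ℚ            ≡⟨ *-identityʳ (ι W) ⟩
          ι W                 ≤⟨ w ⟩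
          ι Φ + ι W * s       ≤⟨ +-monoˡ-≤ _ ιΦ≤ ⟩
          ι W * q + ι W * s   ≡⟨ *-distribˡ-+ (ι W) q s ⟨
          ι W * (q + s)       ≡⟨ cong (ι W *_) (+-comm q s) ⟩
          ι W * (s + q)       ∎)

    Likely-weight : {outs : List (ℚ × B)} {Φ : ℕ} (j : ℕ) → 1 ℕ.≤ W → Φ ℕ.* suc j ℕ.≤ W →
      (l : Likely Q W outs Φ) → 1ℚ - (+ 1) / suc j ≤ sumW (Likely.good l)
    Likely-weight {Φ = Φ} j 1≤W Φj≤W (likely g _ _ w) =
      complement (+ 1 / suc j) (sumW g) {{normalize-nonNeg 1 (suc j)}} Φ j (ι-inverse j) 1≤W Φj≤W w

-- Edge lists, degrees, cuts and connectivity.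

module Graphs where

  open FiniteSums
  open import Data.Nat using (ℕ; zero; suc; _+_; _*_; _≤_; _<_; _≤?_; z≤n; s≤s)
  open import Data.Nat.Properties hiding (_≟_; _<?_; <-cmp)
  open import Data.Nat.Tactic.RingSolver using (solve-∀)
  open import Data.Bool using (Bool; true; false; not; _∧_; _∨_)
  open import Data.Fin using (Fin)
  open import Data.Fin.Properties using (_≟_; _<?_; <-cmp)
  import Data.Fin.Properties as Fin
  open import Data.Vec using (Vec; []; _∷_; lookup; tabulate; _[_]≔_)
  open import Data.Vec.Properties using (lookup∘tabulate; lookup∘update; lookup∘update′)
  open import Data.List using (List; []; _∷_; length; cartesianProduct; allFin)
  open import Data.List.Properties using (length-tabulate)
  open import Data.List.Membership.Propositional using (_∉_)
  open import Data.List.Membership.Propositional.Properties using (∈-allFin)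
  open import Data.List.Relation.Unary.Any using (here; there)
  open import Data.Product using (∃; _×_; _,_; proj₁; proj₂)
  open import Data.Sum using (_⊎_; inj₁; inj₂)
  open import Function using (_∘_)
  open import Relation.Nullary using (yes; no; does; contradiction)
  open import Relation.Nullary.Decidable using (dec-true; dec-false)
  open import Relation.Binary using (tri<; tri≈; tri>)
  open import Relation.Binary.PropositionalEquality using (_≡_; _≢_; refl; sym; trans; cong; cong₂; subst; module ≡-Reasoning)
  open import Defs using (edges; Edge; Adj; Reach; here; step; KConnected)

  module _ {n : ℕ} where
    open import Data.List.Membership.DecPropositional (_≟_ {n}) using (_∈?_) public

  private
    variable
      n : ℕ

  -- Adjacency as multiplicity

  -- A multiplicity rather than a truth value: adjacency, degrees and cut sizes all become sums over
  -- an edge list, and one conservation law for such sums covers them all.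
  lk : Fin n → Fin n → Edge n → ℕ
  lk v w (i , j) = δ v i * δ w j + δ v j * δ w i

  adj : List (Edge n) → Fin n → Fin n → ℕ
  adj L v w = ∑ L (lk v w)

  deg₁ : Fin n → Edge n → ℕ
  deg₁ v (i , j) = δ v i + δ v j

  deg : List (Edge n) → Fin n → ℕ
  deg L v = ∑ L (deg₁ v)

  δ-sym : (v w : Fin n) → δ v w ≡ δ w v
  δ-sym v w with v ≟ w
  ... | yes refl = sym (δ-refl v)
  ... | no v≢w   = sym (δ-≢ (v≢w ∘ sym))

  lk-sym : (v w : Fin n) (e : Edge n) → lk v w e ≡ lk w v e
  lk-sym v w (i , j) = r (δ v i) (δ w j) (δ v j) (δ w i)
    where
    r : ∀ a b c d → a * b + c * d ≡ d * c + b * a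
    r = solve-∀

  adj-sym : (L : List (Edge n)) (v w : Fin n) → adj L v w ≡ adj L w v
  adj-sym L v w = ∑-cong L (lk-sym v w)

  ∑-lk : (g : Fin n → ℕ) (v : Fin n) (e : Edge n) →
    ∑ᶠ n (λ w → g w * lk v w e) ≡ δ v (proj₁ e) * g (proj₂ e) + δ v (proj₂ e) * g (proj₁ e)
  ∑-lk {n} g v (i , j) = begin
    ∑ᶠ n (λ w → g w * lk v w (i , j))
      ≡⟨ ∑-cong (allFin n) (λ w → r (g w) (δ v i) (δ w j) (δ v j) (δ w i)) ⟩
    ∑ᶠ n (λ w → δ v i * (δ w j * g w) + δ v j * (δ w i * g w))
      ≡⟨ ∑-+ (allFin n) _ _ ⟩
    ∑ᶠ n (λ w → δ v i * (δ w j * g w)) + ∑ᶠ n (λ w → δ v j * (δ w i * g w))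
      ≡⟨ cong₂ _+_ (∑-*ˡ (allFin n) (δ v i) _) (∑-*ˡ (allFin n) (δ v j) _) ⟩
    δ v i * ∑ᶠ n (λ w → δ w j * g w) + δ v j * ∑ᶠ n (λ w → δ w i * g w)
      ≡⟨ cong₂ (λ a b → δ v i * a + δ v j * b) (∑-δ j g) (∑-δ i g) ⟩
    δ v i * g j + δ v j * g i ∎
    where
    open ≡-Reasoning
    r : ∀ g a b c d → g * (a * b + c * d) ≡ a * (b * g) + c * (d * g)
    r = solve-∀

  ∑-adj : (L : List (Edge n)) (v : Fin n) → ∑ᶠ n (adj L v) ≡ deg L v
  ∑-adj {n} L v = trans (∑-swap (allFin n) L (lk v)) (∑-cong L λ e →
    trans (∑-cong (allFin n) (λ w → sym (*-identityˡ (lk v w e))))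
          (trans (∑-lk (λ _ → 1) v e) (cong₂ _+_ (*-identityʳ (δ v (proj₁ e))) (*-identityʳ (δ v (proj₂ e))))))

  ∑-deg : (L : List (Edge n)) → ∑ᶠ n (deg L) ≡ length L * 2
  ∑-deg {n} L = trans (∑-swap (allFin n) L deg₁) (trans (∑-cong L λ e →
    trans (∑-+ (allFin n) (λ v → δ v (proj₁ e)) _) (cong₂ _+_ (∑-δ₁ (proj₁ e)) (∑-δ₁ (proj₂ e)))) (∑-const L 2))

  cross : (S R : Fin n → Bool) → Edge n → Bool
  cross S R (i , j) = (S i ∧ R j) ∨ (S j ∧ R i)

  Disjoint : (S R : Fin n → Bool) → Set
  Disjoint S R = ∀ v → S v ≡ true → R v ≡ false

  nbrs : (Fin n → Bool) → List (Edge n) → Fin n → ℕ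
  nbrs {n} R L v = ∑ᶠ n (λ w → ind (R w) * adj L v w)

  nbrs-as-∑ : (R : Fin n → Bool) (L : List (Edge n)) (v : Fin n) →
    nbrs R L v ≡ ∑ L (λ e → δ v (proj₁ e) * ind (R (proj₂ e)) + δ v (proj₂ e) * ind (R (proj₁ e)))
  nbrs-as-∑ {n} R L v = begin
    ∑ᶠ n (λ w → ind (R w) * adj L v w)      ≡⟨ ∑-cong (allFin n) (λ w → sym (∑-*ˡ L (ind (R w)) (lk v w))) ⟩
    ∑ᶠ n (λ w → ∑ L (λ e → ind (R w) * lk v w e)) ≡⟨ ∑-swap (allFin n) L _ ⟩
    ∑ L (λ e → ∑ᶠ n (λ w → ind (R w) * lk v w e)) ≡⟨ ∑-cong L (∑-lk (ind ∘ R) v) ⟩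
    ∑ L (λ e → δ v (proj₁ e) * ind (R (proj₂ e)) + δ v (proj₂ e) * ind (R (proj₁ e))) ∎
    where open ≡-Reasoning

  -- By disjointness an edge leads from `S` to `R` in at most one of its two orientations, so the
  -- double sum counts it at most once.
  ∑-nbrs≤cross : {S R : Fin n → Bool} → Disjoint S R → (L : List (Edge n)) →
    ∑ᶠ n (λ v → ind (S v) * nbrs R L v) ≤ cnt (cross S R) L
  ∑-nbrs≤cross {n} {S} {R} disj L = begin
    ∑ᶠ n (λ v → ind (S v) * nbrs R L v)
      ≡⟨ ∑-cong (allFin n) (λ v → trans (cong (ind (S v) *_) (nbrs-as-∑ R L v)) (sym (∑-*ˡ L (ind (S v)) _))) ⟩
    ∑ᶠ n (λ v → ∑ L (λ e → ind (S v) * t v e))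
      ≡⟨ ∑-swap (allFin n) L _ ⟩
    ∑ L (λ e → ∑ᶠ n (λ v → ind (S v) * t v e))
      ≤⟨ ∑-mono L (λ e → ≤-trans (≤-reflexive (outer e)) (bound e)) ⟩
    cnt (cross S R) L ∎
    where
    open ≤-Reasoning
    t : Fin n → Edge n → ℕ
    t v e = δ v (proj₁ e) * ind (R (proj₂ e)) + δ v (proj₂ e) * ind (R (proj₁ e))
    r : ∀ s a b c d → s * (a * b + c * d) ≡ a * (s * b) + c * (s * d)
    r = solve-∀
    outer : ∀ e → ∑ᶠ n (λ v → ind (S v) * t v e) ≡
      ind (S (proj₁ e)) * ind (R (proj₂ e)) + ind (S (proj₂ e)) * ind (R (proj₁ e))
    outer (i , j) = trans (∑-cong (allFin n) (λ v → r (ind (S v)) (δ v i) (ind (R j)) (δ v j) (ind (R i))))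
      (trans (∑-+ (allFin n) _ _) (cong₂ _+_ (∑-δ i (λ v → ind (S v) * ind (R j))) (∑-δ j (λ v → ind (S v) * ind (R i)))))
    bound : ∀ e → ind (S (proj₁ e)) * ind (R (proj₂ e)) + ind (S (proj₂ e)) * ind (R (proj₁ e)) ≤ ind (cross S R e)
    bound (i , j) with S i in Si | S j in Sj
    ... | false | false = z≤n
    ... | true  | true  rewrite disj i Si | disj j Sj = z≤n
    ... | true  | false with R j
    ...   | true  = ≤-refl
    ...   | false = z≤n
    bound (i , j) | false | true with R i
    ...   | true  = ≤-refl
    ...   | false = z≤n

  sing : Fin n → Fin n → Bool
  sing v u = does (u ≟ v)

  nbrs≤cross-sing : {R : Fin n → Bool} (v : Fin n) → R v ≡ false → (L : List (Edge n)) →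
    nbrs R L v ≤ cnt (cross (sing v) R) L
  nbrs≤cross-sing {n} {R} v Rv≡false L = subst (_≤ cnt (cross (sing v) R) L) (∑-δ v (nbrs R L)) (∑-nbrs≤cross disj L)
    where
    disj : Disjoint (sing v) R
    disj u eq with u ≟ v
    ... | yes refl = Rv≡false

  nbrs≤cross : {S R : Fin n → Bool} → Disjoint S R → (L : List (Edge n)) {v : Fin n} → S v ≡ true →
    nbrs R L v ≤ cnt (cross S R) L
  nbrs≤cross {n} {S} {R} disj L {v} Sv = begin
    nbrs R L v                          ≡⟨ *-identityˡ _ ⟨
    1 * nbrs R L v                      ≡⟨ cong (λ b → ind b * nbrs R L v) Sv ⟨
    ind (S v) * nbrs R L v              ≤⟨ ∈⇒≤∑ (λ v → ind (S v) * nbrs R L v) (∈-allFin v) ⟩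
    ∑ᶠ n (λ v → ind (S v) * nbrs R L v) ≤⟨ ∑-nbrs≤cross disj L ⟩
    cnt (cross S R) L                   ∎
    where open ≤-Reasoning

  lk-pair : (v w : Fin n) → 1 ≤ lk v w (v , w)
  lk-pair v w = subst (λ z → 1 ≤ z + δ v w * δ w v) (sym (cong₂ _*_ (δ-refl v) (δ-refl w))) (s≤s z≤n)

  find₁ : (S R : Fin n → Bool) (e : Edge n) →
    ind (cross S R e) ≡ 0 ⊎ (∃ λ v → ∃ λ w → S v ≡ true × R w ≡ true × 1 ≤ lk v w e)
  find₁ S R (i , j) with S i in Si | R j in Rj | S j in Sj | R i in Ri
  ... | true  | true  | _     | _     = inj₂ (i , j , Si , Rj , lk-pair i j)
  ... | true  | false | true  | true  = inj₂ (j , i , Sj , Ri , subst (1 ≤_) (lk-sym i j (i , j)) (lk-pair i j))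
  ... | false | _     | true  | true  = inj₂ (j , i , Sj , Ri , subst (1 ≤_) (lk-sym i j (i , j)) (lk-pair i j))
  ... | true  | false | true  | false = inj₁ refl
  ... | true  | false | false | _     = inj₁ refl
  ... | false | _     | true  | false = inj₁ refl
  ... | false | _     | false | _     = inj₁ refl

  find : (S R : Fin n → Bool) (L : List (Edge n)) →
    cnt (cross S R) L ≡ 0 ⊎ (∃ λ v → ∃ λ w → S v ≡ true × R w ≡ true × 1 ≤ adj L v w)
  find S R [] = inj₁ refl
  find S R (e ∷ L) with find₁ S R e | find S R L
  ... | inj₂ (v , w , Sv , Rw , 1≤) | _ = inj₂ (v , w , Sv , Rw , m≤n⇒m≤n+o _ 1≤)
  ... | inj₁ _  | inj₂ (v , w , Sv , Rw , 1≤) = inj₂ (v , w , Sv , Rw , m≤n⇒m≤o+n (lk v w e) 1≤)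
  ... | inj₁ z₁ | inj₁ z₂ = inj₁ (cong₂ _+_ z₁ z₂)

  lk⇒≡ : {v w : Fin n} (e : Edge n) → 1 ≤ lk v w e → (v , w) ≡ e ⊎ (w , v) ≡ e
  lk⇒≡ {v = v} {w} (i , j) 1≤ with v ≟ i | w ≟ j | v ≟ j | w ≟ i
  ... | yes refl | yes refl | _        | _        = inj₁ refl
  ... | yes _    | no _     | yes refl | yes refl = inj₂ refl
  ... | no _     | _        | yes refl | yes refl = inj₂ refl

  adj⇒Adj : (L : List (Edge n)) {v w : Fin n} → 1 ≤ adj L v w → Adj L v w
  adj⇒Adj (e ∷ L) {v} {w} 1≤ with 1 ≤? lk v w e
  ... | yes 1≤lk with lk⇒≡ e 1≤lk
  ...   | inj₁ eq = inj₁ (here eq)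
  ...   | inj₂ eq = inj₂ (here eq)
  adj⇒Adj (e ∷ L) {v} {w} 1≤ | no 1≰lk
    with adj⇒Adj L (subst (λ z → 1 ≤ z + adj L v w) (n<1⇒n≡0 (≰⇒> 1≰lk)) 1≤)
  ... | inj₁ p = inj₁ (there p)
  ... | inj₂ p = inj₂ (there p)

  ∑-edges : (f : Edge n → ℕ) →
    ∑ (edges n) f ≡ ∑ᶠ n (λ i → ∑ᶠ n (λ j → ind (does (i <? j)) * f (i , j)))
  ∑-edges {n} f = trans (∑-filter (λ p → proj₁ p <? proj₂ p) (cartesianProduct (allFin n) (allFin n)) f)
                        (∑-cartesianProduct (allFin n) (allFin n) _)

  adj-edges : (v w : Fin n) → adj (edges n) v w ≡ ind (does (v <? w)) + ind (does (w <? v))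
  adj-edges {n} v w = begin
    adj (edges n) v w
      ≡⟨ ∑-edges (lk v w) ⟩
    ∑ᶠ n (λ i → ∑ᶠ n (λ j → < i j * lk v w (i , j)))
      ≡⟨ ∑-cong (allFin n) (λ i → trans (∑-cong (allFin n) (λ j → arrange i j)) (∑-+ (allFin n) _ _)) ⟩
    ∑ᶠ n (λ i → ∑ᶠ n (λ j → δ j w * (δ i v * < i j)) + ∑ᶠ n (λ j → δ j v * (δ i w * < i j)))
      ≡⟨ ∑-cong (allFin n) (λ i → cong₂ _+_ (∑-δ w (λ j → δ i v * < i j)) (∑-δ v (λ j → δ i w * < i j))) ⟩
    ∑ᶠ n (λ i → δ i v * < i w + δ i w * < i v)
      ≡⟨ ∑-+ (allFin n) _ _ ⟩
    ∑ᶠ n (λ i → δ i v * < i w) + ∑ᶠ n (λ i → δ i w * < i v)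
      ≡⟨ cong₂ _+_ (∑-δ v (λ i → < i w)) (∑-δ w (λ i → < i v)) ⟩
    < v w + < w v ∎
    where
    open ≡-Reasoning
    < : Fin n → Fin n → ℕ
    < i j = ind (does (i <? j))
    r : ∀ l a b c d → l * (a * b + c * d) ≡ b * (a * l) + c * (d * l)
    r = solve-∀
    arrange : ∀ i j → < i j * lk v w (i , j) ≡ δ j w * (δ i v * < i j) + δ j v * (δ i w * < i j)
    arrange i j = trans (r (< i j) (δ v i) (δ w j) (δ v j) (δ w i))
      (cong₂ _+_ (cong₂ (λ a b → a * (b * < i j)) (δ-sym w j) (δ-sym v i))
                 (cong₂ (λ a b → a * (b * < i j)) (δ-sym v j) (δ-sym w i)))

  adj-edges-≢ : {v w : Fin n} → v ≢ w → adj (edges n) v w ≡ 1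
  adj-edges-≢ {v = v} {w} v≢w = trans (adj-edges v w) one
    where
    one : ind (does (v <? w)) + ind (does (w <? v)) ≡ 1
    one with <-cmp v w
    ... | tri< v<w _ w≮v = cong₂ (λ a b → ind a + ind b) (dec-true (v <? w) v<w) (dec-false (w <? v) w≮v)
    ... | tri≈ _ v≡w _   = contradiction v≡w v≢w
    ... | tri> v≮w _ w<v = cong₂ (λ a b → ind a + ind b) (dec-false (v <? w) v≮w) (dec-true (w <? v) w<v)

  adj-edges-≤1 : (v w : Fin n) → adj (edges n) v w ≤ 1
  adj-edges-≤1 v w with v ≟ w
  ... | no v≢w   = ≤-reflexive (adj-edges-≢ v≢w)
  ... | yes refl = subst (_≤ 1) (sym (trans (adj-edges v v)
    (cong (λ b → ind b + ind b) (dec-false (v <? v) (Fin.<-irrefl refl))))) z≤n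

  edges-loopless : ∑ (edges n) (λ e → δ (proj₁ e) (proj₂ e)) ≡ 0
  edges-loopless {n} = trans (∑-edges {n} (λ e → δ (proj₁ e) (proj₂ e)))
    (trans (∑-cong (allFin n) (λ i → trans (∑-cong (allFin n) (zero-term i)) (∑-zero (allFin n)))) (∑-zero (allFin n)))
    where
    zero-term : (i j : Fin n) → ind (does (i <? j)) * δ i j ≡ 0
    zero-term i j with i ≟ j
    ... | no _     = *-zeroʳ (ind (does (i <? j)))
    ... | yes refl = cong (λ b → ind b * 1) (dec-false (i <? i) (Fin.<-irrefl refl))

  length-edges : length (edges n) ≤ n * n
  length-edges {n} = begin
    length (edges n)                                            ≡⟨ ∑-one (edges n) ⟨
    ∑ (edges n) (λ _ → 1)                                       ≡⟨ ∑-edges {n} (λ _ → 1) ⟩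
    ∑ᶠ n (λ i → ∑ᶠ n (λ j → ind (does (i <? j)) * 1))           ≤⟨ ∑-mono (allFin n) (λ i → ∑-mono (allFin n) (λ j → *-monoˡ-≤ 1 (ind≤1 (does (i <? j))))) ⟩
    ∑ᶠ n (λ i → ∑ᶠ n (λ j → 1))                                 ≡⟨ trans (∑-const (allFin n) _) (cong₂ _*_ (length-tabulate {n = n} (λ i → i)) (∑ᶠ-one n)) ⟩
    n * n                                                       ∎
    where open ≤-Reasoning

  -- Connectivity from cuts

  size : (Fin n → Bool) → ℕ
  size {n} S = ∑ᶠ n (ind ∘ S)

  rest : Vec Bool n → List (Fin n) → Fin n → Bool
  rest S X w = not (lookup S w) ∧ not (does (w ∈? X))

  rest-disjoint : (S : Vec Bool n) (X : List (Fin n)) → Disjoint (lookup S) (rest S X)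
  rest-disjoint S X v eq rewrite eq = refl

  rest-elim : (S : Vec Bool n) (X : List (Fin n)) {w : Fin n} → rest S X w ≡ true → lookup S w ≡ false × w ∉ X
  rest-elim S X {w} eq with lookup S w | w ∈? X
  ... | false | no w∉X = refl , w∉X

  rest-intro : (S : Vec Bool n) (X : List (Fin n)) {w : Fin n} → lookup S w ≡ false → w ∉ X → rest S X w ≡ true
  rest-intro S X {w} eq w∉X rewrite eq = cong not (dec-false (w ∈? X) w∉X)

  size-∈ : (X : List (Fin n)) → ∑ᶠ n (λ w → ind (does (w ∈? X))) ≤ length X
  size-∈ {n} []      = ≤-reflexive (∑-zero (allFin n))
  size-∈ {n} (x ∷ X) = begin
    ∑ᶠ n (λ w → ind (does (w ∈? (x ∷ X))))                ≤⟨ ∑-mono (allFin n) (λ w → ind-∨ (does (w ≟ x)) (does (w ∈? X))) ⟩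
    ∑ᶠ n (λ w → δ w x + ind (does (w ∈? X)))              ≡⟨ ∑-+ (allFin n) (λ w → δ w x) _ ⟩
    ∑ᶠ n (λ w → δ w x) + ∑ᶠ n (λ w → ind (does (w ∈? X))) ≤⟨ +-mono-≤ (≤-reflexive (∑-δ₁ x)) (size-∈ X) ⟩
    suc (length X)                                        ∎
    where
    open ≤-Reasoning
    ind-∨ : ∀ a b → ind (a ∨ b) ≤ ind a + ind b
    ind-∨ true  b = s≤s z≤n
    ind-∨ false b = ≤-refl

  n≤size+rest+X : (S : Vec Bool n) (X : List (Fin n)) → n ≤ size (lookup S) + (size (rest S X) + length X)
  n≤size+rest+X {n} S X = begin
    n                              ≡⟨ ∑ᶠ-one n ⟨
    ∑ᶠ n (λ _ → 1)                 ≤⟨ ∑-mono (allFin n) (λ w → cover (lookup S w) (does (w ∈? X))) ⟩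
    ∑ᶠ n (λ w → ind (lookup S w) + (ind (rest S X w) + ind (does (w ∈? X))))
                                   ≡⟨ trans (∑-+ (allFin n) _ _) (cong (size (lookup S) +_) (∑-+ (allFin n) _ _)) ⟩
    size (lookup S) + (size (rest S X) + ∑ᶠ n (λ w → ind (does (w ∈? X))))
                                   ≤⟨ +-monoʳ-≤ (size (lookup S)) (+-monoʳ-≤ (size (rest S X)) (size-∈ X)) ⟩
    size (lookup S) + (size (rest S X) + length X) ∎
    where
    open ≤-Reasoning
    cover : ∀ a b → 1 ≤ ind a + (ind (not a ∧ not b) + ind b)
    cover true  b     = s≤s z≤n
    cover false true  = ≤-refl
    cover false false = ≤-refl

  size+rest≤n : (S : Vec Bool n) (X : List (Fin n)) → size (lookup S) + size (rest S X) ≤ n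
  size+rest≤n {n} S X = begin
    size (lookup S) + size (rest S X)              ≡⟨ ∑-+ (allFin n) _ _ ⟨
    ∑ᶠ n (λ w → ind (lookup S w) + ind (rest S X w)) ≤⟨ ∑-mono (allFin n) (λ w → pack (lookup S w) (does (w ∈? X))) ⟩
    ∑ᶠ n (λ _ → 1)                                 ≡⟨ ∑ᶠ-one n ⟩
    n                                              ∎
    where
    open ≤-Reasoning
    pack : ∀ a b → ind a + ind (not a ∧ not b) ≤ 1
    pack true  b     = ≤-refl
    pack false true  = z≤n
    pack false false = ≤-refl

  size-tabulate : (S : Fin n → Bool) → size (lookup (tabulate S)) ≡ size S
  size-tabulate {n} S = ∑-cong (allFin n) (λ v → cong ind (lookup∘tabulate S v))

  CrossingEdge : List (Edge n) → Vec Bool n → List (Fin n) → Set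
  CrossingEdge M S X = ∃ λ v → ∃ λ w → lookup S v ≡ true × rest S X w ≡ true × 1 ≤ adj M v w

  -- Limited to at most half of the vertices because only there is the other side large enough to
  -- force many free edges. `S` may overlap `X`; the other side is the complement of their union.
  SmallCutsCrossed : ℕ → List (Edge n) → Set
  SmallCutsCrossed {n} k M = (S : Vec Bool n) (X : List (Fin n)) → length X < k →
    {v : Fin n} → lookup S v ≡ true → 2 * size (lookup S) ≤ n → CrossingEdge M S X

  module _ {k : ℕ} {M : List (Edge n)} (crossed : SmallCutsCrossed k M) where

    -- If `S` is large, then `rest S X` is small, and its own other side is `S` without `X`. The
    -- edge leaving it, read backwards, crosses the given cut.
    cut-crossed : (S : Vec Bool n) (X : List (Fin n)) → length X < k →
      {u v : Fin n} → lookup S u ≡ true → rest S X v ≡ true → CrossingEdge M S X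
    cut-crossed S X X<k {u} {v} Su Rv with 2 * size (lookup S) ≤? n
    ... | yes small = crossed S X X<k Su small
    ... | no large with crossed R X X<k (trans (lookup∘tabulate (rest S X) v) Rv) R-small
      where
      R = tabulate (rest S X)
      R-small : 2 * size (lookup R) ≤ n
      R-small = subst (λ z → 2 * z ≤ n) (sym (size-tabulate (rest S X)))
        (≤-by-slack 0 (+-mono-≤ (<⇒≤ (≰⇒> large)) (*-monoʳ-≤ 2 (size+rest≤n S X))) (r (size (lookup S)) (size (rest S X)) n))
        where
        r : ∀ s t n → 2 * t + (2 * s + 2 * n) + 0 ≡ n + (n + 2 * (s + t))
        r = solve-∀
    ...   | a , b , Ra , Tb , a~b with rest-elim (tabulate (rest S X)) X {b} Tb
    ...     | ¬Rb , b∉X = b , a , Sb , trans (sym (lookup∘tabulate (rest S X) a)) Ra , subst (1 ≤_) (adj-sym M a b) a~b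
      where
      Sb : lookup S b ≡ true
      Sb with lookup S b in eq
      ... | true  = refl
      ... | false = contradiction (trans (sym (rest-intro S X eq b∉X)) (trans (sym (lookup∘tabulate (rest S X) b)) ¬Rb)) λ ()

    private
      snoc : ∀ {X a b u} → Reach M X u a → Adj M a b → b ∉ X → Reach M X u b
      snoc here           a~b b∉X = step a~b b∉X here
      snoc (step e x p)   a~b b∉X = step e x (snoc p a~b b∉X)

      size-insert : (S : Vec Bool n) (b : Fin n) → lookup S b ≡ false → size (lookup (S [ b ]≔ true)) ≡ suc (size (lookup S))
      size-insert S b ¬Sb = trans (∑-cong (allFin n) pointwise)
        (trans (∑-+ (allFin n) (λ v → δ v b) _) (cong (_+ size (lookup S)) (∑-δ₁ b)))
        where
        pointwise : ∀ v → ind (lookup (S [ b ]≔ true) v) ≡ δ v b + ind (lookup S v)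
        pointwise v with v ≟ b
        ... | yes refl rewrite ¬Sb = cong ind (lookup∘update b S true)
        ... | no v≢b   = cong ind (lookup∘update′ v≢b S true)

    -- `S` collects vertices already reached from `u`. As long as `v` is missing, there is an edge
    -- from `S` to a new vertex outside `X`, and this can happen at most `n - |S|` times, which
    -- `fuel` covers.
    grow : (X : List (Fin n)) → length X < k → {u v : Fin n} → v ∉ X → ∀ fuel (S : Vec Bool n) →
      (∀ {w} → lookup S w ≡ true → Reach M X u w) → lookup S u ≡ true → n ≤ size (lookup S) + fuel → Reach M X u v
    grow X X<k {u} {v} v∉X fuel S S-reach Su n≤ with lookup S v in Sv
    ... | true = S-reach Sv
    grow X X<k {u} {v} v∉X zero S S-reach Su n≤ | false = contradiction n≤ (<⇒≱ (begin-strict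
      size (lookup S) + 0               ≡⟨ +-identityʳ _ ⟩
      size (lookup S)                   <⟨ ≤-refl ⟩
      suc (size (lookup S))             ≡⟨ size-insert S v Sv ⟨
      size (lookup (S [ v ]≔ true))     ≤⟨ ∑-mono (allFin n) (λ w → ind≤1 _) ⟩
      ∑ᶠ n (λ _ → 1)                    ≡⟨ ∑ᶠ-one n ⟩
      n                                 ∎))
      where open ≤-Reasoning
    grow X X<k {u} {v} v∉X (suc fuel) S S-reach Su n≤ | false
      with a , b , Sa , Rb , a~b ← cut-crossed S X X<k Su (rest-intro S X Sv v∉X)
      with ¬Sb , b∉X ← rest-elim S X {b} Rb =
      grow X X<k v∉X fuel (S [ b ]≔ true) S′-reach (S⊆S′ Su)
        (subst (n ≤_) (trans (+-suc (size (lookup S)) fuel) (cong (_+ fuel) (sym (size-insert S b ¬Sb)))) n≤)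
      where
      S⊆S′ : ∀ {w} → lookup S w ≡ true → lookup (S [ b ]≔ true) w ≡ true
      S⊆S′ {w} Sw with w ≟ b
      ... | yes refl = lookup∘update b S true
      ... | no w≢b   = trans (lookup∘update′ w≢b S true) Sw
      S′-reach : ∀ {w} → lookup (S [ b ]≔ true) w ≡ true → Reach M X u w
      S′-reach {w} S′w with w ≟ b
      ... | yes refl = snoc (S-reach Sa) (adj⇒Adj M a~b) b∉X
      ... | no w≢b   = S-reach (trans (sym (lookup∘update′ w≢b S true)) S′w)

    crossed⇒connected : k < n → KConnected k n M
    crossed⇒connected k<n = k<n , λ X X<k u v _ v∉X →
      grow X X<k v∉X n (tabulate (sing u)) (reach-u X) (trans (lookup∘tabulate (sing u) u) (dec-true (u ≟ u) refl)) (m≤n+m n _)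
      where
      reach-u : ∀ X {u w} → lookup (tabulate (sing u)) w ≡ true → Reach M X u w
      reach-u X {u} {w} eq with w ≟ u | trans (sym (lookup∘tabulate (sing u) w)) eq
      ... | yes refl | _ = here

-- The union bound over cuts, as a potential.

module CutPotential where

  open FiniteSums
  open Graphs
  open import Data.Nat using (ℕ; zero; suc; _+_; _*_; _∸_; _^_; _⊓_; _≤_; _≤?_; z≤n; s≤s; >-nonZero)
  open import Data.Nat.Properties
  open import Data.Nat.Tactic.RingSolver using (solve-∀)
  open import Data.Bool using (Bool; true; false; _∧_; if_then_else_)
  open import Data.Fin using (Fin)
  open import Data.Vec using (Vec; []; _∷_; lookup)
  open import Data.List using (List; []; _∷_; [_]; _++_; map; concatMap; length; allFin)
  open import Data.List.Properties using (length-tabulate; length-++; length-map)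
  open import Data.List.Membership.Propositional using (_∈_)
  open import Data.List.Membership.Propositional.Properties using (∈-allFin; ∈-map⁺; ∈-++⁺ˡ; ∈-++⁺ʳ; ∈-concatMap⁺)
  open import Data.List.Relation.Unary.Any using (here; there)
  import Data.List.Relation.Unary.Any as Any
  open import Data.Product using (_×_; _,_; proj₁; proj₂)
  open import Data.Sum using (inj₁; inj₂)
  open import Function using (_∘_)
  open import Relation.Nullary using (Dec; yes; no; does; ¬_; contradiction)
  open import Relation.Nullary.Decidable using (dec-true; dec-false; _×-dec_)
  open import Relation.Binary.PropositionalEquality using (_≡_; refl; sym; trans; cong; cong₂; subst; module ≡-Reasoning)
  open import Defs using (Edge; choices)

  -- Powers

  -- Bernoulli's inequality `1 - s / d ≤ (1 - 1 / d) ^ s` for `d = a + 1`, cleared of denominators.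
  -- It turns the chance of missing a cut into a product over the vertices of its small side.
  bernoulli-down : ∀ a s → suc a * suc a ^ s ≤ suc a * a ^ s + s * suc a ^ s
  bernoulli-down a zero    = m≤m+n _ 0
  bernoulli-down a (suc s) = begin
    d * (d * d ^ s)                             ≤⟨ *-monoʳ-≤ d (bernoulli-down a s) ⟩
    d * (d * a ^ s + s * d ^ s)                 ≡⟨ r₁ a (a ^ s) s (d ^ s) ⟩
    d * (a * a ^ s) + s * (d * d ^ s) + d * a ^ s ≤⟨ +-monoʳ-≤ (d * (a * a ^ s) + s * (d * d ^ s)) (*-monoʳ-≤ d (^-monoˡ-≤ s (n≤1+n a))) ⟩
    d * (a * a ^ s) + s * (d * d ^ s) + d * d ^ s ≡⟨ r₂ (d * (a * a ^ s)) s (d * d ^ s) ⟩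
    d * (a * a ^ s) + suc s * (d * d ^ s)       ∎
    where
    open ≤-Reasoning
    d = suc a
    r₁ : ∀ a p s q → suc a * (suc a * p + s * q) ≡ suc a * (a * p) + s * (suc a * q) + suc a * p
    r₁ = solve-∀
    r₂ : ∀ x s y → x + s * y + y ≡ x + suc s * y
    r₂ = solve-∀

  bernoulli-up : ∀ a i → a ^ i * (a + i) ≤ a * suc a ^ i
  bernoulli-up a zero    = ≤-reflexive (r a)
    where
    r : ∀ a → 1 * (a + 0) ≡ a * 1
    r = solve-∀
  bernoulli-up a (suc i) = begin
    a * a ^ i * (a + suc i)             ≤⟨ m≤m+n _ (a ^ i * i) ⟩
    a * a ^ i * (a + suc i) + a ^ i * i ≡⟨ r₁ a (a ^ i) i ⟩
    a ^ i * (a + i) * suc a             ≤⟨ *-monoˡ-≤ (suc a) (bernoulli-up a i) ⟩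
    a * suc a ^ i * suc a               ≡⟨ r₂ a (suc a ^ i) ⟩
    a * (suc a * suc a ^ i)             ∎
    where
    open ≤-Reasoning
    r₁ : ∀ a p i → a * p * (a + suc i) + p * i ≡ p * (a + i) * suc a
    r₁ = solve-∀
    r₂ : ∀ a p → a * p * suc a ≡ a * (suc a * p)
    r₂ = solve-∀

  doubling : ∀ a → 1 ≤ a → 2 * a ^ a ≤ suc a ^ a
  doubling a 1≤a = *-cancelˡ-≤ a {{>-nonZero 1≤a}} (begin
    a * (2 * a ^ a) ≡⟨ r a (a ^ a) ⟩
    a ^ a * (a + a) ≤⟨ bernoulli-up a a ⟩
    a * suc a ^ a   ∎)
    where
    open ≤-Reasoning
    r : ∀ a p → a * (2 * p) ≡ p * (a + a)
    r = solve-∀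

  *-^-distrib : ∀ a b i → (a * b) ^ i ≡ a ^ i * b ^ i
  *-^-distrib a b zero    = refl
  *-^-distrib a b (suc i) = trans (cong (a * b *_) (*-^-distrib a b i)) (r a b (a ^ i) (b ^ i))
    where
    r : ∀ a b p q → a * b * (p * q) ≡ a * p * (b * q)
    r = solve-∀

  -- Both potentials get their exponential smallness from here: `(a / (a + 1)) ^ t ≤ 2 ^ (- e)`,
  -- since every `a` factors `1 + 1 / a` multiply to at least 2.
  power-doubling : ∀ a e t → 1 ≤ a → a * e ≤ t → 2 ^ e * a ^ t ≤ suc a ^ t
  power-doubling a e t 1≤a ae≤t = begin
    2 ^ e * a ^ t                       ≡⟨ cong (λ z → 2 ^ e * a ^ z) t≡ ⟩
    2 ^ e * a ^ (a * e + r)             ≡⟨ cong (2 ^ e *_) (^-distribˡ-+-* a (a * e) r) ⟩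
    2 ^ e * (a ^ (a * e) * a ^ r)       ≡⟨ *-assoc (2 ^ e) _ _ ⟨
    2 ^ e * a ^ (a * e) * a ^ r         ≤⟨ *-mono-≤ full (^-monoˡ-≤ r (n≤1+n a)) ⟩
    suc a ^ (a * e) * suc a ^ r         ≡⟨ ^-distribˡ-+-* (suc a) (a * e) r ⟨
    suc a ^ (a * e + r)                 ≡⟨ cong (suc a ^_) t≡ ⟨
    suc a ^ t                           ∎
    where
    open ≤-Reasoning
    r = t ∸ a * e
    t≡ : t ≡ a * e + r
    t≡ = sym (m+[n∸m]≡n ae≤t)
    full : 2 ^ e * a ^ (a * e) ≤ suc a ^ (a * e)
    full = begin
      2 ^ e * a ^ (a * e)   ≡⟨ cong (2 ^ e *_) (^-*-assoc a a e) ⟨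
      2 ^ e * (a ^ a) ^ e   ≡⟨ *-^-distrib 2 (a ^ a) e ⟨
      (2 * a ^ a) ^ e       ≤⟨ ^-monoˡ-≤ e (doubling a 1≤a) ⟩
      (suc a ^ a) ^ e       ≡⟨ ^-*-assoc (suc a) a e ⟩
      suc a ^ (a * e)       ∎

  -- Enumerating cuts

  subsets : ∀ n → List (Vec Bool n)
  subsets zero    = [ [] ]
  subsets (suc n) = map (true ∷_) (subsets n) ++ map (false ∷_) (subsets n)

  ∈-subsets : ∀ {n} (S : Vec Bool n) → S ∈ subsets n
  ∈-subsets []          = here refl
  ∈-subsets (true ∷ S)  = ∈-++⁺ˡ (∈-map⁺ (true ∷_) (∈-subsets S))
  ∈-subsets (false ∷ S) = ∈-++⁺ʳ (map (true ∷_) (subsets _)) (∈-map⁺ (false ∷_) (∈-subsets S))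

  shortLists : ∀ n → ℕ → List (List (Fin n))
  shortLists n zero    = [ [] ]
  shortLists n (suc k) = [] ∷ concatMap (λ v → map (v ∷_) (shortLists n k)) (allFin n)

  ∈-shortLists : ∀ {n} k (X : List (Fin n)) → length X ≤ k → X ∈ shortLists n k
  ∈-shortLists zero    []      _ = here refl
  ∈-shortLists (suc k) []      _ = here refl
  ∈-shortLists {n} (suc k) (v ∷ X) (s≤s X≤k) =
    there (∈-concatMap⁺ (λ v → map (v ∷_) (shortLists n k))
      (Any.map (λ { refl → ∈-map⁺ (v ∷_) (∈-shortLists k X X≤k) }) (∈-allFin v)))

  length-concatMap : {A B : Set} (f : A → List B) (xs : List A) → length (concatMap f xs) ≡ ∑ xs (length ∘ f)
  length-concatMap f []       = refl
  length-concatMap f (x ∷ xs) = trans (length-++ (f x)) (cong (length (f x) +_) (length-concatMap f xs))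

  length-shortLists : ∀ n k → length (shortLists n k) ≤ suc n ^ k
  length-shortLists n zero    = ≤-refl
  length-shortLists n (suc k) = begin
    suc (length (concatMap (λ v → map (v ∷_) (shortLists n k)) (allFin n)))
      ≡⟨ cong suc (trans (length-concatMap _ (allFin n)) (∑-cong (allFin n) (λ v → length-map (v ∷_) (shortLists n k)))) ⟩
    suc (∑ᶠ n (λ _ → length (shortLists n k)))
      ≡⟨ cong suc (trans (∑-const (allFin n) _) (cong (_* length (shortLists n k)) (length-tabulate {n = n} (λ i → i)))) ⟩
    suc (n * length (shortLists n k))
      ≤⟨ +-mono-≤ (m^n>0 (suc n) k) (*-monoʳ-≤ n (length-shortLists n k)) ⟩
    suc n ^ k + n * suc n ^ k ∎
    where open ≤-Reasoning

  -- The monomial `x ^ |S| * y ^ (i - |S|)`: a factor `x / y` per vertex of `S`, made integral by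
  -- homogeneity, so that summing over all sets gives a power of `x + y`.
  weight : ℕ → ℕ → ∀ {i} → Vec Bool i → ℕ
  weight x y []          = 1
  weight x y (true ∷ S)  = x * weight x y S
  weight x y (false ∷ S) = y * weight x y S

  ∑-weight : ∀ x y n → ∑ (subsets n) (weight x y) ≡ (x + y) ^ n
  ∑-weight x y zero    = refl
  ∑-weight x y (suc n) = begin
    ∑ (map (true ∷_) (subsets n) ++ map (false ∷_) (subsets n)) (weight x y)
      ≡⟨ ∑-++ (map (true ∷_) (subsets n)) _ (weight x y) ⟩
    ∑ (map (true ∷_) (subsets n)) (weight x y) + ∑ (map (false ∷_) (subsets n)) (weight x y)
      ≡⟨ cong₂ _+_ (trans (∑-map (true ∷_) (subsets n) _) (∑-*ˡ (subsets n) x _))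
                   (trans (∑-map (false ∷_) (subsets n) _) (∑-*ˡ (subsets n) y _)) ⟩
    x * ∑ (subsets n) (weight x y) + y * ∑ (subsets n) (weight x y)
      ≡⟨ *-distribʳ-+ _ x y ⟨
    (x + y) * ∑ (subsets n) (weight x y)
      ≡⟨ cong ((x + y) *_) (∑-weight x y n) ⟩
    (x + y) ^ suc n ∎
    where open ≡-Reasoning

  weight-const : ∀ y {i} (S : Vec Bool i) → weight y y S ≡ y ^ i
  weight-const y []          = refl
  weight-const y (true ∷ S)  = cong (y *_) (weight-const y S)
  weight-const y (false ∷ S) = cong (y *_) (weight-const y S)

  size-∷ : ∀ {i} b (S : Vec Bool i) → size (lookup (b ∷ S)) ≡ ind b + size (lookup S)
  size-∷ {i} b S = ∑ᶠ-suc i (ind ∘ lookup (b ∷ S))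

  -- Passing from `x′` to `x = (a / d) x′` costs one factor `a / d` for each vertex of `S`.
  weight-exchange : ∀ {a d x x′} y → d * x ≡ a * x′ → ∀ {i} (S : Vec Bool i) →
    d ^ size (lookup S) * weight x y S ≡ a ^ size (lookup S) * weight x′ y S
  weight-exchange y eq [] = refl
  weight-exchange {a} {d} {x} {x′} y eq (false ∷ S) = begin
    d ^ size (lookup (false ∷ S)) * (y * weight x y S)  ≡⟨ cong (λ z → d ^ z * (y * weight x y S)) (size-∷ false S) ⟩
    d ^ s * (y * weight x y S)                          ≡⟨ r (d ^ s) y (weight x y S) ⟩
    y * (d ^ s * weight x y S)                          ≡⟨ cong (y *_) (weight-exchange y eq S) ⟩
    y * (a ^ s * weight x′ y S)                         ≡⟨ r (a ^ s) y (weight x′ y S) ⟨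
    a ^ s * (y * weight x′ y S)                         ≡⟨ cong (λ z → a ^ z * (y * weight x′ y S)) (size-∷ false S) ⟨
    a ^ size (lookup (false ∷ S)) * (y * weight x′ y S) ∎
    where
    open ≡-Reasoning
    s = size (lookup S)
    r : ∀ p y w → p * (y * w) ≡ y * (p * w)
    r = solve-∀
  weight-exchange {a} {d} {x} {x′} y eq (true ∷ S) = begin
    d ^ size (lookup (true ∷ S)) * (x * weight x y S)   ≡⟨ cong (λ z → d ^ z * (x * weight x y S)) (size-∷ true S) ⟩
    d ^ suc s * (x * weight x y S)                      ≡⟨ r d (d ^ s) x (weight x y S) ⟩
    d * x * (d ^ s * weight x y S)                      ≡⟨ cong₂ _*_ eq (weight-exchange y eq S) ⟩
    a * x′ * (a ^ s * weight x′ y S)                    ≡⟨ r a (a ^ s) x′ (weight x′ y S) ⟨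
    a ^ suc s * (x′ * weight x′ y S)                    ≡⟨ cong (λ z → a ^ z * (x′ * weight x′ y S)) (size-∷ true S) ⟨
    a ^ size (lookup (true ∷ S)) * (x′ * weight x′ y S) ∎
    where
    open ≡-Reasoning
    s = size (lookup S)
    r : ∀ d p x w → d * p * (x * w) ≡ d * x * (p * w)
    r = solve-∀

  nonempty-weight : ℕ → ℕ → ∀ {i} → Vec Bool i → ℕ
  nonempty-weight x y S = if does (1 ≤? size (lookup S)) then weight x y S else 0

  -- The extra term `y ^ n` on the left is the weight of the empty set.
  ∑-nonempty-weight : ∀ x y n → ∑ (subsets n) (nonempty-weight x y) + y ^ n ≤ (x + y) ^ n
  ∑-nonempty-weight x y zero    = ≤-refl
  ∑-nonempty-weight x y (suc n) = begin
    ∑ (map (true ∷_) (subsets n) ++ map (false ∷_) (subsets n)) ω + y * y ^ n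
      ≡⟨ cong (_+ y * y ^ n) (∑-++ (map (true ∷_) (subsets n)) _ ω) ⟩
    ∑ (map (true ∷_) (subsets n)) ω + ∑ (map (false ∷_) (subsets n)) ω + y * y ^ n
      ≡⟨ cong₂ (λ a b → a + b + y * y ^ n) (∑-map (true ∷_) (subsets n) ω) (∑-map (false ∷_) (subsets n) ω) ⟩
    ∑ (subsets n) (ω ∘ (true ∷_)) + ∑ (subsets n) (ω ∘ (false ∷_)) + y * y ^ n
      ≤⟨ +-monoˡ-≤ (y * y ^ n) (+-mono-≤ (∑-mono (subsets n) on-true) (≤-reflexive (∑-cong (subsets n) on-false))) ⟩
    ∑ (subsets n) (λ S → x * weight x y S) + ∑ (subsets n) (λ S → y * nonempty-weight x y S) + y * y ^ n
      ≡⟨ cong₂ (λ a b → a + b + y * y ^ n) (trans (∑-*ˡ (subsets n) x _) (cong (x *_) (∑-weight x y n))) (∑-*ˡ (subsets n) y _) ⟩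
    x * (x + y) ^ n + y * ∑ (subsets n) (nonempty-weight x y) + y * y ^ n
      ≡⟨ r x ((x + y) ^ n) y (∑ (subsets n) (nonempty-weight x y)) (y ^ n) ⟩
    x * (x + y) ^ n + y * (∑ (subsets n) (nonempty-weight x y) + y ^ n)
      ≤⟨ +-monoʳ-≤ (x * (x + y) ^ n) (*-monoʳ-≤ y (∑-nonempty-weight x y n)) ⟩
    x * (x + y) ^ n + y * (x + y) ^ n
      ≡⟨ *-distribʳ-+ ((x + y) ^ n) x y ⟨
    (x + y) * (x + y) ^ n ∎
    where
    open ≤-Reasoning
    ω : Vec Bool (suc n) → ℕ
    ω = nonempty-weight x y
    r : ∀ x p y s q → x * p + y * s + y * q ≡ x * p + y * (s + q)
    r = solve-∀
    on-true : ∀ S → ω (true ∷ S) ≤ x * weight x y S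
    on-true S = ≤-refl
    on-false : ∀ S → ω (false ∷ S) ≡ y * nonempty-weight x y S
    on-false S rewrite size-∷ false S with does (1 ≤? size (lookup S))
    ... | true  = refl
    ... | false = sym (*-zeroʳ y)

  -- (1 + 1/K)^n ≤ 1 + 2n/K for 2n ≤ K
  binomial-bound : ∀ x y K n → K * x ≤ y → 2 * n ≤ K → (x + y) ^ n * K ≤ y ^ n * (K + 2 * n)
  binomial-bound x y K zero Kx≤y _ = ≤-reflexive (r K)
    where
    r : ∀ K → 1 * K ≡ 1 * (K + 0)
    r = solve-∀
  binomial-bound x y zero (suc n) _ ()
  binomial-bound x y K@(suc _) (suc n) Kx≤y 2n≤K = *-cancelʳ-≤ _ _ K (begin
    (x + y) * P * K * K                     ≡⟨ r₁ x y P K ⟩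
    P * K * (K * x + K * y)                 ≤⟨ *-mono-≤ (binomial-bound x y K n Kx≤y 2n≤K′) (+-monoˡ-≤ (K * y) Kx≤y) ⟩
    Q * (K + 2 * n) * (y + K * y)           ≡⟨ r₂ Q K n y ⟩
    y * Q * (K * K + K + 2 * n * K + 2 * n) ≤⟨ *-monoʳ-≤ (y * Q) (+-monoʳ-≤ (K * K + K + 2 * n * K) 2n≤K′) ⟩
    y * Q * (K * K + K + 2 * n * K + K)     ≡⟨ r₃ y Q K n ⟩
    y * Q * (K + 2 * suc n) * K             ∎)
    where
    open ≤-Reasoning
    P = (x + y) ^ n
    Q = y ^ n
    2n≤K′ : 2 * n ≤ K
    2n≤K′ = ≤-trans (*-monoʳ-≤ 2 (n≤1+n n)) 2n≤K
    r₁ : ∀ x y P K → (x + y) * P * K * K ≡ P * K * (K * x + K * y)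
    r₁ = solve-∀
    r₂ : ∀ Q K n y → Q * (K + 2 * n) * (y + K * y) ≡ y * Q * (K * K + K + 2 * n * K + 2 * n)
    r₂ = solve-∀
    r₃ : ∀ y Q K n → y * Q * (K * K + K + 2 * n * K + K) ≡ y * Q * (K + 2 * suc n) * K
    r₃ = solve-∀

  ∑-nonempty-bound : ∀ x y K n → K * x ≤ y → 2 * n ≤ K → ∑ (subsets n) (nonempty-weight x y) * K ≤ y ^ n * (2 * n)
  ∑-nonempty-bound x y K n Kx≤y 2n≤K = +-cancelʳ-≤ (y ^ n * K) _ _ (begin
    Σω * K + y ^ n * K           ≡⟨ *-distribʳ-+ K Σω (y ^ n) ⟨
    (Σω + y ^ n) * K             ≤⟨ *-monoˡ-≤ K (∑-nonempty-weight x y n) ⟩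
    (x + y) ^ n * K              ≤⟨ binomial-bound x y K n Kx≤y 2n≤K ⟩
    y ^ n * (K + 2 * n)          ≡⟨ r (y ^ n) K n ⟩
    y ^ n * (2 * n) + y ^ n * K  ∎)
    where
    open ≤-Reasoning
    Σω = ∑ (subsets n) (nonempty-weight x y)
    r : ∀ q K n → q * (K + 2 * n) ≡ q * (2 * n) + q * K
    r = solve-∀

  module Cuts (n k T a : ℕ) (1≤n : 1 ≤ n) (d≡8n : suc a ≡ 8 * n) where

    d y : ℕ
    d = suc a
    y = d ^ T

    -- `x t / y` is `(1 - 1 / (8n)) ^ t`, where `t` counts the rounds still to come; the power of
    -- `d` gives these fractions the common denominator `y`.
    x : ℕ → ℕ
    x t = a ^ t * d ^ (T ∸ t)

    x-zero : x 0 ≡ y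
    x-zero = +-identityʳ (d ^ T)

    x-suc : ∀ {t} → suc t ≤ T → d * x (suc t) ≡ a * x t
    x-suc {t} t<T = trans (r a d (a ^ t) (d ^ (T ∸ suc t))) (cong (λ z → a * (a ^ t * d ^ z)) (sym (+-∸-assoc 1 t<T)))
      where
      r : ∀ a d p q → d * (a * p * q) ≡ a * (p * (d * q))
      r = solve-∀

    weight-suc : ∀ {t} → suc t ≤ T → (S : Vec Bool n) →
      d ^ size (lookup S) * weight (x (suc t)) y S ≡ a ^ size (lookup S) * weight (x t) y S
    weight-suc t<T = weight-exchange y (x-suc t<T)

    crossing : Vec Bool n → List (Fin n) → List (Edge n) → ℕ
    crossing S X L = cnt (cross (lookup S) (rest S X)) L

    -- The first condition excludes the empty set, whose cut can never be crossed. As at most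
    -- `n * n` edges are free, the last one lets a random free edge cross with probability at least
    -- `|S| / (8n)`.
    Alive : (M U : List (Edge n)) → Vec Bool n → List (Fin n) → Set
    Alive M U S X = 1 ≤ size (lookup S) × crossing S X M ≡ 0 × size (lookup S) * n ≤ 8 * crossing S X U

    alive? : ∀ M U S X → Dec (Alive M U S X)
    alive? M U S X = 1 ≤? size (lookup S) ×-dec (crossing S X M ≟ 0 ×-dec size (lookup S) * n ≤? 8 * crossing S X U)

    -- Scaled by y ^ n, a living cut with t rounds to go weighs (1 - 1/(8n))^(|S| t).
    φ : ℕ → (M U : List (Edge n)) → Vec Bool n → List (Fin n) → ℕ
    φ t M U S X = if does (alive? M U S X) then weight (x t) y S else 0

    φ-alive : ∀ t M U S X → Alive M U S X → φ t M U S X ≡ weight (x t) y S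
    φ-alive t M U S X alive = cong (if_then weight (x t) y S else 0) (dec-true (alive? M U S X) alive)

    φ-dead : ∀ t M U S X → ¬ Alive M U S X → φ t M U S X ≡ 0
    φ-dead t M U S X dead = cong (if_then weight (x t) y S else 0) (dec-false (alive? M U S X) dead)

    cuts : List (List (Fin n))
    cuts = shortLists n k

    Φ₁ : ℕ → (M U : List (Edge n)) → ℕ
    Φ₁ t M U = ∑ cuts (λ X → ∑ (subsets n) (λ S → φ t M U S X))

    φ≤Φ₁ : ∀ t M U S X → length X ≤ k → φ t M U S X ≤ Φ₁ t M U
    φ≤Φ₁ t M U S X X≤k = ≤-trans (∈⇒≤∑ (λ S → φ t M U S X) (∈-subsets S))
      (∈⇒≤∑ (λ X → ∑ (subsets n) (λ S → φ t M U S X)) (∈-shortLists k X X≤k))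

    module _ (m : ℕ) (1≤m : 1 ≤ m) (M U U′ : List (Edge n)) (U′≤U : ∀ f → ∑ U′ f ≤ ∑ U f)
             (U′-small : length U′ ≤ n * n) where

      private
        r : ℕ
        r = m ⊓ length U′
        C : List (List (Edge n) × List (Edge n))
        C = choices r U′

      -- A dead cut stays dead, since Maker's edges only grow and the free ones only shrink. A cut
      -- alive after Breaker's move survives only if Maker misses it, which has probability at most
      -- `1 - s / (8n) ≤ (1 - 1 / (8n)) ^ s`; this is exactly the ratio of the weights at `suc t`
      -- and `t`.
      φ-round : ∀ {t} → suc t ≤ T → ∀ S X →
        ∑ C (λ c → φ t (M ++ proj₁ c) (proj₂ c) S X) ≤ length C * φ (suc t) M U S X
      φ-round {t} t<T S X with alive? M U′ S X
      ... | no dead = subst (_≤ length C * φ (suc t) M U S X) (sym all-dead) z≤n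
        where
        still-dead : ∀ {c} → c ∈ C → ¬ Alive (M ++ proj₁ c) (proj₂ c) S X
        still-dead {c} c∈C (1≤s , uncrossed , enough) = dead (1≤s
          , m+n≡0⇒m≡0 (crossing S X M) (trans (sym (∑-++ M (proj₁ c) _)) uncrossed)
          , ≤-trans enough (*-monoʳ-≤ 8 (∑-unchosen≤ r U′ c∈C (ind ∘ cross (lookup S) (rest S X)))))
        all-dead : ∑ C (λ c → φ t (M ++ proj₁ c) (proj₂ c) S X) ≡ 0
        all-dead = n≤0⇒n≡0 (≤-trans (∑-mono-∈ C (λ {c} c∈C → ≤-reflexive (φ-dead t (M ++ proj₁ c) (proj₂ c) S X (still-dead c∈C)))) (≤-reflexive (∑-zero C)))
      ... | yes (1≤s , uncrossed , enough) = begin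
        ∑ C (λ c → φ t (M ++ proj₁ c) (proj₂ c) S X) ≤⟨ ∑-mono-∈ C pointwise ⟩
        ∑ C (λ c → avoid P (proj₁ c) * w)            ≡⟨ ∑-*ʳ C (avoid P ∘ proj₁) w ⟩
        miss * w                                     ≤⟨ *-cancelˡ-≤ (d ^ s) {{m^n≢0 d s}} scaled ⟩
        length C * weight (x (suc t)) y S            ≡⟨ cong (length C *_) (φ-alive (suc t) M U S X (1≤s , uncrossed , ≤-trans enough (*-monoʳ-≤ 8 (U′≤U (ind ∘ P))))) ⟨
        length C * φ (suc t) M U S X                 ∎
        where
        open ≤-Reasoning
        s = size (lookup S)
        P = cross (lookup S) (rest S X)
        w = weight (x t) y S
        miss = ∑ C (avoid P ∘ proj₁)
        f = crossing S X U′
        u = length U′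
        1≤f : 1 ≤ f
        1≤f = 1≤m*n⇒1≤n 8 f (≤-trans (*-mono-≤ 1≤s 1≤n) enough)
        f≤u : f ≤ u
        f≤u = ≤-trans (∑-mono U′ (λ e → ind≤1 (P e))) (≤-reflexive (∑-one U′))
        1≤u : 1 ≤ u
        1≤u = ≤-trans 1≤f f≤u
        pointwise : ∀ {c} → c ∈ C → φ t (M ++ proj₁ c) (proj₂ c) S X ≤ avoid P (proj₁ c) * w
        pointwise {c} c∈C with avoid-dichotomy P (proj₁ c)
        ... | inj₂ (av , hit) = subst (_≤ avoid P (proj₁ c) * w) (sym (φ-dead t (M ++ proj₁ c) (proj₂ c) S X
                (λ { (_ , z , _) → contradiction (trans (sym (∑-++ M (proj₁ c) (ind ∘ P))) z) (m<n⇒n≢0 (≤-trans hit (m≤n+m (cnt P (proj₁ c)) (cnt P M)))) }))) z≤n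
        ... | inj₁ (av , _) rewrite av with does (alive? (M ++ proj₁ c) (proj₂ c) S X)
        ...   | true  = ≤-reflexive (sym (+-identityʳ w))
        ...   | false = z≤n
        linear : miss * d + length C * s ≤ length C * d
        linear = *-cancelˡ-≤ u {{>-nonZero 1≤u}} (begin
          u * (miss * d + length C * s)            ≡⟨ e₁ u miss d (length C) s ⟩
          miss * u * d + length C * (s * u)        ≤⟨ +-monoʳ-≤ (miss * u * d) (*-monoʳ-≤ (length C) su≤fd) ⟩
          miss * u * d + length C * (f * d)        ≡⟨ e₂ miss u d (length C) f ⟩
          (miss * u + length C * f) * d            ≤⟨ *-monoˡ-≤ d (miss-linear P r U′ (⊓-glb 1≤m 1≤u) 1≤u) ⟩
          length C * u * d                         ≡⟨ e₃ (length C) u d ⟩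
          u * (length C * d)                       ∎)
          where
          e₁ : ∀ u miss d c s → u * (miss * d + c * s) ≡ miss * u * d + c * (s * u)
          e₁ = solve-∀
          e₂ : ∀ miss u d c f → miss * u * d + c * (f * d) ≡ (miss * u + c * f) * d
          e₂ = solve-∀
          e₃ : ∀ c u d → c * u * d ≡ u * (c * d)
          e₃ = solve-∀
          e₄ : ∀ f n → f * (8 * n) ≡ 8 * f * n
          e₄ = solve-∀
          su≤fd : s * u ≤ f * d
          su≤fd = begin
            s * u       ≤⟨ *-monoʳ-≤ s U′-small ⟩
            s * (n * n) ≡⟨ *-assoc s n n ⟨
            s * n * n   ≤⟨ *-monoˡ-≤ n enough ⟩
            8 * f * n   ≡⟨ e₄ f n ⟨
            f * (8 * n) ≡⟨ cong (f *_) d≡8n ⟨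
            f * d       ∎
        ratio : miss * d ^ s ≤ length C * a ^ s
        ratio = *-cancelˡ-≤ d (≤-by-slack 0
          (+-mono-≤ (*-monoʳ-≤ (d ^ s) linear) (*-monoʳ-≤ (length C) (bernoulli-down a s)))
          (e d (a ^ s) (d ^ s) s miss (length C)))
          where
          e : ∀ d p q s m c → d * (m * q) + (q * (c * d) + c * (d * p + s * q)) + 0
                            ≡ d * (c * p) + (q * (m * d + c * s) + c * (d * q))
          e = solve-∀
        scaled : d ^ s * (miss * w) ≤ d ^ s * (length C * weight (x (suc t)) y S)
        scaled = begin
          d ^ s * (miss * w)                             ≡⟨ e₁ (d ^ s) miss w ⟩
          miss * d ^ s * w                               ≤⟨ *-monoˡ-≤ w ratio ⟩
          length C * a ^ s * w                           ≡⟨ *-assoc (length C) (a ^ s) w ⟩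
          length C * (a ^ s * w)                         ≡⟨ cong (length C *_) (weight-suc t<T S) ⟨
          length C * (d ^ s * weight (x (suc t)) y S)    ≡⟨ e₂ (length C) (d ^ s) (weight (x (suc t)) y S) ⟩
          d ^ s * (length C * weight (x (suc t)) y S)    ∎
          where
          e₁ : ∀ p m w → p * (m * w) ≡ m * p * w
          e₁ = solve-∀
          e₂ : ∀ c p w → c * (p * w) ≡ p * (c * w)
          e₂ = solve-∀

      Φ₁-round : ∀ {t} → suc t ≤ T →
        ∑ C (λ c → Φ₁ t (M ++ proj₁ c) (proj₂ c)) ≤ length C * Φ₁ (suc t) M U
      Φ₁-round {t} t<T = begin
        ∑ C (λ c → ∑ cuts (λ X → ∑ (subsets n) (λ S → φ t (M ++ proj₁ c) (proj₂ c) S X)))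
          ≡⟨ ∑-swap C cuts _ ⟩
        ∑ cuts (λ X → ∑ C (λ c → ∑ (subsets n) (λ S → φ t (M ++ proj₁ c) (proj₂ c) S X)))
          ≡⟨ ∑-cong cuts (λ X → ∑-swap C (subsets n) _) ⟩
        ∑ cuts (λ X → ∑ (subsets n) (λ S → ∑ C (λ c → φ t (M ++ proj₁ c) (proj₂ c) S X)))
          ≤⟨ ∑-mono cuts (λ X → ∑-mono (subsets n) (λ S → φ-round t<T S X)) ⟩
        ∑ cuts (λ X → ∑ (subsets n) (λ S → length C * φ (suc t) M U S X))
          ≡⟨ ∑-cong cuts (λ X → ∑-*ˡ (subsets n) (length C) _) ⟩
        ∑ cuts (λ X → length C * ∑ (subsets n) (λ S → φ (suc t) M U S X))
          ≡⟨ ∑-*ˡ cuts (length C) _ ⟩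
        length C * Φ₁ (suc t) M U ∎
        where open ≤-Reasoning

    -- The premise says `(1 - 1 / (8n)) ^ T ≤ 1 / K`. So for each `X` the sum of `K ^ (- |S|)` over
    -- nonempty `S` is at most `(1 + 1 / K) ^ n - 1 ≤ 2n / K`.
    Φ₁-init : ∀ K M U → K * a ^ T ≤ d ^ T → 2 * n ≤ K → Φ₁ T M U * K ≤ length cuts * (2 * n) * y ^ n
    Φ₁-init K M U Ka≤d 2n≤K = begin
      Φ₁ T M U * K                                        ≤⟨ *-monoˡ-≤ K (∑-mono cuts (λ X → ∑-mono (subsets n) (φ≤ X))) ⟩
      ∑ cuts (λ _ → ∑ (subsets n) (nonempty-weight (x T) y)) * K ≡⟨ cong (_* K) (∑-const cuts _) ⟩
      length cuts * ∑ (subsets n) (nonempty-weight (x T) y) * K  ≡⟨ *-assoc (length cuts) _ K ⟩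
      length cuts * (∑ (subsets n) (nonempty-weight (x T) y) * K) ≤⟨ *-monoʳ-≤ (length cuts) (∑-nonempty-bound (x T) y K n Kx≤y 2n≤K) ⟩
      length cuts * (y ^ n * (2 * n))                     ≡⟨ e (length cuts) (y ^ n) (2 * n) ⟩
      length cuts * (2 * n) * y ^ n                       ∎
      where
      open ≤-Reasoning
      e : ∀ l p q → l * (p * q) ≡ l * q * p
      e = solve-∀
      Kx≤y : K * x T ≤ y
      Kx≤y = subst (λ z → K * z ≤ y) (sym (trans (cong (λ z → a ^ T * d ^ z) (n∸n≡0 T)) (*-identityʳ (a ^ T)))) Ka≤d
      φ≤ : ∀ X S → φ T M U S X ≤ nonempty-weight (x T) y S
      φ≤ X S = if-∧ (does (1 ≤? size (lookup S))) _
        where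
        if-∧ : ∀ b c {w} → (if b ∧ c then w else 0) ≤ (if b then w else 0)
        if-∧ true  true  = ≤-refl
        if-∧ true  false = z≤n
        if-∧ false c     = z≤n

-- Breaker's attacks on single vertices, and the heads that answer them.

module AttackPotential where

  open FiniteSums
  open Graphs
  open CutPotential
  open import Data.Nat using (ℕ; zero; suc; _+_; _*_; _∸_; _^_; _⊓_; _≤_; _<_; _≤?_; _<?_; _≡ᵇ_; ⌊_/2⌋; z≤n; s≤s; >-nonZero)
  open import Data.Nat.Properties hiding (_<?_; _≤?_; _≟_)
  open import Data.Nat.Tactic.RingSolver using (solve-∀)
  open import Data.Bool using (Bool; true; false; not; _∧_; if_then_else_)
  open import Data.Fin using (Fin)
  open import Data.Fin.Properties using (_≟_)
  open import Data.List using (List; []; _∷_; [_]; _++_; length; allFin)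
  open import Data.List.Membership.Propositional using (_∈_)
  open import Data.List.Membership.Propositional.Properties using (∈-allFin; ∈-++⁻)
  open import Data.List.Relation.Unary.Any using (here)
  open import Data.Product using (_×_; _,_; proj₁; proj₂)
  open import Data.Sum using (_⊎_; inj₁; inj₂)
  open import Function using (_∘_)
  open import Relation.Nullary using (Dec; yes; no; does; ¬_; contradiction)
  open import Relation.Nullary.Decidable using (dec-true; dec-false; _×-dec_)
  open import Relation.Binary.PropositionalEquality using (_≡_; _≢_; refl; sym; trans; cong; cong₂; subst; module ≡-Reasoning)
  open import Defs using (edges; Edge; choices)

  module VertexPotential (n D θ g : ℕ) where

    -- A move at an attacked vertex misses with probability at most `4g / (4g + 1)`. Counting 1 for
    -- a miss and 1/2 for a hit, the mean is at most `(8g + 1) / (8g + 2) = α / β`, so Breaker may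
    -- gain a factor `β / α` per move. `κ` is the danger at degree `θ` without heads, divided by
    -- `θ`.
    α β κ Z₂ : ℕ
    α = 8 * g + 1
    β = suc α
    κ = 2 ^ D * α ^ θ
    Z₂ = θ * β ^ θ

    pw : ℕ → ℕ
    pw i = α ^ (θ ∸ i) * β ^ i

    Unhappy : ℕ → ℕ → Set
    Unhappy c dm = c < D × 16 * dm < n

    unhappy? : ∀ c dm → Dec (Unhappy c dm)
    unhappy? c dm = c <? D ×-dec 16 * dm <? n

    danger : ℕ → ℕ → ℕ
    danger b c = θ * (2 ^ (D ∸ c) * pw (b ∸ θ))

    -- Scaled by Z₂.  Below θ the potential is linear in Breaker's degree b, so that each of his
    -- moves costs at most κ; above θ it is 2^(D - c) (α / β)^(2θ - b) for a vertex with c heads.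
    Ψ : ℕ → ℕ → ℕ → ℕ
    Ψ b c dm = if does (b <? θ) then b * κ else (if does (unhappy? c dm) then danger b c else 0)

    Ψ-low : ∀ b c dm → b < θ → Ψ b c dm ≡ b * κ
    Ψ-low b c dm b<θ = cong (if_then b * κ else (if does (unhappy? c dm) then danger b c else 0)) (dec-true (b <? θ) b<θ)

    private
      Ψ-high : ∀ b c dm → θ ≤ b → Ψ b c dm ≡ (if does (unhappy? c dm) then danger b c else 0)
      Ψ-high b c dm θ≤b = cong (if_then b * κ else (if does (unhappy? c dm) then danger b c else 0)) (dec-false (b <? θ) (≤⇒≯ θ≤b))

    Ψ-unhappy : ∀ b c dm → θ ≤ b → Unhappy c dm → Ψ b c dm ≡ danger b c
    Ψ-unhappy b c dm θ≤b un = trans (Ψ-high b c dm θ≤b) (cong (if_then danger b c else 0) (dec-true (unhappy? c dm) un))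

    Ψ-happy : ∀ b c dm → θ ≤ b → ¬ Unhappy c dm → Ψ b c dm ≡ 0
    Ψ-happy b c dm θ≤b hp = trans (Ψ-high b c dm θ≤b) (cong (if_then danger b c else 0) (dec-false (unhappy? c dm) hp))

    danger-anti : ∀ b {c c′} → c ≤ c′ → danger b c′ ≤ danger b c
    danger-anti b c≤c′ = *-monoʳ-≤ θ (*-monoˡ-≤ (pw (b ∸ θ)) (^-monoʳ-≤ 2 (∸-monoʳ-≤ D c≤c′)))

    Unhappy-anti : ∀ {c c′ dm dm′} → c ≤ c′ → dm ≤ dm′ → Unhappy c′ dm′ → Unhappy c dm
    Unhappy-anti c≤c′ dm≤dm′ (c′<D , dm′<) = ≤-<-trans c≤c′ c′<D , ≤-<-trans (*-monoʳ-≤ 16 dm≤dm′) dm′<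

    Ψ-anti : ∀ b {c c′ dm dm′} → c ≤ c′ → dm ≤ dm′ → Ψ b c′ dm′ ≤ Ψ b c dm
    Ψ-anti b {c} {c′} {dm} {dm′} c≤c′ dm≤dm′ with <-≤-connex b θ
    ... | inj₁ b<θ = ≤-reflexive (trans (Ψ-low b c′ dm′ b<θ) (sym (Ψ-low b c dm b<θ)))
    ... | inj₂ θ≤b with unhappy? c′ dm′
    ...   | no hp  = subst (_≤ Ψ b c dm) (sym (Ψ-happy b c′ dm′ θ≤b hp)) z≤n
    ...   | yes un = begin
      Ψ b c′ dm′  ≡⟨ Ψ-unhappy b c′ dm′ θ≤b un ⟩
      danger b c′ ≤⟨ danger-anti b c≤c′ ⟩
      danger b c  ≡⟨ Ψ-unhappy b c dm θ≤b (Unhappy-anti c≤c′ dm≤dm′ un) ⟨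
      Ψ b c dm    ∎
      where open ≤-Reasoning

    -- By the choice of `κ` the line `b * κ` meets the exponential branch without heads at `b = θ`,
    -- so even the step onto that branch costs at most `κ`.
    Ψ-low-step : ∀ b c dm → b < θ → Ψ (suc b) c dm ≤ suc b * κ
    Ψ-low-step b c dm b<θ with <-≤-connex (suc b) θ
    ... | inj₁ b′<θ = ≤-reflexive (Ψ-low (suc b) c dm b′<θ)
    ... | inj₂ θ≤b′ with unhappy? c dm
    ...   | no hp  = subst (_≤ suc b * κ) (sym (Ψ-happy (suc b) c dm θ≤b′ hp)) z≤n
    ...   | yes un = begin
      Ψ (suc b) c dm                           ≡⟨ Ψ-unhappy (suc b) c dm θ≤b′ un ⟩
      θ * (2 ^ (D ∸ c) * pw (suc b ∸ θ))       ≡⟨ cong (λ z → θ * (2 ^ (D ∸ c) * pw z)) (m≤n⇒m∸n≡0 b<θ) ⟩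
      θ * (2 ^ (D ∸ c) * (α ^ θ * 1))          ≤⟨ *-mono-≤ θ≤b′ (*-mono-≤ (^-monoʳ-≤ 2 (m∸n≤m D c)) (≤-reflexive (*-identityʳ (α ^ θ)))) ⟩
      suc b * κ                                ∎
      where open ≤-Reasoning

    -- From degree `2 * θ` on, the truncated exponent of `α` is 0 and `pw` is at least `β ^ θ`, so
    -- one lost vertex exhausts all of `Z₂`.
    Ψ-bad : ∀ b c dm → 2 * θ ≤ b → Unhappy c dm → Z₂ ≤ Ψ b c dm
    Ψ-bad b c dm 2θ≤b un = begin
      θ * β ^ θ                                 ≤⟨ *-monoʳ-≤ θ (^-monoʳ-≤ β θ≤b∸θ) ⟩
      θ * β ^ (b ∸ θ)                           ≡⟨ cong (θ *_) (trans (sym (*-identityˡ _)) (cong (λ z → α ^ z * β ^ (b ∸ θ)) (sym (m≤n⇒m∸n≡0 θ≤b∸θ)))) ⟩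
      θ * pw (b ∸ θ)                            ≤⟨ *-monoʳ-≤ θ (m≤n*m (pw (b ∸ θ)) (2 ^ (D ∸ c)) {{m^n≢0 2 (D ∸ c)}}) ⟩
      danger b c                                ≡⟨ Ψ-unhappy b c dm θ≤b un ⟨
      Ψ b c dm                                  ∎
      where
      open ≤-Reasoning
      θ≤b : θ ≤ b
      θ≤b = ≤-trans (m≤n*m θ 2) 2θ≤b
      θ≤b∸θ : θ ≤ b ∸ θ
      θ≤b∸θ = subst (_≤ b ∸ θ) (trans (cong (_∸ θ) (cong (θ +_) (+-identityʳ θ))) (m+n∸n≡m θ θ)) (∸-monoˡ-≤ θ 2θ≤b)

    -- The bound `b < 2 * θ` keeps the exponent of `α` in `pw` positive, so that one factor `α` can
    -- be exchanged for `β`.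
    danger-suc : ∀ b c → θ ≤ b → b < 2 * θ → α * danger (suc b) c ≡ β * danger b c
    danger-suc b c θ≤b b<2θ = begin
      α * (θ * (2 ^ (D ∸ c) * pw (suc b ∸ θ)))  ≡⟨ cong (λ z → α * (θ * (2 ^ (D ∸ c) * pw z))) (+-∸-assoc 1 θ≤b) ⟩
      α * (θ * (2 ^ (D ∸ c) * pw (suc i)))      ≡⟨ r₁ α θ (2 ^ (D ∸ c)) (α ^ (θ ∸ suc i)) β (β ^ i) ⟩
      β * (θ * (2 ^ (D ∸ c) * (α ^ suc (θ ∸ suc i) * β ^ i))) ≡⟨ cong (λ z → β * (θ * (2 ^ (D ∸ c) * (α ^ z * β ^ i)))) (sym (+-∸-assoc 1 i<θ)) ⟩
      β * danger b c                            ∎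
      where
      open ≡-Reasoning
      i = b ∸ θ
      i<θ : i < θ
      i<θ = +-cancelʳ-< θ i θ (subst (_< θ + θ) (sym (m∸n+n≡m θ≤b)) (subst (b <_) (cong (θ +_) (+-identityʳ θ)) b<2θ))
      r₁ : ∀ α θ p q β w → α * (θ * (p * (q * (β * w)))) ≡ β * (θ * (p * (α * q * w)))
      r₁ = solve-∀

    halving : ∀ b c → c < D → 2 * danger b (suc c) ≡ danger b c
    halving b c c<D = trans (r θ (2 ^ (D ∸ suc c)) (pw (b ∸ θ)))
      (cong (λ z → θ * (2 ^ z * pw (b ∸ θ))) (sym (+-∸-assoc 1 c<D)))
      where
      r : ∀ θ p w → 2 * (θ * (p * w)) ≡ θ * (2 * p * w)
      r = solve-∀

    -- The average of 2^(-hits) over Maker's move makes up for the factor β / α gained by Breaker.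
    Ψ-average : {A : Set} (C : List A) (b c dm : ℕ) (av c′ dm′ : A → ℕ) →
      θ ≤ b → b < 2 * θ → Unhappy c dm →
      (∀ {i} → i ∈ C → c ≤ c′ i × dm ≤ dm′ i × (av i ≡ 1 ⊎ (av i ≡ 0 × suc c ≤ c′ i))) →
      ∑ C av * (4 * g + 1) ≤ length C * (4 * g) →
      ∑ C (λ i → Ψ (suc b) (c′ i) (dm′ i)) ≤ length C * Ψ b c dm
    Ψ-average C b c dm av c′ dm′ θ≤b b<2θ un cases miss = subst (λ z → ∑ C (λ i → Ψ (suc b) (c′ i) (dm′ i)) ≤ length C * z)
      (sym (Ψ-unhappy b c dm θ≤b un)) (*-cancelˡ-≤ (2 * β) (begin
        2 * β * ∑Ψ                           ≡⟨ r₁ β ∑Ψ ⟩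
        β * (2 * ∑Ψ)                         ≡⟨ cong (β *_) (∑-*ˡ C 2 _) ⟨
        β * ∑ C (λ i → 2 * Ψ (suc b) (c′ i) (dm′ i)) ≤⟨ *-monoʳ-≤ β (∑-mono-∈ C pointwise) ⟩
        β * ∑ C (λ i → (1 + av i) * E′)      ≡⟨ cong (β *_) (trans (∑-*ʳ C (λ i → 1 + av i) E′) (cong (_* E′) (trans (∑-+ C (λ _ → 1) av) (cong (_+ ∑ C av) (∑-one C))))) ⟩
        β * ((length C + ∑ C av) * E′)       ≡⟨ *-assoc β (length C + ∑ C av) E′ ⟨
        β * (length C + ∑ C av) * E′         ≤⟨ *-monoˡ-≤ E′ β≤α ⟩
        2 * length C * α * E′                ≡⟨ *-assoc (2 * length C) α E′ ⟩
        2 * length C * (α * E′)              ≡⟨ cong (2 * length C *_) (danger-suc b c θ≤b b<2θ) ⟩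
        2 * length C * (β * E)               ≡⟨ r₃ (length C) β E ⟩
        2 * β * (length C * E)               ∎))
      where
      open ≤-Reasoning
      ∑Ψ = ∑ C (λ i → Ψ (suc b) (c′ i) (dm′ i))
      E = danger b c
      E′ = danger (suc b) c
      θ≤b′ : θ ≤ suc b
      θ≤b′ = m≤n⇒m≤1+n θ≤b
      r₁ : ∀ β s → 2 * β * s ≡ β * (2 * s)
      r₁ = solve-∀
      r₂ : ∀ g l s → suc (8 * g + 1) * (l + s) + 2 * (l * (4 * g)) + 0 ≡ 2 * l * (8 * g + 1) + 2 * (s * (4 * g + 1))
      r₂ = solve-∀
      r₃ : ∀ l β e → 2 * l * (β * e) ≡ 2 * β * (l * e)
      r₃ = solve-∀
      β≤α : β * (length C + ∑ C av) ≤ 2 * length C * α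
      β≤α = ≤-by-slack 0 (*-monoʳ-≤ 2 miss) (r₂ g (length C) (∑ C av))
      pointwise : ∀ {i} → i ∈ C → 2 * Ψ (suc b) (c′ i) (dm′ i) ≤ (1 + av i) * E′
      pointwise {i} i∈C with cases i∈C
      ... | c≤ , dm≤ , inj₁ av≡1 = begin
        2 * Ψ (suc b) (c′ i) (dm′ i) ≤⟨ *-monoʳ-≤ 2 (Ψ-anti (suc b) c≤ dm≤) ⟩
        2 * Ψ (suc b) c dm           ≡⟨ cong (2 *_) (Ψ-unhappy (suc b) c dm θ≤b′ un) ⟩
        2 * E′                       ≡⟨ cong (λ z → (1 + z) * E′) av≡1 ⟨
        (1 + av i) * E′              ∎
      ... | _ , _ , inj₂ (av≡0 , c<c′) with unhappy? (c′ i) (dm′ i)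
      ...   | no hp   = subst (λ z → 2 * z ≤ (1 + av i) * E′) (sym (Ψ-happy (suc b) (c′ i) (dm′ i) θ≤b′ hp)) z≤n
      ...   | yes un′ = begin
        2 * Ψ (suc b) (c′ i) (dm′ i) ≡⟨ cong (2 *_) (Ψ-unhappy (suc b) (c′ i) (dm′ i) θ≤b′ un′) ⟩
        2 * danger (suc b) (c′ i)    ≤⟨ *-monoʳ-≤ 2 (danger-anti (suc b) c<c′) ⟩
        2 * danger (suc b) (suc c)   ≡⟨ halving (suc b) c (proj₁ un) ⟩
        E′                           ≡⟨ +-identityʳ E′ ⟨
        1 * E′                       ≡⟨ cong (λ z → (1 + z) * E′) av≡0 ⟨
        (1 + av i) * E′              ∎

  -- Heads: distinct Maker neighbours reserved for vertices under attack

  Heads : ℕ → Set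
  Heads n = List (Fin n × Fin n)

  outHeads : ∀ {n} → Fin n → Heads n → ℕ
  outHeads v H = ∑ H (λ p → δ v (proj₁ p))

  inHeads : ∀ {n} → Fin n → Heads n → ℕ
  inHeads w H = ∑ H (λ p → δ w (proj₂ p))

  ∑-outHeads : ∀ {n} (H : Heads n) → ∑ᶠ n (λ v → outHeads v H) ≡ length H
  ∑-outHeads {n} H = trans (∑-swap (allFin n) H _) (trans (∑-cong H (λ p → ∑-δ₁ (proj₁ p))) (∑-one H))

  ∑-inHeads : ∀ {n} (H : Heads n) → ∑ᶠ n (λ v → inHeads v H) ≡ length H
  ∑-inHeads {n} H = trans (∑-swap (allFin n) H _) (trans (∑-cong H (λ p → ∑-δ₁ (proj₂ p))) (∑-one H))

  2⌊n/2⌋≤n : ∀ n → 2 * ⌊ n /2⌋ ≤ n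
  2⌊n/2⌋≤n 0 = z≤n
  2⌊n/2⌋≤n 1 = z≤n
  2⌊n/2⌋≤n (suc (suc n)) = subst (_≤ suc (suc n)) (sym (*-suc 2 ⌊ n /2⌋)) (s≤s (s≤s (2⌊n/2⌋≤n n)))

  half : ∀ {n} → Bool → Fin n → Bool
  half {n} true  w = below ⌊ n /2⌋ w
  half {n} false w = not (below ⌊ n /2⌋ w)

  half-size : ∀ n side → n ≤ suc (2 * size (half {n} side))
  half-size n true = subst (λ z → n ≤ suc (2 * z)) (sym (∑-below n ⌊ n /2⌋ (⌊n/2⌋≤n n))) (lower n)
    where
    lower : ∀ n → n ≤ suc (2 * ⌊ n /2⌋)
    lower 0 = z≤n
    lower 1 = s≤s z≤n
    lower (suc (suc n)) = subst (suc (suc n) ≤_) (cong suc (sym (*-suc 2 ⌊ n /2⌋))) (s≤s (s≤s (lower n)))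
  half-size n false = subst (λ z → n ≤ suc (2 * z)) (sym (∑-not-below n ⌊ n /2⌋ (⌊n/2⌋≤n n))) (m≤n⇒m≤1+n (begin
    n                     ≡⟨ m+n∸n≡m n n ⟨
    n + n ∸ n             ≤⟨ ∸-monoʳ-≤ (n + n) (2⌊n/2⌋≤n n) ⟩
    n + n ∸ 2 * ⌊ n /2⌋   ≡⟨ cong (_∸ 2 * ⌊ n /2⌋) (cong (n +_) (sym (+-identityʳ n))) ⟩
    2 * n ∸ 2 * ⌊ n /2⌋   ≡⟨ *-distribˡ-∸ 2 n ⌊ n /2⌋ ⟨
    2 * (n ∸ ⌊ n /2⌋)     ∎))
    where
    open ≤-Reasoning

  fresh : ∀ {n} → Bool → Fin n → Heads n → Fin n → Bool
  fresh side v H w = half side w ∧ (not (does (w ≟ v)) ∧ (inHeads w H ≡ᵇ 0))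

  fresh-self : ∀ {n} side (v : Fin n) H → fresh side v H v ≡ false
  fresh-self side v H rewrite dec-true (v ≟ v) refl with half side v
  ... | true  = refl
  ... | false = refl

  fresh-elim : ∀ {n} side (v : Fin n) H {w} → fresh side v H w ≡ true → half side w ≡ true × inHeads w H ≡ 0
  fresh-elim side v H {w} eq with half side w | does (w ≟ v) | inHeads w H
  ... | true | false | zero = refl , refl

  hits : ∀ {n} → Bool → Fin n → Heads n → Edge n → Bool
  hits side v H = cross (sing v) (fresh side v H)

  module _ {n : ℕ} (M B U : List (Edge n)) (total : ∀ f → ∑ M f + (∑ B f + ∑ U f) ≡ ∑ (edges n) f) where

    -- A vertex of the half is `v` itself, a head in use, already joined to `v` by Maker or by
    -- Breaker, or else the end of a free edge that hits.
    half≤ : ∀ side v (H : Heads n) →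
      size (half {n} side) ≤ 1 + (length H + (deg M v + (deg B v + cnt (hits side v H) U)))
    half≤ side v H = begin
      ∑ᶠ n (λ w → ind (half side w))
        ≤⟨ ∑-mono (allFin n) pointwise ⟩
      ∑ᶠ n (λ w → δ w v + (inHeads w H + (adj M v w + (adj B v w + ind (fresh side v H w) * adj U v w))))
        ≡⟨ trans (∑-+ (allFin n) (λ w → δ w v) _) (cong₂ _+_ (∑-δ₁ v)
           (trans (∑-+ (allFin n) (λ w → inHeads w H) _) (cong₂ _+_ (∑-inHeads H)
           (trans (∑-+ (allFin n) (adj M v) _) (cong₂ _+_ (∑-adj M v)
           (trans (∑-+ (allFin n) (adj B v) _) (cong (_+ nbrs (fresh side v H) U v) (∑-adj B v)))))))) ⟩
      1 + (length H + (deg M v + (deg B v + nbrs (fresh side v H) U v)))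
        ≤⟨ +-monoʳ-≤ 1 (+-monoʳ-≤ (length H) (+-monoʳ-≤ (deg M v) (+-monoʳ-≤ (deg B v)
             (nbrs≤cross-sing v (fresh-self side v H) U)))) ⟩
      1 + (length H + (deg M v + (deg B v + cnt (hits side v H) U))) ∎
      where
      open ≤-Reasoning
      pointwise : ∀ w → ind (half side w) ≤ δ w v + (inHeads w H + (adj M v w + (adj B v w + ind (fresh side v H w) * adj U v w)))
      pointwise w with half side w | w ≟ v | inHeads w H
      ... | false | _      | _     = z≤n
      ... | true  | yes _  | _     = s≤s z≤n
      ... | true  | no _   | suc _ = s≤s z≤n
      ... | true  | no w≢v | zero  = ≤-reflexive (begin-equality
        1                                      ≡⟨ adj-edges-≢ (w≢v ∘ sym) ⟨
        adj (edges n) v w                      ≡⟨ total (lk v w) ⟨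
        adj M v w + (adj B v w + adj U v w)    ≡⟨ cong (λ z → adj M v w + (adj B v w + z)) (+-identityʳ (adj U v w)) ⟨
        adj M v w + (adj B v w + 1 * adj U v w) ∎)

    -- `(n - 1) / 2` less `1 + n / 64 + n / 16 + n / 32` (for `v`, the heads, Maker and Breaker) is
    -- still at least `n / 4` once `n ≥ 64`.
    hits-many : ∀ θ side v (H : Heads n) → 64 ≤ n → 64 * θ ≤ n → 64 * length H ≤ n →
      16 * deg M v < n → deg B v ≤ 2 * θ → n ≤ 4 * cnt (hits side v H) U
    hits-many θ side v H 64≤n 64θ≤n 64H≤n dM dB = *-cancelˡ-≤ 16 (≤-by-slack (7 * n + 32) (+-mono-≤ (*-monoʳ-≤ 32 (half-size n side))
        (+-mono-≤ (*-monoʳ-≤ 64 (half≤ side v H)) (+-mono-≤ 64H≤n (+-mono-≤ (*-monoʳ-≤ 4 (<⇒≤ dM)) (+-mono-≤ (*-monoʳ-≤ 64 dB)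
        (+-mono-≤ (*-monoʳ-≤ 2 64θ≤n) (*-monoʳ-≤ 2 64≤n)))))))
        (r n (size (half {n} side)) (length H) (deg M v) (deg B v) (cnt (hits side v H) U) θ))
      where
      r : ∀ n s h m b f θ →
        16 * n + (32 * suc (2 * s) + (64 * (1 + (h + (m + (b + f)))) + (n + (4 * n + (64 * (2 * θ) + (2 * n + 2 * n)))))) + (7 * n + 32)
        ≡ 16 * (4 * f) + (32 * n + (64 * s + (64 * h + (4 * (16 * m) + (64 * b + (2 * (64 * θ) + 2 * 64))))))
      r = solve-∀

  module Attack (n m D θ g : ℕ) (1≤n : 1 ≤ n) (n≤mg : n ≤ m * g) where

    open VertexPotential n D θ g public

    -- The reserve `2 * κ * t` pays in advance for the two endpoints whose degree Breaker raises in
    -- each of the `t` rounds to come.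
    Φ₂ : ℕ → (M B : List (Edge n)) → Heads n → ℕ
    Φ₂ t M B H = ∑ᶠ n (λ v → Ψ (deg B v) (outHeads v H) (deg M v)) + 2 * κ * t

    Ψ≤Φ₂ : ∀ t M B H v → Ψ (deg B v) (outHeads v H) (deg M v) ≤ Φ₂ t M B H
    Ψ≤Φ₂ t M B H v = ≤-trans (∈⇒≤∑ (λ v → Ψ (deg B v) (outHeads v H) (deg M v)) (∈-allFin v)) (m≤m+n _ _)

    Wants : (M B : List (Edge n)) → Heads n → Fin n → Set
    Wants M B H v = θ ≤ deg B v × Unhappy (outHeads v H) (deg M v)

    wants? : ∀ M B H v → Dec (Wants M B H v)
    wants? M B H v = θ ≤? deg B v ×-dec unhappy? (outHeads v H) (deg M v)

    module _ (M B : List (Edge n)) (H : Heads n) where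

      data Gain (side : Bool) (v : Fin n) (L : List (Edge n)) : Set where
        nothing : (Wants M B H v → cnt (hits side v H) L ≡ 0) → Gain side v L
        just    : ∀ w → Wants M B H v → fresh side v H w ≡ true → 1 ≤ adj L v w → Gain side v L

      abstract
        -- Opaque, since any fresh neighbour will do: the constructors of `Gain` record all that is
        -- used of the choice.
        gain : ∀ side v L → Gain side v L
        gain side v L with wants? M B H v
        ... | no ¬wants = nothing (λ wants → contradiction wants ¬wants)
        ... | yes wants with find (sing v) (fresh side v H) L
        ...   | inj₁ none = nothing (λ _ → none)
        ...   | inj₂ (u , w , u≡v , fr , 1≤) with u ≟ v
        ...     | yes refl = just w wants fr 1≤

      new : ∀ {side v L} → Gain side v L → Heads n
      new {v = v} (nothing _)    = []
      new {v = v} (just w _ _ _) = [ (v , w) ]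

      -- Both searches refer to the old `H`, so neither sees the head that the other may find; only
      -- the division into halves keeps the two apart.
      next : Edge n → List (Edge n) → Heads n
      next (x , y) L = new (gain true x L) ++ (new (gain false y L) ++ H)

      outHeads-next : ∀ v e L → outHeads v (next e L) ≡
        outHeads v (new (gain true (proj₁ e) L)) + (outHeads v (new (gain false (proj₂ e) L)) + outHeads v H)
      outHeads-next v (x , y) L = trans (∑-++ (new (gain true x L)) _ _)
        (cong (outHeads v (new (gain true x L)) +_) (∑-++ (new (gain false y L)) H _))

      inHeads-next : ∀ w e L → inHeads w (next e L) ≡
        inHeads w (new (gain true (proj₁ e) L)) + (inHeads w (new (gain false (proj₂ e) L)) + inHeads w H)
      inHeads-next w (x , y) L = trans (∑-++ (new (gain true x L)) _ _)
        (cong (inHeads w (new (gain true x L)) +_) (∑-++ (new (gain false y L)) H _))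

      outHeads-mono : ∀ v e L → outHeads v H ≤ outHeads v (next e L)
      outHeads-mono v e L = subst (outHeads v H ≤_) (sym (outHeads-next v e L))
        (≤-trans (m≤n+m (outHeads v H) (outHeads v (new (gain false (proj₂ e) L)))) (m≤n+m _ (outHeads v (new (gain true (proj₁ e) L)))))

      new-out : ∀ {side v L} (p : Gain side v L) → Wants M B H v → 1 ≤ cnt (hits side v H) L → 1 ≤ outHeads v (new p)
      new-out (nothing none) wants hit = contradiction (none wants) (m<n⇒n≢0 hit)
      new-out {v = v} (just w _ _ _) wants hit = ≤-reflexive (sym (trans (+-identityʳ (δ v v)) (δ-refl v)))

      new-out-≤ : ∀ {side v L} (p : Gain side v L) → outHeads v (new p) ≤ 1
      new-out-≤ (nothing _) = z≤n
      new-out-≤ {v = v} (just w _ _ _) = ≤-reflexive (trans (+-identityʳ (δ v v)) (δ-refl v))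

      new-out-other : ∀ {side v L} (p : Gain side v L) {u} → u ≢ v → outHeads u (new p) ≡ 0
      new-out-other (nothing _) u≢v = refl
      new-out-other (just w _ _ _) {u} u≢v = trans (+-identityʳ (δ u _)) (δ-≢ u≢v)

      -- A head is added only below `D` heads and at Breaker degree at least `θ`, so the bound holds
      -- anew after each addition. Summed over the vertices it limits the number of heads.
      new-lim : ∀ {side v L} (p : Gain side v L) → outHeads v H * θ ≤ D * deg B v →
        (outHeads v (new p) + outHeads v H) * θ ≤ D * deg B v
      new-lim (nothing _) lim = lim
      new-lim {v = v} p@(just w (θ≤b , c<D , _) _ _) lim =
        ≤-trans (*-monoˡ-≤ θ (≤-trans (+-monoˡ-≤ (outHeads v H) (new-out-≤ p)) c<D)) (*-monoʳ-≤ D θ≤b)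

      new-in : ∀ {side v L} (p : Gain side v L) w → inHeads w H ≤ 1 →
        inHeads w (new p) + inHeads w H ≤ 1 × (inHeads w (new p) ≡ 0 ⊎ (inHeads w H ≡ 0 × half side w ≡ true))
      new-in (nothing _) w lim = lim , inj₁ refl
      new-in {side} {v} (just u _ fr _) w lim with w ≟ u
      ... | no  _    = lim , inj₁ refl
      ... | yes refl with fresh-elim side v H fr
      ...   | hf , zr = subst (λ z → 1 + z ≤ 1) (sym zr) ≤-refl , inj₂ (zr , hf)

      new-adj : ∀ {side v L} (p : Gain side v L) {q} → q ∈ new p → 1 ≤ adj L (proj₁ q) (proj₂ q)
      new-adj (just w _ _ 1≤) (here refl) = 1≤

      -- As the endpoints differ, no vertex receives more than one head per round, and `new-lim`
      -- applies to each endpoint separately.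
      next-lim : ∀ e L → proj₁ e ≢ proj₂ e → (∀ v → outHeads v H * θ ≤ D * deg B v) →
        ∀ v → outHeads v (next e L) * θ ≤ D * deg (e ∷ B) v
      next-lim e@(x , y) L x≢y lim v = ≤-trans bound (*-monoʳ-≤ D (m≤n+m (deg B v) (deg₁ v e)))
        where
        bound : outHeads v (next e L) * θ ≤ D * deg B v
        bound rewrite outHeads-next v e L with v ≟ x | v ≟ y
        ... | yes refl | _ rewrite new-out-other (gain false y L) x≢y = new-lim (gain true x L) (lim x)
        ... | no v≢x | yes refl rewrite new-out-other (gain true x L) v≢x = new-lim (gain false y L) (lim y)
        ... | no v≢x | no v≢y rewrite new-out-other (gain true x L) v≢x | new-out-other (gain false y L) v≢y = lim v

      next-in : ∀ e L → (∀ w → inHeads w H ≤ 1) → ∀ w → inHeads w (next e L) ≤ 1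
      next-in e@(x , y) L lim w = subst (_≤ 1) (sym (inHeads-next w e L)) bound
        where
        bound : inHeads w (new (gain true x L)) + (inHeads w (new (gain false y L)) + inHeads w H) ≤ 1
        bound with new-in (gain true x L) w (lim w) | new-in (gain false y L) w (lim w)
        ... | _ , inj₁ z | b₂ , _ = subst (λ i → i + _ ≤ 1) (sym z) b₂
        ... | b₁ , inj₂ _ | _ , inj₁ z = subst (λ i → inHeads w (new (gain true x L)) + (i + inHeads w H) ≤ 1) (sym z) b₁
        -- A head found by both searches would lie in both halves.
        ... | _ , inj₂ (_ , t) | _ , inj₂ (_ , f) = contradiction (trans (sym f) (cong not t)) λ ()

      next-adj : ∀ e L → (∀ {q} → q ∈ H → 1 ≤ adj M (proj₁ q) (proj₂ q)) →
        ∀ {q} → q ∈ next e L → 1 ≤ adj (M ++ L) (proj₁ q) (proj₂ q)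
      next-adj e@(x , y) L old {q} q∈ = subst (1 ≤_) (sym (∑-++ M L (lk (proj₁ q) (proj₂ q)))) bound
        where
        bound : 1 ≤ adj M (proj₁ q) (proj₂ q) + adj L (proj₁ q) (proj₂ q)
        bound with ∈-++⁻ (new (gain true x L)) q∈
        ... | inj₁ q∈₁ = m≤n⇒m≤o+n _ (new-adj (gain true x L) q∈₁)
        ... | inj₂ q∈₂ with ∈-++⁻ (new (gain false y L)) q∈₂
        ...   | inj₁ q∈₁ = m≤n⇒m≤o+n _ (new-adj (gain false y L) q∈₁)
        ...   | inj₂ q∈H = m≤n⇒m≤n+o _ (old q∈H)

    -- A random free edge hits with probability at least `1 / (4n)`, so `m` of them all miss with
    -- probability at most `1 / (1 + m / (4n))`, which `n ≤ m * g` bounds by `4g / (4g + 1)`.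
    miss-hits : (P : Edge n → Bool) (U : List (Edge n)) → length U ≤ n * n → n ≤ 4 * cnt P U →
      ∑ (choices (m ⊓ length U) U) (avoid P ∘ proj₁) * (4 * g + 1) ≤ length (choices (m ⊓ length U) U) * (4 * g)
    miss-hits P U U-small n≤4f = *-cancelʳ-≤ _ _ u {{>-nonZero 1≤u}} (begin
      miss * (4 * g + 1) * u         ≡⟨ e₁ miss g u ⟩
      miss * (4 * g * u + u)         ≤⟨ *-monoʳ-≤ miss (+-monoʳ-≤ (4 * g * u) u≤) ⟩
      miss * (4 * g * u + 4 * g * (r * f)) ≡⟨ e₂ miss g u (r * f) ⟩
      4 * g * (miss * (u + r * f))   ≤⟨ *-monoʳ-≤ (4 * g) (miss-harmonic P r U 1≤u) ⟩
      4 * g * (total * u)            ≡⟨ e₃ g total u ⟩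
      total * (4 * g) * u            ∎)
      where
      open ≤-Reasoning
      u = length U
      f = cnt P U
      r = m ⊓ u
      miss = ∑ (choices r U) (avoid P ∘ proj₁)
      total = length (choices r U)
      1≤f : 1 ≤ f
      1≤f = 1≤m*n⇒1≤n 4 f (≤-trans 1≤n n≤4f)
      1≤g : 1 ≤ g
      1≤g = 1≤m*n⇒1≤n m g (≤-trans 1≤n n≤mg)
      1≤u : 1 ≤ u
      1≤u = ≤-trans 1≤f (≤-trans (∑-mono U (λ e → ind≤1 (P e))) (≤-reflexive (∑-one U)))
      e₁ : ∀ s g u → s * (4 * g + 1) * u ≡ s * (4 * g * u + u)
      e₁ = solve-∀
      e₂ : ∀ s g u x → s * (4 * g * u + 4 * g * x) ≡ 4 * g * (s * (u + x))
      e₂ = solve-∀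
      e₃ : ∀ g t u → 4 * g * (t * u) ≡ t * (4 * g) * u
      e₃ = solve-∀
      e₄ : ∀ m g f → m * g * (4 * f) ≡ 4 * g * (m * f)
      e₄ = solve-∀
      e₅ : ∀ u → 1 * (u * 1) ≡ u
      e₅ = solve-∀
      u≤ : u ≤ 4 * g * (r * f)
      u≤ with ⊓-sel m u
      ... | inj₁ r≡m = begin
        u                   ≤⟨ U-small ⟩
        n * n               ≤⟨ *-mono-≤ n≤mg n≤4f ⟩
        m * g * (4 * f)     ≡⟨ e₄ m g f ⟩
        4 * g * (m * f)     ≡⟨ cong (λ z → 4 * g * (z * f)) r≡m ⟨
        4 * g * (r * f)     ∎
      -- At most `m` edges are left and Maker takes all of them; a single one that hits suffices for
      -- the estimate.
      ... | inj₂ r≡u = begin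
        u                   ≡⟨ e₅ u ⟨
        1 * (u * 1)         ≤⟨ *-mono-≤ (≤-trans 1≤g (m≤n*m g 4)) (*-monoʳ-≤ u 1≤f) ⟩
        4 * g * (u * f)     ≡⟨ cong (λ z → 4 * g * (z * f)) r≡u ⟨
        4 * g * (r * f)     ∎

    module _ (M B U′ : List (Edge n)) (H : Heads n) (e : Edge n) (x≢y : proj₁ e ≢ proj₂ e)
             (total : ∀ f → ∑ M f + (∑ (e ∷ B) f + ∑ U′ f) ≡ ∑ (edges n) f)
             (U′-small : length U′ ≤ n * n)
             (64≤n : 64 ≤ n) (64θ≤n : 64 * θ ≤ n) (64H≤n : 64 * length H ≤ n)
             (safe : ∀ v → Ψ (deg B v) (outHeads v H) (deg M v) < Z₂) where

      private
        C : List (List (Edge n) × List (Edge n))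
        C = choices (m ⊓ length U′) U′
        x y : Fin n
        x = proj₁ e
        y = proj₂ e
        b c dm : Fin n → ℕ
        b v = deg B v
        c v = outHeads v H
        dm v = deg M v
        Ψ₀ : Fin n → ℕ
        Ψ₀ v = Ψ (b v) (c v) (dm v)
        Ψ₁ : Fin n → List (Edge n) × List (Edge n) → ℕ
        Ψ₁ v i = Ψ (deg (e ∷ B) v) (outHeads v (next M B H e (proj₁ i))) (deg (M ++ proj₁ i) v)

        dm-mono : ∀ v L → dm v ≤ deg (M ++ L) v
        dm-mono v L = subst (dm v ≤_) (sym (∑-++ M L (deg₁ v))) (m≤m+n _ _)

        bounded : ∀ v k → (∀ i → Ψ₁ v i ≤ k) → ∑ C (Ψ₁ v) ≤ length C * k
        bounded v k Ψ₁≤k = ≤-trans (∑-mono C Ψ₁≤k) (≤-reflexive (∑-const C k))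

        -- Only a vertex below degree `θ` draws on the charge `κ`. From `θ` on, a happy vertex stays
        -- at potential 0, and at an unhappy one Maker's chance of a new head makes up for Breaker's
        -- move; there `safe` guarantees a degree below `2 * θ`.
        played : ∀ side v → deg₁ v e ≡ 1 →
          (∀ L → outHeads v (new M B H (gain M B H side v L)) + c v ≤ outHeads v (next M B H e L)) →
          ∑ C (Ψ₁ v) ≤ length C * (Ψ₀ v + 1 * κ)
        played side v v∈e gained with <-≤-connex (b v) θ
        ... | inj₁ b<θ = bounded v (Ψ₀ v + 1 * κ) λ i → begin
          Ψ (deg₁ v e + b v) (outHeads v (next M B H e (proj₁ i))) (deg (M ++ proj₁ i) v)
                                              ≡⟨ cong (λ z → Ψ (z + b v) (outHeads v (next M B H e (proj₁ i))) (deg (M ++ proj₁ i) v)) v∈e ⟩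
          Ψ (suc (b v)) (outHeads v (next M B H e (proj₁ i))) (deg (M ++ proj₁ i) v)
                                              ≤⟨ Ψ-low-step (b v) (outHeads v (next M B H e (proj₁ i))) (deg (M ++ proj₁ i) v) b<θ ⟩
          suc (b v) * κ                       ≡⟨ e₁ (b v) κ ⟩
          b v * κ + 1 * κ                     ≡⟨ cong (_+ 1 * κ) (Ψ-low (b v) (c v) (dm v) b<θ) ⟨
          Ψ₀ v + 1 * κ                        ∎
          where
          open ≤-Reasoning
          e₁ : ∀ b κ → suc b * κ ≡ b * κ + 1 * κ
          e₁ = solve-∀
        ... | inj₂ θ≤b with unhappy? (c v) (dm v)
        ...   | no hp = bounded v (Ψ₀ v + 1 * κ) λ i → ≤-trans (Ψ-anti (deg (e ∷ B) v) (outHeads-mono M B H v e (proj₁ i)) (dm-mono v (proj₁ i)))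
                  (≤-trans (≤-reflexive (Ψ-happy (deg (e ∷ B) v) (c v) (dm v) (≤-trans θ≤b (m≤n+m (b v) (deg₁ v e))) hp)) z≤n)
        ...   | yes un = ≤-trans (subst (λ z → ∑ C (λ i → Ψ (z + b v) (outHeads v (next M B H e (proj₁ i))) (deg (M ++ proj₁ i) v)) ≤ length C * Ψ₀ v)
                  (sym v∈e) averaged) (*-monoʳ-≤ (length C) (m≤m+n (Ψ₀ v) (1 * κ)))
          where
          P = hits side v H
          b<2θ : b v < 2 * θ
          b<2θ with <-≤-connex (b v) (2 * θ)
          ... | inj₁ lt = lt
          ... | inj₂ ge = contradiction (Ψ-bad (b v) (c v) (dm v) ge un) (<⇒≱ (safe v))
          many : n ≤ 4 * cnt P U′
          many = hits-many M (e ∷ B) U′ total θ side v H 64≤n 64θ≤n 64H≤n (proj₂ un) (subst (λ z → z + b v ≤ 2 * θ) (sym v∈e) b<2θ)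
          averaged : ∑ C (λ i → Ψ (suc (b v)) (outHeads v (next M B H e (proj₁ i))) (deg (M ++ proj₁ i) v)) ≤ length C * Ψ₀ v
          averaged = Ψ-average C (b v) (c v) (dm v) (avoid P ∘ proj₁) (λ i → outHeads v (next M B H e (proj₁ i))) (λ i → deg (M ++ proj₁ i) v) θ≤b b<2θ un
            (λ {i} _ → outHeads-mono M B H v e (proj₁ i) , dm-mono v (proj₁ i) , outcome (proj₁ i))
            (miss-hits P U′ U′-small many)
            where
            outcome : ∀ L → avoid P L ≡ 1 ⊎ (avoid P L ≡ 0 × suc (c v) ≤ outHeads v (next M B H e L))
            outcome L with avoid-dichotomy P L
            ... | inj₁ (av , _)   = inj₁ av
            ... | inj₂ (av , hit) = inj₂ (av , ≤-trans (+-monoˡ-≤ (c v) (new-out M B H (gain M B H side v L) (θ≤b , un) hit)) (gained L))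

        Round : Fin n → Set
        Round v = ∑ C (Ψ₁ v) ≤ length C * (Ψ₀ v + deg₁ v e * κ)

        round-x : Round x
        round-x = subst (λ z → ∑ C (Ψ₁ x) ≤ length C * (Ψ₀ x + z * κ)) (sym x∈e) (played true x x∈e λ L →
          subst (outHeads x (new M B H (gain M B H true x L)) + c x ≤_) (sym (outHeads-next M B H x e L))
            (+-monoʳ-≤ (outHeads x (new M B H (gain M B H true x L))) (m≤n+m (c x) (outHeads x (new M B H (gain M B H false y L))))))
          where
          x∈e : deg₁ x e ≡ 1
          x∈e = cong₂ _+_ (δ-refl x) (δ-≢ x≢y)

        round-y : Round y
        round-y = subst (λ z → ∑ C (Ψ₁ y) ≤ length C * (Ψ₀ y + z * κ)) (sym y∈e) (played false y y∈e λ L →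
          subst (outHeads y (new M B H (gain M B H false y L)) + c y ≤_) (sym (outHeads-next M B H y e L))
            (m≤n+m (outHeads y (new M B H (gain M B H false y L)) + c y) (outHeads y (new M B H (gain M B H true x L)))))
          where
          y∈e : deg₁ y e ≡ 1
          y∈e = cong₂ _+_ (δ-≢ (x≢y ∘ sym)) (δ-refl y)

        round-other : ∀ v → v ≢ x → v ≢ y → Round v
        round-other v v≢x v≢y = bounded v (Ψ₀ v + deg₁ v e * κ) λ i → begin
          Ψ (deg₁ v e + b v) (outHeads v (next M B H e (proj₁ i))) (deg (M ++ proj₁ i) v) ≡⟨ cong (λ z → Ψ (z + b v) (outHeads v (next M B H e (proj₁ i))) (deg (M ++ proj₁ i) v)) v∉e ⟩
          Ψ (b v) (outHeads v (next M B H e (proj₁ i))) (deg (M ++ proj₁ i) v)            ≤⟨ Ψ-anti (b v) (outHeads-mono M B H v e (proj₁ i)) (dm-mono v (proj₁ i)) ⟩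
          Ψ₀ v                                                                            ≤⟨ m≤m+n _ _ ⟩
          Ψ₀ v + deg₁ v e * κ                                                             ∎
          where
          open ≤-Reasoning
          v∉e : deg₁ v e ≡ 0
          v∉e = cong₂ _+_ (δ-≢ v≢x) (δ-≢ v≢y)

        Ψ-round : ∀ v → Round v
        Ψ-round v = cases (v ≟ x) (v ≟ y)
          where
          cases : Dec (v ≡ x) → Dec (v ≡ y) → Round v
          cases (yes refl) _          = round-x
          cases (no _)     (yes refl) = round-y
          cases (no v≢x)   (no v≢y)   = round-other v v≢x v≢y

      Φ₂-round : ∀ t → ∑ C (λ i → Φ₂ t (M ++ proj₁ i) (e ∷ B) (next M B H e (proj₁ i))) ≤ length C * Φ₂ (suc t) M B H
      Φ₂-round t = begin
        ∑ C (λ i → ∑ᶠ n (λ v → Ψ₁ v i) + 2 * κ * t)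
          ≡⟨ ∑-+ C (λ i → ∑ᶠ n (λ v → Ψ₁ v i)) (λ _ → 2 * κ * t) ⟩
        ∑ C (λ i → ∑ᶠ n (λ v → Ψ₁ v i)) + ∑ C (λ _ → 2 * κ * t)
          ≡⟨ cong₂ _+_ (∑-swap C (allFin n) (λ i v → Ψ₁ v i)) (∑-const C (2 * κ * t)) ⟩
        ∑ᶠ n (λ v → ∑ C (Ψ₁ v)) + length C * (2 * κ * t)
          ≤⟨ +-monoˡ-≤ (length C * (2 * κ * t)) (∑-mono (allFin n) Ψ-round) ⟩
        ∑ᶠ n (λ v → length C * (Ψ₀ v + deg₁ v e * κ)) + length C * (2 * κ * t)
          ≡⟨ cong (_+ length C * (2 * κ * t)) (trans (∑-*ˡ (allFin n) (length C) (λ v → Ψ₀ v + deg₁ v e * κ))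
               (cong (length C *_) (trans (∑-+ (allFin n) Ψ₀ (λ v → deg₁ v e * κ)) (cong (∑ᶠ n Ψ₀ +_)
                 (trans (∑-*ʳ (allFin n) (λ v → deg₁ v e) κ) (cong (_* κ) two)))))) ⟩
        length C * (∑ᶠ n Ψ₀ + 2 * κ) + length C * (2 * κ * t)
          ≡⟨ e₁ (length C) (∑ᶠ n Ψ₀) κ t ⟩
        length C * (∑ᶠ n Ψ₀ + 2 * κ * suc t) ∎
        where
        open ≤-Reasoning
        e₁ : ∀ l p κ t → l * (p + 2 * κ) + l * (2 * κ * t) ≡ l * (p + 2 * κ * suc t)
        e₁ = solve-∀
        two : ∑ᶠ n (λ v → deg₁ v e) ≡ 2
        two = trans (∑-+ (allFin n) (λ v → δ v x) (λ v → δ v y)) (cong₂ _+_ (∑-δ₁ x) (∑-δ₁ y))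

-- From the two potentials to the outcome of the game.

module Gameplay where

  open FiniteSums
  open Probability
  open Graphs
  open CutPotential
  open AttackPotential
  open import Data.Nat using (ℕ; zero; suc; _+_; _*_; _^_; _⊓_; _≤_; _<_; _≤?_; z≤n; s≤s; >-nonZero)
  open import Data.Nat.Properties hiding (_<?_; _≤?_; _≟_)
  open import Data.Nat.Tactic.RingSolver using (solve-∀)
  open import Data.Bool using (Bool; true; false)
  open import Data.Fin using (Fin)
  open import Data.Vec using (Vec; lookup)
  open import Data.List as List using (List; []; _∷_; _++_; length; allFin; removeAt)
  open import Data.List.Membership.Propositional using (_∈_)
  open import Data.List.Membership.Propositional.Properties using (∈-allFin)
  open import Data.Product using (_×_; _,_; proj₁; proj₂)
  open import Data.Sum using (_⊎_; inj₁; inj₂)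
  open import Function using (_∘_)
  open import Relation.Nullary using (Dec; yes; no; does; ¬_; contradiction)
  open import Relation.Binary.PropositionalEquality using (_≡_; _≢_; refl; sym; trans; cong; cong₂; subst)
  open import Defs using (edges; Edge; choices; Strategy; outcomes; game; KConnected)

  module Play (n m k T a θ g : ℕ) (d≡8n : suc a ≡ 8 * n) (64≤n : 64 ≤ n) (1≤θ : 1 ≤ θ) (64θ≤n : 64 * θ ≤ n)
              (64k≤n : 64 * k ≤ n) (n≤mg : n ≤ m * g) (few : 128 * (2 * suc k * T) ≤ n * θ) where

    D : ℕ
    D = 2 * suc k

    1≤n : 1 ≤ n
    1≤n = ≤-trans (s≤s z≤n) 64≤n

    open Cuts n k T a 1≤n d≡8n public
    open Attack n m D θ g 1≤n n≤mg public

    -- `total` says that `M`, `B` and `U` partition the board, in the form in which it is used: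
    -- every sum over edges splits. `headLim` serves to bound the number of heads, `headAdj` and
    -- `headIn` make the heads of a vertex private Maker neighbours.
    record Inv (t : ℕ) (M B U : List (Edge n)) (H : Heads n) : Set where
      field
        total   : ∀ f → ∑ M f + (∑ B f + ∑ U f) ≡ ∑ (edges n) f
        rounds  : length B + t ≡ T
        headAdj : ∀ {q} → q ∈ H → 1 ≤ adj M (proj₁ q) (proj₂ q)
        headIn  : ∀ w → inHeads w H ≤ 1
        headLim : ∀ v → outHeads v H * θ ≤ D * deg B v

    private
      instance
        θ-nonZero = >-nonZero 1≤θ

    module _ {t M B U H} (inv : Inv t M B U H) where
      open Inv inv

      B≤T : length B ≤ T
      B≤T = subst (length B ≤_) rounds (m≤m+n (length B) t)

      -- Breaker's degrees add up to at most `2 * T`, so summing `headLim` gives `θ |H| ≤ 2 D T`,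
      -- which `few` bounds by `n θ / 64`.
      heads-few : 64 * length H ≤ n
      heads-few = *-cancelʳ-≤ _ _ θ (begin
        64 * length H * θ                  ≡⟨ *-assoc 64 (length H) θ ⟩
        64 * (length H * θ)                ≡⟨ cong (λ z → 64 * (z * θ)) (∑-outHeads H) ⟨
        64 * (∑ᶠ n (λ v → outHeads v H) * θ) ≡⟨ cong (64 *_) (∑-*ʳ (allFin n) (λ v → outHeads v H) θ) ⟨
        64 * ∑ᶠ n (λ v → outHeads v H * θ) ≤⟨ *-monoʳ-≤ 64 (∑-mono (allFin n) headLim) ⟩
        64 * ∑ᶠ n (λ v → D * deg B v)      ≡⟨ cong (64 *_) (trans (∑-*ˡ (allFin n) D (deg B)) (cong (D *_) (∑-deg B))) ⟩
        64 * (D * (length B * 2))          ≤⟨ *-monoʳ-≤ 64 (*-monoʳ-≤ D (*-monoˡ-≤ 2 B≤T)) ⟩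
        64 * (D * (T * 2))                 ≡⟨ e₁ D T ⟩
        128 * (D * T)                      ≤⟨ few ⟩
        n * θ                              ∎)
        where
        open ≤-Reasoning
        e₁ : ∀ D T → 64 * (D * (T * 2)) ≡ 128 * (D * T)
        e₁ = solve-∀

      module _ (Φ₂<Z₂ : Φ₂ t M B H < Z₂) (S : Vec Bool n) (X : List (Fin n)) (X≤k : length X ≤ k)
               (1≤s : 1 ≤ size (lookup S)) (2s≤n : 2 * size (lookup S) ≤ n)
               (uncrossed : crossing S X M ≡ 0) where

        private
          s q f : ℕ
          s = size (lookup S)
          q = size (rest S X)
          f = crossing S X U

          inX : Fin n → ℕ
          inX w = ind (does (w ∈? X))

          SX : Fin n → ℕ
          SX w = ind (lookup S w) + inX w

          ∑-SX : ∑ᶠ n SX ≤ s + k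
          ∑-SX = ≤-trans (≤-reflexive (∑-+ (allFin n) _ _)) (+-monoʳ-≤ s (≤-trans (size-∈ X) X≤k))

          nbrs-M : ∀ {v} → lookup S v ≡ true → nbrs (rest S X) M v ≡ 0
          nbrs-M {v} Sv = n≤0⇒n≡0 (subst (nbrs (rest S X) M v ≤_) uncrossed (nbrs≤cross (rest-disjoint S X) M Sv))

          closed : ∀ {v w} → lookup S v ≡ true → 1 ≤ adj M v w → 1 ≤ SX w
          closed {v} {w} Sv 1≤adj with lookup S w in Sw | w ∈? X
          ... | true  | _      = s≤s z≤n
          ... | false | yes _  = s≤s z≤n
          ... | false | no w∉X = contradiction (nbrs-M Sv) (m<n⇒n≢0 (begin
            1                                ≤⟨ 1≤adj ⟩
            adj M v w                        ≡⟨ *-identityˡ (adj M v w) ⟨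
            1 * adj M v w                    ≡⟨ cong (λ b → ind b * adj M v w) (rest-intro S X Sw w∉X) ⟨
            ind (rest S X w) * adj M v w     ≤⟨ ∈⇒≤∑ (λ w → ind (rest S X w) * adj M v w) (∈-allFin w) ⟩
            nbrs (rest S X) M v              ∎))
            where open ≤-Reasoning

          adj-M≤1 : ∀ v w → adj M v w ≤ 1
          adj-M≤1 v w = ≤-trans (m≤m+n _ _) (≤-trans (≤-reflexive (total (lk v w))) (adj-edges-≤1 v w))

          deg-M : ∀ {v} → lookup S v ≡ true → deg M v ≤ s + k
          deg-M {v} Sv = begin
            deg M v          ≡⟨ ∑-adj M v ⟨
            ∑ᶠ n (adj M v)   ≤⟨ ∑-mono (allFin n) pointwise ⟩
            ∑ᶠ n SX          ≤⟨ ∑-SX ⟩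
            s + k            ∎
            where
            open ≤-Reasoning
            pointwise : ∀ w → adj M v w ≤ SX w
            pointwise w with 1 ≤? adj M v w
            ... | yes 1≤adj = ≤-trans (adj-M≤1 v w) (closed Sv 1≤adj)
            ... | no 1≰adj  = subst (_≤ SX w) (sym (n<1⇒n≡0 (≰⇒> 1≰adj))) z≤n

          abstract
            dangerous? : ∀ v → Dec (2 * θ ≤ deg B v)
            dangerous? v = 2 * θ ≤? deg B v

          dS : Fin n → ℕ
          dS v = ind (lookup S v) * ind (does (dangerous? v))

          sd : ℕ
          sd = ∑ᶠ n dS

          happy : ∀ v → 2 * θ ≤ deg B v → ¬ Unhappy (outHeads v H) (deg M v)
          happy v 2θ≤b un = contradiction (≤-trans (Ψ-bad (deg B v) (outHeads v H) (deg M v) 2θ≤b un) (Ψ≤Φ₂ t M B H v)) (<⇒≱ Φ₂<Z₂)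

          sd*θ≤T : sd * θ ≤ T
          sd*θ≤T = *-cancelʳ-≤ _ _ 2 (begin
            sd * θ * 2                     ≡⟨ e₁ sd θ ⟩
            sd * (2 * θ)                   ≡⟨ ∑-*ʳ (allFin n) dS (2 * θ) ⟨
            ∑ᶠ n (λ v → dS v * (2 * θ))    ≤⟨ ∑-mono (allFin n) pointwise ⟩
            ∑ᶠ n (deg B)                   ≡⟨ ∑-deg B ⟩
            length B * 2                   ≤⟨ *-monoˡ-≤ 2 B≤T ⟩
            T * 2                          ∎)
            where
            open ≤-Reasoning
            e₁ : ∀ s θ → s * θ * 2 ≡ s * (2 * θ)
            e₁ = solve-∀
            e₂ : ∀ x → 1 * 1 * x ≡ x
            e₂ = solve-∀
            pointwise : ∀ v → dS v * (2 * θ) ≤ deg B v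
            pointwise v with dangerous? v
            ... | no _  = subst (λ z → z * (2 * θ) ≤ deg B v) (sym (*-zeroʳ (ind (lookup S v)))) z≤n
            ... | yes p = ≤-trans (*-monoˡ-≤ (2 * θ) (*-monoˡ-≤ 1 (ind≤1 (lookup S v)))) (≤-trans (≤-reflexive (e₂ (2 * θ))) p)

          -- With `T` edges Breaker reaches degree `2 * θ` at no more than `T / θ ≤ n / 256`
          -- vertices, whereas here `s ≥ n / 16 - k ≥ 3n / 64`.
          2sd≤s-large : n ≤ 16 * (s + k) → 2 * sd ≤ s
          2sd≤s-large n≤ = *-cancelˡ-≤ 128 (≤-by-slack (5 * n)
            (+-mono-≤ few′ (+-mono-≤ (*-monoʳ-≤ 8 n≤) (*-monoʳ-≤ 2 64k≤n))) (e₂ n sd s k))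
            where
            open ≤-Reasoning
            e₁ : ∀ sd D θ → sd * (128 * D) * θ ≡ 128 * (D * (sd * θ))
            e₁ = solve-∀
            few₀ : sd * (128 * D) ≤ n
            few₀ = *-cancelʳ-≤ _ _ θ (begin
              sd * (128 * D) * θ   ≡⟨ e₁ sd D θ ⟩
              128 * (D * (sd * θ)) ≤⟨ *-monoʳ-≤ 128 (*-monoʳ-≤ D sd*θ≤T) ⟩
              128 * (D * T)        ≤⟨ few ⟩
              n * θ                ∎)
            few′ : sd * 256 ≤ n
            few′ = ≤-trans (*-monoʳ-≤ sd (*-monoʳ-≤ 128 (*-monoʳ-≤ 2 (s≤s (z≤n {k}))))) few₀
            e₂ : ∀ n sd s k → 128 * (2 * sd) + (n + (8 * (16 * (s + k)) + 2 * n)) + 5 * n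
                            ≡ 128 * s + (sd * 256 + (8 * n + 2 * (64 * k)))
            e₂ = solve-∀

          -- Maker degrees in `S` are below `n / 16`, so a dangerous vertex can be happy only
          -- through `D` heads. Heads are distinct and lie in `S` or `X`, whence
          -- `2 (k + 1) sd ≤ s + k ≤ (k + 1) s`. This is the origin of `D`.
          2sd≤s-small : 16 * (s + k) < n → 2 * sd ≤ s
          2sd≤s-small <n = *-cancelˡ-≤ (suc k) (begin
            suc k * (2 * sd)    ≡⟨ e₁ k sd ⟩
            D * sd              ≡⟨ ∑-*ˡ (allFin n) D dS ⟨
            ∑ᶠ n (λ v → D * dS v) ≤⟨ ∑-mono (allFin n) enough ⟩
            ∑ᶠ n (λ v → ind (lookup S v) * outHeads v H) ≡⟨ ∑-cong (allFin n) (λ v → sym (∑-*ˡ H (ind (lookup S v)) _)) ⟩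
            ∑ᶠ n (λ v → ∑ H (λ p → ind (lookup S v) * δ v (proj₁ p))) ≡⟨ ∑-swap (allFin n) H _ ⟩
            ∑ H (λ p → ∑ᶠ n (λ v → ind (lookup S v) * δ v (proj₁ p))) ≡⟨ ∑-cong H (λ p → trans (∑-cong (allFin n) (λ v → *-comm (ind (lookup S v)) (δ v (proj₁ p)))) (∑-δ (proj₁ p) (ind ∘ lookup S))) ⟩
            ∑ H (λ p → ind (lookup S (proj₁ p)))      ≤⟨ ∑-mono-∈ H head-closed ⟩
            ∑ H (λ p → SX (proj₂ p))                  ≡⟨ ∑-cong H (λ p → sym (∑-δ (proj₂ p) SX)) ⟩
            ∑ H (λ p → ∑ᶠ n (λ w → δ w (proj₂ p) * SX w)) ≡⟨ ∑-swap (allFin n) H _ ⟨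
            ∑ᶠ n (λ w → ∑ H (λ p → δ w (proj₂ p) * SX w)) ≡⟨ ∑-cong (allFin n) (λ w → ∑-*ʳ H (λ p → δ w (proj₂ p)) (SX w)) ⟩
            ∑ᶠ n (λ w → inHeads w H * SX w)           ≤⟨ ∑-mono (allFin n) (λ w → *-monoˡ-≤ (SX w) (headIn w)) ⟩
            ∑ᶠ n (λ w → 1 * SX w)                     ≡⟨ ∑-cong (allFin n) (λ w → *-identityˡ (SX w)) ⟩
            ∑ᶠ n SX                                   ≤⟨ ∑-SX ⟩
            s + k                                     ≤⟨ +-monoʳ-≤ s (≤-trans (≤-reflexive (sym (*-identityʳ k))) (*-monoʳ-≤ k 1≤s)) ⟩
            s + k * s                                 ∎)
            where
            open ≤-Reasoning
            e₁ : ∀ k s → suc k * (2 * s) ≡ 2 * suc k * s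
            e₁ = solve-∀
            enough : ∀ v → D * dS v ≤ ind (lookup S v) * outHeads v H
            enough v with lookup S v in Sv | dangerous? v
            ... | false | _     = ≤-reflexive (*-zeroʳ D)
            ... | true  | no _  = ≤-trans (≤-reflexive (*-zeroʳ D)) z≤n
            ... | true  | yes p with <-≤-connex (outHeads v H) D
            ...   | inj₁ c<D = contradiction (c<D , ≤-<-trans (*-monoʳ-≤ 16 (deg-M Sv)) <n) (happy v p)
            ...   | inj₂ D≤c = ≤-trans (≤-reflexive (*-identityʳ D)) (≤-trans D≤c (≤-reflexive (sym (+-identityʳ _))))
            head-closed : ∀ {p} → p ∈ H → ind (lookup S (proj₁ p)) ≤ SX (proj₂ p)
            head-closed {v , w} p∈H with lookup S v in Sv
            ... | false = z≤n
            ... | true  = closed Sv (headAdj p∈H)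

          2sd≤s : 2 * sd ≤ s
          2sd≤s with <-≤-connex (16 * (s + k)) n
          ... | inj₁ lt = 2sd≤s-small lt
          ... | inj₂ ge = 2sd≤s-large ge

          -- A vertex of `S` that is not dangerous has no Maker edge and fewer than `2 * θ` Breaker
          -- edges to the `q` vertices opposite, and its other edges to them are free. A dangerous
          -- vertex is given up at the price `q`.
          room : ∀ v → ind (lookup S v) * q ≤ ind (lookup S v) * nbrs (rest S X) U v + (ind (lookup S v) * (2 * θ) + dS v * q)
          room v with lookup S v in Sv | dangerous? v
          ... | false | _     = z≤n
          ... | true  | yes _ = ≤-trans (m≤n+m (1 * q) (1 * (2 * θ))) (m≤n+m _ (1 * nbrs (rest S X) U v))
          ... | true  | no p  = begin
            1 * q                                            ≡⟨ *-identityˡ q ⟩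
            ∑ᶠ n (λ w → ind (rest S X w))                    ≤⟨ ∑-mono (allFin n) pointwise ⟩
            ∑ᶠ n (λ w → ind (rest S X w) * adj M v w + (adj B v w + ind (rest S X w) * adj U v w))
              ≡⟨ trans (∑-+ (allFin n) _ _) (cong₂ _+_ (nbrs-M Sv) (trans (∑-+ (allFin n) (adj B v) _) (cong (_+ nbrs (rest S X) U v) (∑-adj B v)))) ⟩
            deg B v + nbrs (rest S X) U v                    ≤⟨ +-monoˡ-≤ _ (<⇒≤ (≰⇒> p)) ⟩
            2 * θ + nbrs (rest S X) U v                      ≡⟨ e₁ (2 * θ) (nbrs (rest S X) U v) q ⟩
            1 * nbrs (rest S X) U v + (1 * (2 * θ) + 1 * 0 * q) ∎
            where
            open ≤-Reasoning
            e₁ : ∀ a b q → a + b ≡ 1 * b + (1 * a + 1 * 0 * q)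
            e₁ = solve-∀
            e₂ : ∀ a b c → a + (b + c) ≡ 1 * a + (b + 1 * c)
            e₂ = solve-∀
            pointwise : ∀ w → ind (rest S X w) ≤ ind (rest S X w) * adj M v w + (adj B v w + ind (rest S X w) * adj U v w)
            pointwise w with rest S X w in Rw
            ... | false = z≤n
            ... | true  = ≤-reflexive (begin-equality
              1                                      ≡⟨ adj-edges-≢ v≢w ⟨
              adj (edges n) v w                      ≡⟨ total (lk v w) ⟨
              adj M v w + (adj B v w + adj U v w)    ≡⟨ e₂ (adj M v w) (adj B v w) (adj U v w) ⟩
              1 * adj M v w + (adj B v w + 1 * adj U v w) ∎)
              where
              v≢w : v ≢ w
              v≢w refl = contradiction (trans (sym Rw) (rest-disjoint S X v Sv)) λ ()

          sq≤ : s * q ≤ f + (s * (2 * θ) + sd * q)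
          sq≤ = begin
            s * q                                    ≡⟨ ∑-*ʳ (allFin n) (ind ∘ lookup S) q ⟨
            ∑ᶠ n (λ v → ind (lookup S v) * q)        ≤⟨ ∑-mono (allFin n) room ⟩
            ∑ᶠ n (λ v → ind (lookup S v) * nbrs (rest S X) U v + (ind (lookup S v) * (2 * θ) + dS v * q))
              ≡⟨ trans (∑-+ (allFin n) _ _) (cong (∑ᶠ n (λ v → ind (lookup S v) * nbrs (rest S X) U v) +_)
                   (trans (∑-+ (allFin n) _ _) (cong₂ _+_ (∑-*ʳ (allFin n) (ind ∘ lookup S) (2 * θ)) (∑-*ʳ (allFin n) dS q)))) ⟩
            ∑ᶠ n (λ v → ind (lookup S v) * nbrs (rest S X) U v) + (s * (2 * θ) + sd * q)
              ≤⟨ +-monoˡ-≤ (s * (2 * θ) + sd * q) (∑-nbrs≤cross (rest-disjoint S X) U) ⟩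
            f + (s * (2 * θ) + sd * q) ∎
            where open ≤-Reasoning

        -- As at most half of `S` is dangerous, `f ≥ s q / 2 - 2 θ s`. With
        -- `q ≥ n - s - |X| ≥ 7n / 16` and `2 θ ≤ n / 32` this is at least `3 s n / 16`, more than
        -- the required `s n / 8`.
        uncrossed⇒alive : Alive M U S X
        uncrossed⇒alive = 1≤s , uncrossed , *-cancelˡ-≤ 4 (≤-by-slack (2 * (s * n))
          (+-mono-≤ (*-monoʳ-≤ 32 sq≤) (+-mono-≤ (*-monoʳ-≤ 16 (*-monoˡ-≤ q 2sd≤s))
          (+-mono-≤ (*-monoʳ-≤ 16 (*-monoʳ-≤ s (n≤size+rest+X S X))) (+-mono-≤ (*-monoʳ-≤ 8 (*-monoʳ-≤ s 2s≤n))
          (+-mono-≤ (*-monoʳ-≤ s 64θ≤n) (*-monoʳ-≤ s (≤-trans 16x≤64k 64k≤n)))))))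
          (e s n f q θ sd (length X)))
          where
          16x≤64k : 16 * length X ≤ 64 * k
          16x≤64k = *-mono-≤ (m≤m+n 16 48) X≤k
          e : ∀ s n f q θ sd x →
            4 * (s * n) + (32 * (f + (s * (2 * θ) + sd * q)) + (16 * (s * q) + (16 * (s * (s + (q + x))) + (8 * (s * n) + (s * n + s * n))))) + 2 * (s * n)
            ≡ 4 * (8 * f) + (32 * (s * q) + (16 * (2 * sd * q) + (16 * (s * n) + (8 * (s * (2 * s)) + (s * (64 * θ) + s * (16 * x))))))
          e = solve-∀

      -- An uncrossed small cut would be alive. But with no round left a living cut weighs the full
      -- `y ^ n`, and with no edge left it lacks the free edges it needs.
      finished : Φ₁ t M U < y ^ n → Φ₂ t M B H < Z₂ → t ≡ 0 ⊎ U ≡ [] → SmallCutsCrossed k M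
      finished Φ₁<Z₁ Φ₂<Z₂ over S X X<k {v} Sv 2s≤n with find (lookup S) (rest S X) M
      ... | inj₂ edge = edge
      ... | inj₁ uncrossed = contradiction alive (dead over)
        where
        1≤s : 1 ≤ size (lookup S)
        1≤s = ≤-trans (≤-reflexive (cong ind (sym Sv))) (∈⇒≤∑ (ind ∘ lookup S) (∈-allFin v))
        alive : Alive M U S X
        alive = uncrossed⇒alive Φ₂<Z₂ S X (<⇒≤ X<k) 1≤s 2s≤n uncrossed
        dead : t ≡ 0 ⊎ U ≡ [] → ¬ Alive M U S X
        dead (inj₁ refl) al = contradiction (subst (_≤ Φ₁ 0 M U) (trans (φ-alive 0 M U S X al)
          (trans (cong (λ z → weight z y S) x-zero) (weight-const y S))) (φ≤Φ₁ 0 M U S X (<⇒≤ X<k))) (<⇒≱ Φ₁<Z₁)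
        dead (inj₂ refl) (_ , _ , sn≤0) = contradiction (≤-trans (*-mono-≤ 1≤s 1≤n) sn≤0) λ ()

    -- The sum `Φ₁ / y ^ n + Φ₂ / Z₂` over the common denominator `W`.
    Φ : ℕ → (M B U : List (Edge n)) → Heads n → ℕ
    Φ t M B U H = Φ₁ t M U * Z₂ + Φ₂ t M B H * y ^ n

    W : ℕ
    W = y ^ n * Z₂

    Φ<W : ∀ {p q z w} → p * w + q * z < z * w → p < z × q < w
    Φ<W {p} {q} {z} {w} lt =
      *-cancelʳ-< w p z (≤-<-trans (m≤m+n (p * w) (q * z)) lt) ,
      *-cancelʳ-< z q w (subst (q * z <_) (*-comm z w) (≤-<-trans (m≤n+m (q * z) (p * w)) lt))

    1≤choices : {A : Set} (r : ℕ) (xs : List A) → 1 ≤ length (choices (r ⊓ length xs) xs)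
    1≤choices r xs = subst (1 ≤_) (sym (length-choices (r ⊓ length xs) xs)) (bin-pos (m⊓n≤n r (length xs)))

    crossed-mono : ∀ (M L : List (Edge n)) → SmallCutsCrossed k M → SmallCutsCrossed k (M ++ L)
    crossed-mono M L crossed S X X<k Sv 2s≤n with v , w , Sv′ , Rw , 1≤ ← crossed S X X<k Sv 2s≤n =
      v , w , Sv′ , Rw , subst (1 ≤_) (sym (∑-++ M L (lk v w))) (m≤n⇒m≤n+o _ 1≤)

    k<n : k < n
    k<n = *-cancelˡ-< 64 k n (≤-<-trans 64k≤n n<64n)
      where
      n<64n : n < 64 * n
      n<64n = m<m+n n (≤-trans 1≤n (m≤m+n n (62 * n)))

    module _ (S : Strategy n) where

      -- The rest of the game can only add edges to Maker's graph, so all its outcomes are good and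
      -- the failure bound is 0.
      already-connected : ∀ fuel h M U → SmallCutsCrossed k M →
        Likely (KConnected k n) W (outcomes n m S fuel h M U) 0
      already-connected fuel    h M []       crossed = Likely-sure (crossed⇒connected crossed k<n)
      already-connected zero    h M (u ∷ us) crossed = Likely-sure (crossed⇒connected crossed k<n)
      already-connected (suc f) h M (u ∷ us) crossed =
        Likely-uniform C _ (λ _ → 0) 0 (1≤choices m U′) (subst (_≤ length C * 0) (sym (∑-zero C)) z≤n)
          (λ {c} _ → already-connected f _ (M ++ proj₁ c) (proj₂ c) (crossed-mono M (proj₁ c) crossed))
        where
        U′ = removeAt (u ∷ us) (S h u us)
        C = choices (m ⊓ length U′) U′

      -- If `Φ` has reached `W`, the claim is void. Otherwise both potentials are below their
      -- limits: this settles the cuts once the rounds or the edges run out, and supplies `safe` for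
      -- averaging over one more round. The bound on `length U` excludes a game cut short by its
      -- fuel.
      likely-connected : ∀ fuel h t M B U H → Inv t M B U H → length U ≤ fuel →
        Likely (KConnected k n) W (outcomes n m S fuel h M U) (Φ t M B U H)
      likely-connected fuel h t M B U H inv U≤fuel with <-≤-connex (Φ t M B U H) W
      ... | inj₂ W≤Φ = Likely-trivial _ W≤Φ
      likely-connected fuel h t M B [] H inv U≤fuel | inj₁ Φ< with Φ₁< , Φ₂< ← Φ<W {Φ₁ t M []} Φ< =
        Likely-sure (crossed⇒connected (finished inv Φ₁< Φ₂< (inj₂ refl)) k<n)
      likely-connected fuel h zero M B (u ∷ us) H inv U≤fuel | inj₁ Φ< with Φ₁< , Φ₂< ← Φ<W {Φ₁ 0 M (u ∷ us)} Φ< =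
        Likely-mono z≤n (already-connected fuel h M (u ∷ us) (finished inv Φ₁< Φ₂< (inj₁ refl)))
      likely-connected (suc fuel) h (suc t) M B (u ∷ us) H inv (s≤s us≤fuel) | inj₁ Φ< with Φ₁< , Φ₂< ← Φ<W {Φ₁ (suc t) M (u ∷ us)} Φ< =
        Likely-uniform C _ (λ c → Φ t (M ++ proj₁ c) (e ∷ B) (proj₂ c) (next M B H e (proj₁ c))) _ (1≤choices m U′) average
          (λ {c} c∈C → likely-connected fuel _ t (M ++ proj₁ c) (e ∷ B) (proj₂ c) (next M B H e (proj₁ c)) (inv′ c∈C) (shrink c∈C))
        where
        open Inv inv
        U = u ∷ us
        i = S h u us
        e = List.lookup U i
        U′ = removeAt U i
        C = choices (m ⊓ length U′) U′

        e+U′ : ∀ f → f e + ∑ U′ f ≡ ∑ U f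
        e+U′ = ∑-removeAt U i

        U′≤U : ∀ f → ∑ U′ f ≤ ∑ U f
        U′≤U f = subst (∑ U′ f ≤_) (e+U′ f) (m≤n+m (∑ U′ f) (f e))

        U≤edges : ∀ f → ∑ U f ≤ ∑ (edges n) f
        U≤edges f = subst (∑ U f ≤_) (total f) (≤-trans (m≤n+m (∑ U f) (∑ B f)) (m≤n+m (∑ B f + ∑ U f) (∑ M f)))

        U′-small : length U′ ≤ n * n
        U′-small = begin
          length U′             ≡⟨ ∑-one U′ ⟨
          ∑ U′ (λ _ → 1)        ≤⟨ ≤-trans (U′≤U (λ _ → 1)) (U≤edges (λ _ → 1)) ⟩
          ∑ (edges n) (λ _ → 1) ≡⟨ ∑-one (edges n) ⟩
          length (edges n)      ≤⟨ length-edges {n} ⟩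
          n * n                 ∎
          where open ≤-Reasoning

        x≢y : proj₁ e ≢ proj₂ e
        x≢y x≡y = contradiction (begin
          1                                          ≡⟨ δ-refl (proj₁ e) ⟨
          δ (proj₁ e) (proj₁ e)                      ≡⟨ cong (δ (proj₁ e)) x≡y ⟩
          loop e                                     ≤⟨ m≤m+n (loop e) (∑ U′ loop) ⟩
          loop e + ∑ U′ loop                         ≡⟨ e+U′ loop ⟩
          ∑ U loop                                   ≤⟨ U≤edges loop ⟩
          ∑ (edges n) loop                           ≡⟨ edges-loopless {n} ⟩
          0                                          ∎) λ ()
          where
          open ≤-Reasoning
          loop : Edge n → ℕ
          loop p = δ (proj₁ p) (proj₂ p)

        total′ : ∀ f → ∑ M f + (∑ (e ∷ B) f + ∑ U′ f) ≡ ∑ (edges n) f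
        total′ f = trans (cong (∑ M f +_) (trans (r (f e) (∑ B f) (∑ U′ f)) (cong (∑ B f +_) (e+U′ f)))) (total f)
          where
          r : ∀ a b c → a + b + c ≡ b + (a + c)
          r = solve-∀

        shrink : ∀ {c} → c ∈ C → length (proj₂ c) ≤ fuel
        shrink {c} c∈C = begin
          length (proj₂ c)        ≡⟨ ∑-one (proj₂ c) ⟨
          ∑ (proj₂ c) (λ _ → 1)   ≤⟨ ∑-unchosen≤ (m ⊓ length U′) U′ c∈C (λ _ → 1) ⟩
          ∑ U′ (λ _ → 1)          ≡⟨ suc-injective (e+U′ (λ _ → 1)) ⟩
          ∑ us (λ _ → 1)          ≡⟨ ∑-one us ⟩
          length us               ≤⟨ us≤fuel ⟩
          fuel                    ∎
          where open ≤-Reasoning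

        inv′ : ∀ {c} → c ∈ C → Inv t (M ++ proj₁ c) (e ∷ B) (proj₂ c) (next M B H e (proj₁ c))
        inv′ {c} c∈C = record
          { total = λ f → trans (cong (_+ (∑ (e ∷ B) f + ∑ (proj₂ c) f)) (∑-++ M (proj₁ c) f))
              (trans (r (∑ M f) (∑ (proj₁ c) f) (∑ (e ∷ B) f) (∑ (proj₂ c) f))
              (trans (cong (λ z → ∑ M f + (∑ (e ∷ B) f + z)) (∑-choices (m ⊓ length U′) U′ c∈C f)) (total′ f)))
          ; rounds = trans (sym (+-suc (length B) t)) rounds
          ; headAdj = next-adj M B H e (proj₁ c) headAdj
          ; headIn = next-in M B H e (proj₁ c) headIn
          ; headLim = next-lim M B H e (proj₁ c) x≢y headLim
          }
          where
          r : ∀ a b c d → a + b + (c + d) ≡ a + (c + (b + d))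
          r = solve-∀

        t<T : suc t ≤ T
        t<T = subst (suc t ≤_) rounds (m≤n+m (suc t) (length B))

        1≤m : 1 ≤ m
        1≤m = 1≤m*n⇒1≤n g m (subst (1 ≤_) (*-comm m g) (≤-trans 1≤n n≤mg))

        safe : ∀ v → Ψ (deg B v) (outHeads v H) (deg M v) < Z₂
        safe v = ≤-<-trans (Ψ≤Φ₂ (suc t) M B H v) Φ₂<

        average : ∑ C (λ c → Φ t (M ++ proj₁ c) (e ∷ B) (proj₂ c) (next M B H e (proj₁ c))) ≤ length C * Φ (suc t) M B U H
        average = begin
          ∑ C (λ c → P₁ c * Z₂ + P₂ c * y ^ n)
            ≡⟨ ∑-+ C (λ c → P₁ c * Z₂) (λ c → P₂ c * y ^ n) ⟩
          ∑ C (λ c → P₁ c * Z₂) + ∑ C (λ c → P₂ c * y ^ n)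
            ≡⟨ cong₂ _+_ (∑-*ʳ C P₁ Z₂) (∑-*ʳ C P₂ (y ^ n)) ⟩
          ∑ C P₁ * Z₂ + ∑ C P₂ * y ^ n
            ≤⟨ +-mono-≤ (*-monoˡ-≤ Z₂ (Φ₁-round m 1≤m M U U′ U′≤U U′-small t<T))
                        (*-monoˡ-≤ (y ^ n) (Φ₂-round M B U′ H e x≢y total′ U′-small 64≤n 64θ≤n (heads-few inv) safe t)) ⟩
          length C * Φ₁ (suc t) M U * Z₂ + length C * Φ₂ (suc t) M B H * y ^ n
            ≡⟨ r (length C) (Φ₁ (suc t) M U) Z₂ (Φ₂ (suc t) M B H) (y ^ n) ⟩
          length C * Φ (suc t) M B U H ∎
          where
          open ≤-Reasoning
          P₁ P₂ : List (Edge n) × List (Edge n) → ℕ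
          P₁ c = Φ₁ t (M ++ proj₁ c) (proj₂ c)
          P₂ c = Φ₂ t (M ++ proj₁ c) (e ∷ B) (next M B H e (proj₁ c))
          r : ∀ l p z q w → l * p * z + l * q * w ≡ l * (p * z + q * w)
          r = solve-∀

      game-likely : Likely (KConnected k n) W (game n m S) (Φ T [] [] (edges n) [])
      game-likely = likely-connected (length (edges n)) [] T [] [] (edges n) [] inv₀ ≤-refl
        where
        inv₀ : Inv T [] [] (edges n) []
        inv₀ = record
          { total = λ f → refl
          ; rounds = refl
          ; headAdj = λ ()
          ; headIn = λ w → z≤n
          ; headLim = λ v → z≤n
          }

-- The choice of parameters and the initial values of the potentials.

module Asymptotics where

  open FiniteSums
  open Probability
  open Graphs
  open CutPotential
  open AttackPotential
  open Gameplay
  open import Data.Nat using (ℕ; zero; suc; pred; _+_; _*_; _∸_; _^_; _≤_; _<_; _/_; NonZero; ⌊_/2⌋; z≤n; s≤s; >-nonZero)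
  open import Data.Nat.Properties
  open import Data.Nat.DivMod using (m/n*n≤m; m≡m%n+[m/n]*n; m%n<n)
  open import Data.Nat.Induction using (<-rec)
  open import Data.Nat.Logarithm using (⌊log₂_⌋; ⌊log₂⌋-mono-≤; ⌊log₂⌊n/2⌋⌋≡⌊log₂n⌋∸1; ⌊log₂[2^n]⌋≡n)
  open import Data.Nat.Tactic.RingSolver using (solve-∀)
  open import Data.List using ([]; length; allFin)
  open import Data.Sum using (inj₁; inj₂)
  open import Relation.Nullary using (contradiction)
  open import Relation.Binary.PropositionalEquality using (_≡_; sym; trans; cong; subst)
  open import Defs using (edges)

  n<2^[1+log₂n] : ∀ n → n < 2 ^ suc ⌊log₂ n ⌋
  n<2^[1+log₂n] n with <-≤-connex n (2 ^ suc ⌊log₂ n ⌋)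
  ... | inj₁ lt = lt
  ... | inj₂ ge = contradiction (subst (_≤ ⌊log₂ n ⌋) (⌊log₂[2^n]⌋≡n (suc ⌊log₂ n ⌋)) (⌊log₂⌋-mono-≤ ge)) 1+n≰n

  2^log₂n≤n : ∀ n → 1 ≤ n → 2 ^ ⌊log₂ n ⌋ ≤ n
  2^log₂n≤n = <-rec (λ n → 1 ≤ n → 2 ^ ⌊log₂ n ⌋ ≤ n) go
    where
    go : ∀ n → (∀ {i} → i < n → 1 ≤ i → 2 ^ ⌊log₂ i ⌋ ≤ i) → 1 ≤ n → 2 ^ ⌊log₂ n ⌋ ≤ n
    go 1 rec _ = ≤-refl
    go n@(suc (suc n′)) rec _ = begin
      2 ^ ⌊log₂ n ⌋                 ≡⟨ cong (2 ^_) (m+[n∸m]≡n (⌊log₂⌋-mono-≤ {2} {n} (s≤s (s≤s z≤n)))) ⟨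
      2 ^ suc (⌊log₂ n ⌋ ∸ 1)       ≡⟨ cong (λ z → 2 ^ suc z) (⌊log₂⌊n/2⌋⌋≡⌊log₂n⌋∸1 n) ⟨
      2 * 2 ^ ⌊log₂ ⌊ n /2⌋ ⌋       ≤⟨ *-monoʳ-≤ 2 (rec (⌊n/2⌋<n (suc n′)) (s≤s z≤n)) ⟩
      2 * ⌊ n /2⌋                   ≤⟨ 2⌊n/2⌋≤n n ⟩
      n                             ∎
      where open ≤-Reasoning

  -- This is `(1 + L) ^ 2 ≤ 2 ^ L` for `L = 6 + i`; it fails for `L = 5`.
  square≤2^ : ∀ i → (7 + i) * (7 + i) ≤ 2 ^ (6 + i)
  square≤2^ zero    = m≤m+n 49 15
  square≤2^ (suc i) = begin
    (7 + suc i) * (7 + suc i)                     ≤⟨ m≤m+n _ (34 + 12 * i + i * i) ⟩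
    (7 + suc i) * (7 + suc i) + (34 + 12 * i + i * i) ≡⟨ r i ⟩
    2 * ((7 + i) * (7 + i))                       ≤⟨ *-monoʳ-≤ 2 (square≤2^ i) ⟩
    2 * 2 ^ (6 + i)                               ≡⟨ cong (2 ^_) (+-suc 6 i) ⟨
    2 ^ (6 + suc i)                               ∎
    where
    open ≤-Reasoning
    r : ∀ i → (7 + suc i) * (7 + suc i) + (34 + 12 * i + i * i) ≡ 2 * ((7 + i) * (7 + i))
    r = solve-∀

  m<suc[m/n]*n : ∀ m n .{{_ : NonZero n}} → m < suc (m / n) * n
  m<suc[m/n]*n m n = subst (_< suc (m / n) * n) (sym (m≡m%n+[m/n]*n m n)) (+-monoˡ-< (m / n * n) (m%n<n m n))

  m≤2*[m/n]*n : ∀ m n .{{_ : NonZero n}} → 1 ≤ m / n → m ≤ 2 * (m / n) * n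
  m≤2*[m/n]*n m n 1≤q = ≤-trans (<⇒≤ (m<suc[m/n]*n m n))
    (*-monoˡ-≤ n (+-mono-≤ 1≤q (≤-reflexive (sym (+-identityʳ (m / n))))))

  1≤m/n : ∀ m n .{{_ : NonZero n}} → n ≤ m → 1 ≤ m / n
  1≤m/n m n n≤m with m / n | m<suc[m/n]*n m n
  ... | zero  | m<n = contradiction n≤m (<⇒≱ (subst (m <_) (+-identityʳ n) m<n))
  ... | suc _ | _   = s≤s z≤n

  -- With it `few` reduces to `c₁ k * (1 + L) ≤ θ`; 2048 is `128 * 2 * 8`, the 8 coming from `T`.
  c₁ : ℕ → ℕ
  c₁ k = 2048 * (suc k * (k + 3))

  -- `2 (j + 1)` times the initial `Φ₂ / Z₂` is at most `c₂ k j * (1 + L) * (α / β) ^ θ`; 4096 is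
  -- `2 * 8 * 2 * 128`, the last factor from `n ≤ 128 * θ`.
  c₂ : ℕ → ℕ → ℕ
  c₂ k j = 4096 * suc j * 2 ^ (2 * suc k) * (k + 3)

  L₀ : ℕ → ℕ → ℕ
  L₀ k j = 6 + (128 * c₁ k + c₂ k j)

  module Parameters (k j n m : ℕ) (n-large : 2 ^ L₀ k j ≤ n) (m-large : 9216 * ⌊log₂ ⌊log₂ n ⌋ ⌋ ≤ m) where

    -- `E` makes `K` at least `(1 + n) ^ (k + 3)`: `k` powers pay for the choice of `X`, the other
    -- three for `2n` and `2 (j + 1)`. `T` is long enough for `(1 - 1 / (8n)) ^ T ≤ 1 / K`. `e`
    -- makes `2 ^ e` at least `(1 + L) ^ 2`, and the 9 in `g` ensures `α * e ≤ θ`, because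
    -- `α ≤ 9 * g`.
    L ℓ e E K T θ a : ℕ
    L = ⌊log₂ n ⌋
    ℓ = ⌊log₂ L ⌋
    e = 2 * suc ℓ
    E = suc L * (k + 3)
    K = 2 ^ E
    T = 8 * n * E
    θ = n / 64
    a = pred (8 * n)

    g : ℕ
    g = θ / (9 * e)

    private
      L₀≤L : L₀ k j ≤ L
      L₀≤L = subst (_≤ L) (⌊log₂[2^n]⌋≡n (L₀ k j)) (⌊log₂⌋-mono-≤ n-large)

      6≤L : 6 ≤ L
      6≤L = m+n≤o⇒m≤o 6 L₀≤L

      128c₁≤L : 128 * c₁ k ≤ L
      128c₁≤L = m+n≤o⇒m≤o (128 * c₁ k) (m+n≤o⇒n≤o 6 L₀≤L)

      c₂≤L : c₂ k j ≤ L
      c₂≤L = m+n≤o⇒n≤o (128 * c₁ k) (m+n≤o⇒n≤o 6 L₀≤L)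

      1≤n : 1 ≤ n
      1≤n = ≤-trans (m^n>0 2 (L₀ k j)) n-large

      2^L≤n : 2 ^ L ≤ n
      2^L≤n = 2^log₂n≤n n 1≤n

      [1+L]²≤n : suc L * suc L ≤ n
      [1+L]²≤n = ≤-trans (subst (λ z → suc z * suc z ≤ 2 ^ z) (m+[n∸m]≡n 6≤L) (square≤2^ (L ∸ 6))) 2^L≤n

      L<n : L < n
      L<n = ≤-trans (m≤m*n (suc L) (suc L)) [1+L]²≤n

      n≤128θ : n ≤ 128 * θ
      n≤128θ = ≤-trans (m≤2*[m/n]*n n 64 1≤θ) (≤-reflexive (r θ))
        where
        1≤θ : 1 ≤ θ
        1≤θ = 1≤m/n n 64 (≤-trans (^-monoʳ-≤ 2 6≤L) 2^L≤n)
        r : ∀ x → 2 * x * 64 ≡ 128 * x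
        r = solve-∀

      c₁[1+L]≤θ : c₁ k * suc L ≤ θ
      c₁[1+L]≤θ = *-cancelˡ-≤ 128 (begin
        128 * (c₁ k * suc L) ≡⟨ *-assoc 128 (c₁ k) (suc L) ⟨
        128 * c₁ k * suc L   ≤⟨ *-monoˡ-≤ (suc L) (m≤n⇒m≤1+n 128c₁≤L) ⟩
        suc L * suc L        ≤⟨ [1+L]²≤n ⟩
        n                    ≤⟨ n≤128θ ⟩
        128 * θ              ∎)
        where open ≤-Reasoning

      1≤[1+k][3+k] : 1 ≤ suc k * (k + 3)
      1≤[1+k][3+k] = *-mono-≤ (s≤s (z≤n {k})) (m≤n⇒m≤o+n k (s≤s (z≤n {2})))

      1≤ℓ : 1 ≤ ℓ
      1≤ℓ = ⌊log₂⌋-mono-≤ (m+n≤o⇒m≤o 2 6≤L)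

      ℓ≤L : ℓ ≤ L
      ℓ≤L = ≤-trans (<⇒≤ (m<2^m ℓ)) (2^log₂n≤n L (m+n≤o⇒m≤o 1 6≤L))
        where
        m<2^m : ∀ i → i < 2 ^ i
        m<2^m zero    = s≤s z≤n
        m<2^m (suc i) = ≤-trans (+-mono-≤ (m^n>0 2 i) (m<2^m i)) (≤-reflexive (cong (2 ^ i +_) (sym (+-identityʳ (2 ^ i)))))

      9e≤θ : 9 * e ≤ θ
      9e≤θ = begin
        9 * (2 * suc ℓ)     ≡⟨ *-assoc 9 2 (suc ℓ) ⟨
        18 * suc ℓ          ≤⟨ *-mono-≤ 18≤c₁ (s≤s ℓ≤L) ⟩
        c₁ k * suc L        ≤⟨ c₁[1+L]≤θ ⟩
        θ                   ∎
        where
        open ≤-Reasoning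
        18≤c₁ : 18 ≤ c₁ k
        18≤c₁ = *-mono-≤ (m≤m+n 18 2030) 1≤[1+k][3+k]

    1≤g : 1 ≤ g
    1≤g = 1≤m/n θ (9 * e) 9e≤θ

    d≡8n : suc a ≡ 8 * n
    d≡8n = suc-pred (8 * n) {{>-nonZero (≤-trans 1≤n (m≤n*m n 8))}}

    64≤n : 64 ≤ n
    64≤n = ≤-trans (^-monoʳ-≤ 2 6≤L) 2^L≤n

    1≤θ : 1 ≤ θ
    1≤θ = 1≤m/n n 64 64≤n

    64θ≤n : 64 * θ ≤ n
    64θ≤n = subst (_≤ n) (*-comm θ 64) (m/n*n≤m n 64)

    64k≤n : 64 * k ≤ n
    64k≤n = begin
      64 * k      ≤⟨ *-mono-≤ (m≤m+n 64 64) k≤c₁ ⟩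
      128 * c₁ k  ≤⟨ 128c₁≤L ⟩
      L           ≤⟨ <⇒≤ L<n ⟩
      n           ∎
      where
      open ≤-Reasoning
      k≤c₁ : k ≤ c₁ k
      k≤c₁ = ≤-trans (≤-trans (m≤n⇒m≤1+n ≤-refl) (m≤m*n (suc k) (k + 3) {{>-nonZero (m≤n⇒m≤o+n k (s≤s (z≤n {2})))}}))
                     (m≤n*m (suc k * (k + 3)) 2048)

    -- Here 9216 arises as `128 * 2 * 9 * 2 * 2`: 64 doubled for rounding `θ`, 2 for rounding `g`,
    -- the 9 in `g`, the 2 in `e`, and 2 for `1 + ℓ ≤ 2 * ℓ`.
    n≤mg : n ≤ m * g
    n≤mg = begin
      n                                  ≤⟨ n≤128θ ⟩
      128 * θ                            ≤⟨ *-monoʳ-≤ 128 (m≤2*[m/n]*n θ (9 * e) 1≤g) ⟩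
      128 * (2 * g * (9 * (2 * suc ℓ)))  ≡⟨ r g (suc ℓ) ⟩
      4608 * (1 + ℓ) * g                 ≤⟨ *-monoˡ-≤ g (*-monoʳ-≤ 4608 (+-monoˡ-≤ ℓ 1≤ℓ)) ⟩
      4608 * (ℓ + ℓ) * g                 ≡⟨ cong (_* g) (trans (cong (λ z → 4608 * (ℓ + z)) (sym (+-identityʳ ℓ))) (sym (*-assoc 4608 2 ℓ))) ⟩
      9216 * ℓ * g                       ≤⟨ *-monoˡ-≤ g m-large ⟩
      m * g                              ∎
      where
      open ≤-Reasoning
      r : ∀ g l → 128 * (2 * g * (9 * (2 * l))) ≡ 4608 * l * g
      r = solve-∀

    few : 128 * (2 * suc k * T) ≤ n * θ
    few = begin
      128 * (2 * suc k * (8 * n * (suc L * (k + 3))))   ≡⟨ r (suc k) n (suc L) (k + 3) ⟩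
      n * (c₁ k * suc L)                                ≤⟨ *-monoʳ-≤ n c₁[1+L]≤θ ⟩
      n * θ                                             ∎
      where
      open ≤-Reasoning
      r : ∀ p n l q → 128 * (2 * p * (8 * n * (l * q))) ≡ n * (2048 * (p * q) * l)
      r = solve-∀

    open Play n m k T a θ g d≡8n 64≤n 1≤θ 64θ≤n 64k≤n n≤mg few hiding (1≤n) public

    private
      K≡ : K ≡ (2 ^ suc L) ^ (k + 3)
      K≡ = sym (^-*-assoc 2 (suc L) (k + 3))

      [1+n]^≤K : suc n ^ k * suc n ^ 3 ≤ K
      [1+n]^≤K = begin
        suc n ^ k * suc n ^ 3     ≡⟨ ^-distribˡ-+-* (suc n) k 3 ⟨
        suc n ^ (k + 3)           ≤⟨ ^-monoˡ-≤ (k + 3) (n<2^[1+log₂n] n) ⟩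
        (2 ^ suc L) ^ (k + 3)     ≡⟨ K≡ ⟨
        K                         ∎
        where open ≤-Reasoning

      4[1+j]≤n : 4 * suc j ≤ n
      4[1+j]≤n = begin
        4 * suc j                               ≤⟨ *-monoˡ-≤ (suc j) (m≤m+n 4 4092) ⟩
        4096 * suc j                            ≤⟨ m≤m*n (4096 * suc j) (2 ^ (2 * suc k)) {{m^n≢0 2 (2 * suc k)}} ⟩
        4096 * suc j * 2 ^ (2 * suc k)          ≤⟨ m≤m*n (4096 * suc j * 2 ^ (2 * suc k)) (k + 3) {{>-nonZero (m≤n⇒m≤o+n k (s≤s (z≤n {2})))}} ⟩
        c₂ k j                                  ≤⟨ c₂≤L ⟩
        L                                       ≤⟨ <⇒≤ L<n ⟩
        n                                       ∎
        where open ≤-Reasoning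

      4n[1+j]≤[1+n]³ : 2 * n * (2 * suc j) ≤ suc n ^ 3
      4n[1+j]≤[1+n]³ = begin
        2 * n * (2 * suc j)             ≡⟨ r n (suc j) ⟩
        n * (4 * suc j)                 ≤⟨ *-mono-≤ (n≤1+n n) (≤-trans 4[1+j]≤n (n≤1+n n)) ⟩
        suc n * suc n                   ≤⟨ *-monoʳ-≤ (suc n) (m≤m*n (suc n) (suc n ^ 1) {{m^n≢0 (suc n) 1}}) ⟩
        suc n ^ 3                       ∎
        where
        open ≤-Reasoning
        r : ∀ n j → 2 * n * (2 * j) ≡ n * (4 * j)
        r = solve-∀

      2n≤K : 2 * n ≤ K
      2n≤K = begin
        2 * n                 ≤⟨ m≤m*n (2 * n) (2 * suc j) ⟩
        2 * n * (2 * suc j)   ≤⟨ 4n[1+j]≤[1+n]³ ⟩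
        suc n ^ 3             ≤⟨ m≤n*m (suc n ^ 3) (suc n ^ k) {{m^n≢0 (suc n) k}} ⟩
        suc n ^ k * suc n ^ 3 ≤⟨ [1+n]^≤K ⟩
        K                     ∎
        where open ≤-Reasoning

      Ka≤d : K * a ^ T ≤ d ^ T
      Ka≤d = power-doubling a E T 1≤a aE≤T
        where
        1≤a : 1 ≤ a
        1≤a = pred-mono-≤ (≤-trans (s≤s (s≤s z≤n)) (≤-trans 64≤n (m≤n*m n 8)))
        aE≤T : a * E ≤ T
        aE≤T = *-monoˡ-≤ E (pred[n]≤n {8 * n})

    Φ₁-small : Φ₁ T [] (edges n) * (2 * suc j) ≤ y ^ n
    Φ₁-small = *-cancelʳ-≤ _ _ K {{m^n≢0 2 E}} (begin
      Φ₁ T [] (edges n) * (2 * suc j) * K        ≡⟨ r₁ (Φ₁ T [] (edges n)) (2 * suc j) K ⟩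
      Φ₁ T [] (edges n) * K * (2 * suc j)        ≤⟨ *-monoˡ-≤ (2 * suc j) (Φ₁-init K [] (edges n) Ka≤d 2n≤K) ⟩
      length cuts * (2 * n) * y ^ n * (2 * suc j) ≡⟨ r₂ (length cuts) (2 * n) (y ^ n) (2 * suc j) ⟩
      y ^ n * (length cuts * (2 * n * (2 * suc j))) ≤⟨ *-monoʳ-≤ (y ^ n) (*-mono-≤ (length-shortLists n k) 4n[1+j]≤[1+n]³) ⟩
      y ^ n * (suc n ^ k * suc n ^ 3)            ≤⟨ *-monoʳ-≤ (y ^ n) [1+n]^≤K ⟩
      y ^ n * K                                  ∎)
      where
      open ≤-Reasoning
      r₁ : ∀ p q r → p * q * r ≡ p * r * q
      r₁ = solve-∀
      r₂ : ∀ l q p s → l * q * p * s ≡ p * (l * (q * s))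
      r₂ = solve-∀

    -- Only the reserve `2 * κ * T` is present at the start. Of the two factors `1 + L` contained in
    -- `2 ^ e` one pays for the logarithm in `T`, the other for the constant `c₂ k j`.
    Φ₂-small : Φ₂ T [] [] [] * (2 * suc j) ≤ Z₂
    Φ₂-small = begin
      (∑ᶠ n (λ v → Ψ 0 0 0) + 2 * κ * T) * (2 * suc j) ≡⟨ cong (λ z → (z + 2 * κ * T) * (2 * suc j)) (trans (∑-cong (allFin n) (λ _ → Ψ-low 0 0 0 1≤θ)) (∑-zero (allFin n))) ⟩
      2 * (2 ^ D * α ^ θ) * T * (2 * suc j)     ≡⟨ r₁ (2 ^ D) (α ^ θ) n E (suc j) ⟩
      32 * suc j * 2 ^ D * E * α ^ θ * n        ≤⟨ *-monoʳ-≤ (32 * suc j * 2 ^ D * E * α ^ θ) n≤128θ ⟩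
      32 * suc j * 2 ^ D * E * α ^ θ * (128 * θ) ≡⟨ r₂ (suc j) (2 ^ D) (suc L) (k + 3) (α ^ θ) θ ⟩
      θ * (c₂ k j * suc L * α ^ θ)              ≤⟨ *-monoʳ-≤ θ (*-monoˡ-≤ (α ^ θ) (*-monoˡ-≤ (suc L) (m≤n⇒m≤1+n c₂≤L))) ⟩
      θ * (suc L * suc L * α ^ θ)               ≤⟨ *-monoʳ-≤ θ (*-monoˡ-≤ (α ^ θ) [1+L]²≤2^e) ⟩
      θ * (2 ^ e * α ^ θ)                       ≤⟨ *-monoʳ-≤ θ (power-doubling α e θ (m≤n+m 1 (8 * g)) αe≤θ) ⟩
      θ * β ^ θ                                 ∎
      where
      open ≤-Reasoning
      r₁ : ∀ p q n E j → 2 * (p * q) * (8 * n * E) * (2 * j) ≡ 32 * j * p * E * q * n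
      r₁ = solve-∀
      r₂ : ∀ j p l q s θ → 32 * j * p * (l * q) * s * (128 * θ) ≡ θ * (4096 * j * p * q * l * s)
      r₂ = solve-∀
      [1+L]²≤2^e : suc L * suc L ≤ 2 ^ e
      [1+L]²≤2^e = begin
        suc L * suc L             ≤⟨ *-mono-≤ (n<2^[1+log₂n] L) (n<2^[1+log₂n] L) ⟩
        2 ^ suc ℓ * 2 ^ suc ℓ     ≡⟨ ^-distribˡ-+-* 2 (suc ℓ) (suc ℓ) ⟨
        2 ^ (suc ℓ + suc ℓ)       ≡⟨ cong (λ z → 2 ^ (suc ℓ + z)) (+-identityʳ (suc ℓ)) ⟨
        2 ^ e                     ∎
      αe≤θ : α * e ≤ θ
      αe≤θ = begin
        (8 * g + 1) * e   ≤⟨ *-monoˡ-≤ e (+-monoʳ-≤ (8 * g) 1≤g) ⟩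
        (8 * g + g) * e   ≡⟨ r₃ g e ⟩
        g * (9 * e)       ≤⟨ m/n*n≤m θ (9 * e) ⟩
        θ                 ∎
        where
        r₃ : ∀ g e → (8 * g + g) * e ≡ g * (9 * e)
        r₃ = solve-∀

    Φ-small : Φ T [] [] (edges n) [] * suc j ≤ W
    Φ-small = *-cancelˡ-≤ 2 (begin
      2 * ((p * Z₂ + q * y ^ n) * suc j)                  ≡⟨ r₁ p Z₂ q (y ^ n) (suc j) ⟩
      p * (2 * suc j) * Z₂ + q * (2 * suc j) * y ^ n      ≤⟨ +-mono-≤ (*-monoˡ-≤ Z₂ Φ₁-small) (*-monoˡ-≤ (y ^ n) Φ₂-small) ⟩
      y ^ n * Z₂ + Z₂ * y ^ n                             ≡⟨ r₂ (y ^ n) Z₂ ⟩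
      2 * (y ^ n * Z₂)                                    ∎)
      where
      open ≤-Reasoning
      p = Φ₁ T [] (edges n)
      q = Φ₂ T [] [] []
      r₁ : ∀ p z q w j → 2 * ((p * z + q * w) * j) ≡ p * (2 * j) * z + q * (2 * j) * w
      r₁ = solve-∀
      r₂ : ∀ w z → w * z + z * w ≡ 2 * (w * z)
      r₂ = solve-∀

    1≤W : 1 ≤ W
    1≤W = *-mono-≤ (m^n>0 (d ^ T) {{m^n≢0 d T}} n) (*-mono-≤ 1≤θ (m^n>0 β θ))

open import Defs
open import Data.Nat using (ℕ; suc; _≤_; _<_; _*_; _^_; z≤n; s≤s)
open import Data.Nat.Logarithm using (⌊log₂_⌋)
open import Data.Product using (Σ; _×_; proj₂; _,_)
open import Data.List using (List)
open import Data.List.Relation.Unary.All using (All)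
open import Data.List.Relation.Binary.Sublist.Propositional using (_⊆_)
open import Data.Integer using (+_)
open import Data.Rational using (ℚ; 1ℚ; _-_; _/_) renaming (_≤_ to _≤ℚ_)

theorem1p6 : (k : ℕ) → 0 < k →
    Σ ℕ λ A → 0 < A ×
    ((j : ℕ) → Σ ℕ λ N → (n : ℕ) → N ≤ n →
    (m : ℕ) → A * ⌊log₂ ⌊log₂ n ⌋ ⌋ ≤ m →
    (S : Strategy n) →
    Σ (List (ℚ × List (Edge n))) λ good →
    (good ⊆ game n m S) ×
    All (λ o → KConnected k n (proj₂ o)) good ×
    (1ℚ - (+ 1) / suc j ≤ℚ sumW good))
theorem1p6 k _ = 9216 , s≤s z≤n , λ j → 2 ^ Asymptotics.L₀ k j , λ n n-large m m-large S →
  let module P = Asymptotics.Parameters k j n m n-large m-large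
      l = P.game-likely S
      open Probability.Likely l
  in good , good⊆ , allQ , Probability.Likely-weight j P.1≤W P.Φ-small l
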